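{- Let $k>0$ and $\alpha=(\alpha_1,\dots,\alpha_r)\in[k]^r$ with $\alpha_1+\cdots+\alpha_r=n$. With respect to the neglex term order on $\mathbb{Q}[x_1,\dots,x_n]$, the set $\mathcal{M}_{\alpha,k}$ of $\alpha$-nonskip monomials is the standard monomial basis of $S_{\alpha,k}=\mathbb{Q}[\mathbf{x}_n]/J_{\alpha,k}$. Moreover there is an isomorphism of ungraded $\mathfrak{S}_\alpha$-modules $S_{\alpha,k}\cong\mathbb{Q}[\mathcal{OP}_{\alpha,k}]$.
   Context: $\mathbf{x}^{(i)}_n=(x_{\alpha_1+\cdots+\alpha_{i-1}+1},\dots,x_{\alpha_1+\cdots+\alpha_i})$ is the $i$-th batch of variables. $J_{\alpha,k}\subseteq\mathbb{Q}[x_1,\dots,x_n]$ is the ideal generated by $e_n(\mathbf{x}_n),\dots,e_{n-k+1}(\mathbf{x}_n)$ and by $h_{k-\alpha_i+1}(\mathbf{x}^{(i)}_n),\dots,h_k(\mathbf{x}^{(i)}_n)$, $1\le i\le r$. Neglex order: $x^a<x^b$ iff there is $i$ with $a_i<b_i$ and $a_j=b_j$ for all $j>i$. Standard monomials are monomials not in the initial ideal. For $S=\{s_1<\cdots<s_t\}\subseteq[n]$, $\gamma(S)=(\gamma_1,\dots,\gamma_n)$ with $\gamma_i=i-j+1$ if $i=s_j$ and $0$ if $i\notin S$; $\mathbf{x}(S)^*=x_1^{\gamma_n}\cdots x_n^{\gamma_1}$. A monomial $m$ is $\alpha$-nonskip if $\mathbf{x}(S)^*\nmid m$ for all $S\subseteq[n]$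 with $|S|=n-k+1$ and $x_{\alpha_1+\cdots+\alpha_{i-1}+j}^{k-j+1}\nmid m$ for all $1\le i\le r$, $1\le j\le\alpha_i$. $\mathcal{OP}_{\alpha,k}$ is the set of ordered set partitions $(B_1\mid\cdots\mid B_k)$ of $[n]$ into $k$ nonempty blocks such that, for each $i$, the letters $\alpha_1+\cdots+\alpha_{i-1}+1,\dots,\alpha_1+\cdots+\alpha_i$ lie in distinct blocks. The parabolic subgroup $\mathfrak{S}_\alpha=\mathfrak{S}_{\alpha_1}\times\cdots\times\mathfrak{S}_{\alpha_r}\subseteq\mathfrak{S}_n$ (the $i$-th factor permuting the $i$-th batch of indices) acts on $S_{\alpha,k}$ by permuting variable subscripts and on $\mathcal{OP}_{\alpha,k}$ by permuting letters.
   Formalization: The assumption k ≤ n is added: for k ≥ n+2 the ideal contains e_0 = 1, so the quotient is zero, yet the monomial 1 is α-nonskip and the claim fails; for k = n+1 (also excluded) the quotient is zero and both sides are empty. -}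

module Defs where

open import Data.Nat as ℕ using (ℕ; zero; suc; _∸_; _≤_; _<_; _≤ᵇ_; _<ᵇ_)
open import Data.Bool using (Bool; true; false; if_then_else_; _∧_)
open import Data.Fin using (Fin; toℕ)
open import Data.Fin.Subset using (Subset; ∣_∣)
open import Data.Fin.Permutation using (Permutation′; _⟨$⟩ʳ_; _⟨$⟩ˡ_)
open import Data.Vec as Vec using (Vec; []; _∷_; lookup; tabulate; zipWith; replicate; reverse)
open import Data.Vec.Properties using (≡-dec)
open import Data.List as List using (List; []; _∷_; _++_; map; concat; concatMap; allFin; upTo)
open import Data.List.Membership.Propositional using (_∈_)
open import Data.List.Relation.Unary.All using (All)
import Data.Nat.ListAction as ListAction
open import Data.Rational as ℚ using (ℚ; 0ℚ; 1ℚ)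
import Data.Rational.Properties as ℚP
open import Data.Product using (Σ; ∃; _×_; _,_; proj₁; proj₂)
open import Data.Sum using (_⊎_)
open import Data.Empty using (⊥)
open import Relation.Binary.PropositionalEquality using (_≡_; _≢_)
open import Relation.Binary.Definitions using (DecidableEquality)
open import Relation.Nullary using (¬_; yes; no)
open import Function.Bundles using (_⇔_)

-- Finitely supported formal ℚ-linear combinations over a set X
-- (a list of (coefficient , basis element), read as a formal sum).
-- Two such sums are equal when all coefficients agree.

Free : Set → Set
Free X = List (ℚ × X)

coeff : {X : Set} → DecidableEquality X → Free X → X → ℚ
coeff _≟_ [] x = 0ℚ
coeff _≟_ ((c , y) ∷ v) x with y ≟ x
... | yes _ = c ℚ.+ coeff _≟_ v x
... | no _  = coeff _≟_ v x

FreeEq : {X : Set} → DecidableEquality X → Free X → Free X → Set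
FreeEq _≟_ u v = ∀ x → coeff _≟_ u x ≡ coeff _≟_ v x

scaleF : {X : Set} → ℚ → Free X → Free X
scaleF c = map (λ t → (c ℚ.* proj₁ t , proj₂ t))

-- Polynomials in ℚ[x_1,…,x_n]; the variable x_{i+1} has index i : Fin n.
-- A monomial is its exponent vector.

Monomial : ℕ → Set
Monomial n = Vec ℕ n

_≟ₘ_ : ∀ {n} → DecidableEquality (Monomial n)
_≟ₘ_ = ≡-dec ℕ._≟_

Poly : ℕ → Set
Poly n = Free (Monomial n)

coeffP : ∀ {n} → Poly n → Monomial n → ℚ
coeffP = coeff _≟ₘ_

_≈ₚ_ : ∀ {n} → Poly n → Poly n → Set
p ≈ₚ q = FreeEq _≟ₘ_ p q

zeroP : ∀ {n} → Poly n
zeroP = []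

oneP : ∀ {n} → Poly n
oneP = (1ℚ , replicate _ 0) ∷ []

unitVec : ∀ {n} → Fin n → Monomial n
unitVec i = tabulate (λ j → if toℕ j ℕ.≡ᵇ toℕ i then 1 else 0)

var : ∀ {n} → Fin n → Poly n
var i = (1ℚ , unitVec i) ∷ []

_+ₚ_ : ∀ {n} → Poly n → Poly n → Poly n
p +ₚ q = p ++ q

_*ₚ_ : ∀ {n} → Poly n → Poly n → Poly n
p *ₚ q = concatMap (λ s → map (λ t → (proj₁ s ℚ.* proj₁ t , zipWith ℕ._+_ (proj₂ s) (proj₂ t))) q) p

_-ₚ_ : ∀ {n} → Poly n → Poly n → Poly n
p -ₚ q = p ++ scaleF (ℚ.- 1ℚ) q

sumP : ∀ {n} → List (Poly n) → Poly n
sumP = concat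

InIdeal : ∀ {n} → List (Poly n) → Poly n → Set
InIdeal {n} gs p =
  Σ (List (Poly n × Poly n)) λ cs →
    All (λ c → proj₂ c ∈ gs) cs × (p ≈ₚ sumP (map (λ c → proj₁ c *ₚ proj₂ c) cs))

-- Neglex order: x^a < x^b iff ∃ i, a_i < b_i and a_j = b_j for all j > i.
-- Since the head of the vector is x_1, the tail is compared first.

_<nl_ : ∀ {n} → Monomial n → Monomial n → Set
[] <nl [] = ⊥
(a ∷ as) <nl (b ∷ bs) = (as <nl bs) ⊎ ((as ≡ bs) × (a < b))

_≤nl_ : ∀ {n} → Monomial n → Monomial n → Set
a ≤nl b = (a ≡ b) ⊎ (a <nl b)

LeadMon : ∀ {n} → Poly n → Monomial n → Set
LeadMon p m = (coeffP p m ≢ 0ℚ) × (∀ m' → coeffP p m' ≢ 0ℚ → m' ≤nl m)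

_∣ₘ_ : ∀ {n} → Monomial n → Monomial n → Set
a ∣ₘ b = ∀ i → lookup a i ≤ lookup b i

InInitial : ∀ {n} → List (Poly n) → Monomial n → Set
InInitial {n} gs m =
  Σ (Poly n) λ p → Σ (Monomial n) λ m' → InIdeal gs p × LeadMon p m' × (m' ∣ₘ m)

Standard : ∀ {n} → List (Poly n) → Monomial n → Set
Standard gs m = ¬ InInitial gs m

esym : ∀ {n} → List (Fin n) → ℕ → Poly n
esym []       zero    = oneP
esym []       (suc d) = zeroP
esym (i ∷ is) zero    = oneP
esym (i ∷ is) (suc d) = esym is (suc d) +ₚ (var i *ₚ esym is d)

hsym : ∀ {n} → List (Fin n) → ℕ → Poly n
hsym []       zero    = oneP
hsym []       (suc d) = zeroP
hsym (i ∷ is) zero    = oneP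
hsym (i ∷ is) (suc d) = hsym is (suc d) +ₚ (var i *ₚ hsym (i ∷ is) d)

offset : ∀ {r} → Vec ℕ r → Fin r → ℕ
offset (a ∷ as) Fin.zero    = 0
offset (a ∷ as) (Fin.suc i) = a ℕ.+ offset as i

InBatch : ∀ {r n} → Vec ℕ r → Fin n → Fin r → Set
InBatch α p i = (offset α i ≤ toℕ p) × (toℕ p < offset α i ℕ.+ lookup α i)

filterᵇ : {A : Set} → (A → Bool) → List A → List A
filterᵇ f [] = []
filterᵇ f (x ∷ xs) = if f x then x ∷ filterᵇ f xs else filterᵇ f xs

batchVars : ∀ {r} n → Vec ℕ r → Fin r → List (Fin n)
batchVars n α i =
  filterᵇ (λ p → (offset α i ≤ᵇ toℕ p) ∧ (toℕ p <ᵇ offset α i ℕ.+ lookup α i)) (allFin n)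

eGens : ∀ n → ℕ → List (Poly n)
eGens n k = map (λ t → esym (allFin n) (n ∸ t)) (upTo k)

hGens : ∀ {r} n → ℕ → Vec ℕ r → List (Poly n)
hGens {r} n k α =
  concatMap (λ i → map (λ t → hsym (batchVars n α i) (k ∸ t)) (upTo (lookup α i))) (allFin r)

Jgens : ∀ {r} n → ℕ → Vec ℕ r → List (Poly n)
Jgens n k α = eGens n k ++ hGens n k α

countUpTo : ∀ {n} → Subset n → Fin n → ℕ
countUpTo {n} S i =
  ListAction.sum (map (λ q → if (toℕ q ≤ᵇ toℕ i) ∧ lookup S q then 1 else 0) (allFin n))

-- γ(S): γ_i = i - j + 1 if i = s_j, and 0 if i ∉ S  (1-based i; here the
-- 1-based index of position q is toℕ q + 1 and j = countUpTo S q)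
gamma : ∀ {n} → Subset n → Vec ℕ n
gamma S = tabulate (λ q → if lookup S q then (suc (toℕ q) ∸ countUpTo S q) ℕ.+ 1 else 0)

xStar : ∀ {n} → Subset n → Monomial n
xStar S = reverse (gamma S)

-- exponent of the variable with 0-based index p (0 if out of range)
expAt : ∀ {n} → Monomial n → ℕ → ℕ
expAt [] p = 0
expAt (e ∷ m) zero = e
expAt (e ∷ m) (suc p) = expAt m p

Nonskip : ∀ {r n} → ℕ → Vec ℕ r → Monomial n → Set
Nonskip {r} {n} k α m =
  (∀ (S : Subset n) → ∣ S ∣ ≡ (n ∸ k) ℕ.+ 1 → ¬ (xStar S ∣ₘ m))
  × (∀ (i : Fin r) (j : ℕ) → 1 ≤ j → j ≤ lookup α i →
       -- x_{α_1+⋯+α_{i-1}+j}^{k-j+1} ∤ m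
       ¬ ((k ∸ j) ℕ.+ 1 ≤ expAt m ((offset α i ℕ.+ j) ∸ 1)))

-- Ordered set partitions in OP_{α,k}.  A word w : Vec (Fin k) n records
-- the block of each letter: letter p lies in block B_{w(p)+1}.

IsOP : ∀ {r n k} → Vec ℕ r → Vec (Fin k) n → Set
IsOP {r} {n} {k} α w =
  (∀ (b : Fin k) → ∃ λ (p : Fin n) → lookup w p ≡ b)
  × (∀ (p p' : Fin n) (i : Fin r) → InBatch α p i → InBatch α p' i →
       p ≢ p' → lookup w p ≢ lookup w p')

-- ℚ-combinations of words; ℚ[OP_{α,k}] is the subspace of those supported on OP_{α,k}.
_≟w_ : ∀ {n k} → DecidableEquality (Vec (Fin k) n)
_≟w_ = ≡-dec Data.Fin._≟_

Words : ℕ → ℕ → Set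
Words n k = Free (Vec (Fin k) n)

_≈w_ : ∀ {n k} → Words n k → Words n k → Set
u ≈w v = FreeEq _≟w_ u v

SupportedOnOP : ∀ {r n k} → Vec ℕ r → Words n k → Set
SupportedOnOP α v = ∀ w → ¬ IsOP α w → coeff _≟w_ v w ≡ 0ℚ

InYoungSubgroup : ∀ {r n} → Vec ℕ r → Permutation′ n → Set
InYoungSubgroup {r} {n} α σ = ∀ (p : Fin n) (i : Fin r) → InBatch α p i → InBatch α (σ ⟨$⟩ʳ p) i

-- σ · x^m : x_p ↦ x_{σ(p)}, so the new exponent at q is m_{σ⁻¹(q)}
actMon : ∀ {n} → Permutation′ n → Monomial n → Monomial n
actMon σ m = tabulate (λ q → lookup m (σ ⟨$⟩ˡ q))

actP : ∀ {n} → Permutation′ n → Poly n → Poly n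
actP σ = map (λ t → (proj₁ t , actMon σ (proj₂ t)))

-- σ · (B_1|⋯|B_k) = (σ(B_1)|⋯|σ(B_k)): letter σ(p) goes to the block of p
actWord : ∀ {n k} → Permutation′ n → Vec (Fin k) n → Vec (Fin k) n
actWord σ w = tabulate (λ q → lookup w (σ ⟨$⟩ˡ q))

actW : ∀ {n k} → Permutation′ n → Words n k → Words n k
actW σ = map (λ t → (proj₁ t , actWord σ (proj₂ t)))

-- An isomorphism of ungraded 𝔖_α-modules S_{α,k} = ℚ[x]/J_{α,k} ≅ ℚ[OP_{α,k}],
-- given by a map φ on ℚ[x] that descends to a ℚ-linear, 𝔖_α-equivariant
-- bijection from the quotient onto ℚ[OP_{α,k}].

ModuleIso : ∀ {r} n k → Vec ℕ r → Set
ModuleIso n k α =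
  let J = Jgens n k α in
  Σ (Poly n → Words n k) λ φ →
    (∀ p → SupportedOnOP α (φ p))
    × (∀ p q → InIdeal J (p -ₚ q) → φ p ≈w φ q)
    × (∀ p q → φ (p +ₚ q) ≈w (φ p ++ φ q))
    × (∀ c p → φ (scaleF c p) ≈w scaleF c (φ p))
    × (∀ p q → φ p ≈w φ q → InIdeal J (p -ₚ q))
    × (∀ v → SupportedOnOP α v → ∃ λ p → φ p ≈w v)
    × (∀ σ → InYoungSubgroup α σ → ∀ p → φ (actP σ p) ≈w actW σ (φ p))

{-# OPTIONS --safe #-}
module Submission where

open import Defs
open import Data.Nat using (ℕ; _≤_; _<_)
open import Data.Fin using (Fin)
open import Data.Vec using (Vec; lookup; sum)
open import Data.Product using (_×_)
open import Function.Bundles using (_⇔_)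
open import Relation.Binary.PropositionalEquality using (_≡_)

open import Algebra.Bundles using (CommutativeRing)
import Algebra.Solver.Ring as RingSolver
open import Algebra.Solver.Ring.AlmostCommutativeRing using (AlmostCommutativeRing; fromCommutativeRing; _-Raw-AlmostCommutative⟶_; -raw-almostCommutative⟶)
open import Data.Bool using (Bool; true; false; if_then_else_; _∧_)
open import Data.Bool.Properties using (T-≡; T-∧)
open import Data.Empty using (⊥; ⊥-elim)
open import Data.Fin as Fin using (toℕ; fromℕ<)
open import Data.Fin.Permutation using (Permutation′; _⟨$⟩ʳ_; _⟨$⟩ˡ_; inverseˡ; inverseʳ)
import Data.Fin.Properties as FinP
open import Data.Fin.Subset using (Subset; ∣_∣)
import Data.Integer as ℤ
open import Data.List as List using (List; []; _∷_; _++_; map; allFin; upTo; length)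
open import Data.List.Membership.Propositional using (_∈_)
import Data.List.Membership.Propositional.Properties as MemP
import Data.List.Membership.Propositional.Properties.WithK as MemK
import Data.List.Properties as ListP
open import Data.List.Relation.Binary.BagAndSetEquality using (∼bag⇒↭)
open import Data.List.Relation.Binary.Permutation.Propositional as Perm using (_↭_; ↭-sym; ↭-trans)
import Data.List.Relation.Binary.Permutation.Propositional.Properties as PermP
import Data.List.Relation.Binary.Permutation.Setoid.Properties as PermS
open import Data.List.Relation.Unary.All as All using (All; []; _∷_)
import Data.List.Relation.Unary.All.Properties as AllP
import Data.List.Relation.Unary.AllPairs as AllPairs
open import Data.List.Relation.Unary.Any as Any using (here; there)
import Data.List.Relation.Unary.Any.Properties as AnyP
open import Data.List.Relation.Unary.Unique.Propositional using (Unique)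
import Data.List.Relation.Unary.Unique.Propositional.Properties as UniqueP
open import Data.Maybe using (Maybe; just; nothing)
open import Data.Nat as ℕ using (zero; suc; _+_; _∸_; z≤n; s≤s)
import Data.Nat.Coprimality as Coprimality
open import Data.Nat.Induction using (<-wellFounded)
import Data.Nat.ListAction as ListAction
import Data.Nat.Properties as ℕP
open import Algebra.Properties.CommutativeSemigroup ℕP.+-commutativeSemigroup using () renaming (interchange to +-interchange; x∙yz≈y∙xz to +-leftSwap)
open import Data.Product using (Σ; ∃; _,_; proj₁; proj₂)
open import Data.Rational as ℚ using (ℚ; 0ℚ; 1ℚ) renaming (_+_ to _+q_; _*_ to _*q_; -_ to -q_)
import Data.Rational.Properties as ℚP
open import Data.Rational.Solver using (module +-*-Solver)
open import Data.Sum using (_⊎_; inj₁; inj₂)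
open import Data.Vec as Vec using ([]; _∷_; tabulate; zipWith; replicate)
import Data.Vec.Properties as VecP
open import Function using (_∘_; id)
open import Function.Bundles using (Equivalence; mk⇔)
open import Induction.WellFounded using (Acc; WellFounded) renaming (acc to access)
open import Level using (0ℓ)
open import Relation.Binary.Definitions using (DecidableEquality; tri<; tri≈; tri>)
open import Relation.Binary.PropositionalEquality using (_≢_; refl; sym; trans; cong; cong₂; subst; setoid; module ≡-Reasoning)
import Relation.Binary.Reasoning.Setoid as SetoidReasoning
open import Relation.Nullary using (¬_; Dec; yes; no)
open import Relation.Nullary.Decidable using (¬?; _×-dec_; _→-dec_)
open import Relation.Unary using (Decidable)

-- Let t = n - k + 1. For B = {b₁ < … < b_t} ⊆ [n] the determinant of the matrix with entries
-- h_{k - b_i + j}(x_1, …, x_{b_i}) has neglex leading monomial ∏ x_{b_i}^{k - b_i + i}, which is the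
-- monomial x(S)* for S = {n + 1 - b : b ∈ B}. It lies in J: modulo J all rows are orthogonal to the
-- vector of signed elementary symmetric polynomials ε_{t-1}, …, ε_1, ε_0 = 1, since the convolution
-- of h(x_1, …, x_b) with ε(x_1, …, x_n) is ε(x_{b+1}, …, x_n), which vanishes in degree n + 1 - b.
-- Likewise h_{k-j+1} of the first j variables of a batch lies in J and has leading monomial
-- x^{k-j+1} for the last of these variables. So every monomial reduces modulo J to smaller nonskip
-- monomials, and every skip monomial is in the initial ideal.
--
-- Read an exponent vector from left to right as instructions for placing the letters 1, …, n into
-- k blocks, where the exponent selects a block that is not yet used by the current batch, empty
-- blocks first. A nonskip monomial leaves no block empty, so nonskip monomials inject into OP.
--
-- Evaluate polynomials at the points with coordinates y_{w(1)}, …, y_{w(n)} for w ∈ OP and distinct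
-- y_1, …, y_k. There every generator of J agrees with a polynomial of lower degree. Hence evaluation
-- of nonskip monomials still gives all functions on OP, and as there are at most |OP| of them they
-- are linearly independent modulo J. Averaging p ↦ (evaluation of the normal form of p) over 𝔖_α
-- gives an equivariant map which kills J and agrees with evaluation up to lower degree; by the same
-- argument it is bijective on the span of the nonskip monomials.

-- Formal linear combinations

-- Evaluation on OP is equivariant but does not kill J, as a generator agrees there only with a
-- polynomial of lower degree. Taking normal forms kills J but depends on the neglex order, so it
-- need not be equivariant. Composing the two and averaging repairs both defects; the danger is that
-- averaging loses injectivity. It does not, because evaluation is unchanged when points and
-- variables are permuted together, so every summand of the average is evaluation up to lower
-- degree. Bijectivity is therefore proved once, for any family of functionals with this property,
-- and applied to evaluation and to the average. The comparison of cardinalities takes the form of a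
-- square matrix: its columns belong to the nonskip monomials and its rows to the words that these
-- monomials produce. Interpolating polynomials, rewritten degree by degree in nonskip monomials,
-- give a right inverse up to nonzero factors, and a kernel vector argument turns this into
-- injectivity. The induction on degrees works because J is homogeneous, so that normal forms can
-- preserve the degree.

module _ where

  open +-*-Solver using (solve; _:=_; _:+_; _:*_; :-_; con)

  -- The pairing with an arbitrary function. Equality of formal sums amounts to equality of all
  -- pairings (`lin-≈`, `≈-lin`), so polynomial identities are checked on functionals, without
  -- rearranging lists or comparing monomials.
  lin : {X : Set} → (X → ℚ) → Free X → ℚ
  lin f [] = 0ℚ
  lin f ((c , x) ∷ v) = c *q f x +q lin f v

  lin-++ : ∀ {X} (f : X → ℚ) u v → lin f (u ++ v) ≡ lin f u +q lin f v
  lin-++ f [] v = sym (ℚP.+-identityˡ _)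
  lin-++ f ((c , x) ∷ u) v = trans (cong (c *q f x +q_) (lin-++ f u v)) (sym (ℚP.+-assoc (c *q f x) (lin f u) (lin f v)))

  lin-scale : ∀ {X} (f : X → ℚ) c v → lin f (scaleF c v) ≡ c *q lin f v
  lin-scale f c [] = sym (ℚP.*-zeroʳ c)
  lin-scale f c ((d , x) ∷ v) = trans (cong (c *q d *q f x +q_) (lin-scale f c v))
    (solve 4 (λ c d a b → c :* d :* a :+ c :* b := c :* (d :* a :+ b)) refl c d (f x) (lin f v))

  lin-cong : ∀ {X} {f g : X → ℚ} → (∀ x → f x ≡ g x) → ∀ v → lin f v ≡ lin g v
  lin-cong h [] = refl
  lin-cong h ((c , x) ∷ v) = cong₂ _+q_ (cong (c *q_) (h x)) (lin-cong h v)

  lin-0 : ∀ {X} (v : Free X) → lin (λ _ → 0ℚ) v ≡ 0ℚ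
  lin-0 [] = refl
  lin-0 ((c , x) ∷ v) = trans (cong₂ _+q_ (ℚP.*-zeroʳ c) (lin-0 v)) (ℚP.+-identityʳ 0ℚ)

  lin-+ : ∀ {X} (f g : X → ℚ) v → lin (λ x → f x +q g x) v ≡ lin f v +q lin g v
  lin-+ f g [] = refl
  lin-+ f g ((c , x) ∷ v) = trans (cong (c *q (f x +q g x) +q_) (lin-+ f g v))
    (solve 5 (λ c a b u v → c :* (a :+ b) :+ (u :+ v) := (c :* a :+ u) :+ (c :* b :+ v)) refl c (f x) (g x) _ _)

  lin-* : ∀ {X} d (f : X → ℚ) v → lin (λ x → d *q f x) v ≡ d *q lin f v
  lin-* d f [] = sym (ℚP.*-zeroʳ d)
  lin-* d f ((c , x) ∷ v) = trans (cong (c *q (d *q f x) +q_) (lin-* d f v))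
    (solve 4 (λ c d a b → c :* (d :* a) :+ d :* b := d :* (c :* a :+ b)) refl c d (f x) (lin f v))

  lin-swap : ∀ {X Y : Set} (g : X → Y → ℚ) u v →
    lin (λ x → lin (g x) v) u ≡ lin (λ y → lin (λ x → g x y) u) v
  lin-swap g [] v = sym (lin-0 v)
  lin-swap g ((c , x) ∷ u) v = trans (cong₂ _+q_ (sym (lin-* c (g x) v)) (lin-swap g u v))
    (sym (lin-+ (λ y → c *q g x y) (λ y → lin (λ x → g x y) u) v))

  lin-map : ∀ {X Y : Set} (h : X → Y) (f : Y → ℚ) v →
    lin f (map (λ t → (proj₁ t , h (proj₂ t))) v) ≡ lin (f ∘ h) v
  lin-map h f [] = refl
  lin-map h f ((c , x) ∷ v) = cong (c *q f (h x) +q_) (lin-map h f v)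

  bind : {X Y : Set} → (X → Free Y) → Free X → Free Y
  bind f [] = []
  bind f ((c , x) ∷ v) = scaleF c (f x) ++ bind f v

  lin-bind : ∀ {X Y : Set} (h : X → Free Y) (f : Y → ℚ) v → lin f (bind h v) ≡ lin (λ x → lin f (h x)) v
  lin-bind h f [] = refl
  lin-bind h f ((c , x) ∷ v) = trans (lin-++ f (scaleF c (h x)) (bind h v))
    (cong₂ _+q_ (lin-scale f c (h x)) (lin-bind h f v))

  module Decidable {X : Set} (_≟_ : DecidableEquality X) where

    δ : X → X → ℚ
    δ x y with y ≟ x
    ... | yes _ = 1ℚ
    ... | no _  = 0ℚ

    δ-refl : ∀ x → δ x x ≡ 1ℚ
    δ-refl x with x ≟ x
    ... | yes _ = refl
    ... | no x≢x = ⊥-elim (x≢x refl)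

    δ-≢ : ∀ {x y} → y ≢ x → δ x y ≡ 0ℚ
    δ-≢ {x} {y} y≢x with y ≟ x
    ... | yes y≡x = ⊥-elim (y≢x y≡x)
    ... | no _ = refl

    coeff-lin : ∀ v x → coeff _≟_ v x ≡ lin (δ x) v
    coeff-lin [] x = refl
    coeff-lin ((c , y) ∷ v) x with y ≟ x
    ... | yes _ = cong₂ _+q_ (sym (ℚP.*-identityʳ c)) (coeff-lin v x)
    ... | no _  = trans (coeff-lin v x) (sym (trans (cong (_+q lin (δ x) v) (ℚP.*-zeroʳ c)) (ℚP.+-identityˡ _)))

    without : X → Free X → Free X
    without x [] = []
    without x ((c , y) ∷ v) with y ≟ x
    ... | yes _ = without x v
    ... | no _  = (c , y) ∷ without x v

    without-length : ∀ x v → length (without x v) ≤ length v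
    without-length x [] = z≤n
    without-length x ((c , y) ∷ v) with y ≟ x
    ... | yes _ = ℕP.m≤n⇒m≤1+n (without-length x v)
    ... | no _  = s≤s (without-length x v)

    lin-without : ∀ f x v → lin f v ≡ coeff _≟_ v x *q f x +q lin f (without x v)
    lin-without f x [] = sym (trans (cong (_+q 0ℚ) (ℚP.*-zeroˡ (f x))) refl)
    lin-without f x ((c , y) ∷ v) with y ≟ x
    ... | yes refl = trans (cong (c *q f y +q_) (lin-without f y v))
        (solve 4 (λ c a d b → c :* a :+ (d :* a :+ b) := (c :+ d) :* a :+ b) refl c (f y) _ _)
    ... | no _ = trans (cong (c *q f y +q_) (lin-without f x v))
        (solve 3 (λ p q r → p :+ (q :+ r) := q :+ (p :+ r)) refl (c *q f y) (coeff _≟_ v x *q f x) (lin f (without x v)))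

    coeff-without-self : ∀ x v → coeff _≟_ (without x v) x ≡ 0ℚ
    coeff-without-self x [] = refl
    coeff-without-self x ((c , y) ∷ v) with y ≟ x
    ... | yes _ = coeff-without-self x v
    ... | no y≢x with y ≟ x
    ...   | yes y≡x = ⊥-elim (y≢x y≡x)
    ...   | no _ = coeff-without-self x v

    coeff-without : ∀ {x z} v → z ≢ x → coeff _≟_ (without x v) z ≡ coeff _≟_ v z
    coeff-without [] z≢x = refl
    coeff-without {x} {z} ((c , y) ∷ v) z≢x with y ≟ x
    ... | yes refl with y ≟ z
    ...   | yes refl = ⊥-elim (z≢x refl)
    ...   | no _ = coeff-without v z≢x
    coeff-without {x} {z} ((c , y) ∷ v) z≢x | no _ with y ≟ z
    ...   | yes _ = cong (c +q_) (coeff-without v z≢x)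
    ...   | no _ = coeff-without v z≢x

    -- A list may repeat a basis element, whose coefficient is the sum over all occurrences, so
    -- plain induction on the list fails. Each step removes every occurrence of the first element;
    -- the bound `l` on the length makes this terminate.
    lin-vanish : ∀ f v → (∀ x → coeff _≟_ v x *q f x ≡ 0ℚ) → lin f v ≡ 0ℚ
    lin-vanish f v = go (length v) v ℕP.≤-refl
      where
      go : ∀ l v → length v ≤ l → (∀ x → coeff _≟_ v x *q f x ≡ 0ℚ) → lin f v ≡ 0ℚ
      go l [] _ h = refl
      go (suc l) v@((c , y) ∷ u) (s≤s le) h = trans (lin-without f y v) (trans (cong₂ _+q_ (h y) rest) refl)
        where
        shorter : length (without y v) ≤ l
        shorter with y ≟ y
        ... | yes _ = ℕP.≤-trans (without-length y u) le
        ... | no y≢y = ⊥-elim (y≢y refl)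
        rest : lin f (without y v) ≡ 0ℚ
        rest = go l (without y v) shorter λ x → vanish x (x ≟ y)
          where
          vanish : ∀ x → Dec (x ≡ y) → coeff _≟_ (without y v) x *q f x ≡ 0ℚ
          vanish x (yes refl) = trans (cong (_*q f x) (coeff-without-self x v)) (ℚP.*-zeroˡ (f x))
          vanish x (no x≢y) = trans (cong (_*q f x) (coeff-without v x≢y)) (h x)

    lin-minus : ∀ (f : X → ℚ) u v → lin f (u ++ scaleF (-q 1ℚ) v) ≡ lin f u +q (-q (lin f v))
    lin-minus f u v = trans (lin-++ f u _) (cong (lin f u +q_)
      (trans (lin-scale f (-q 1ℚ) v) (trans (sym (ℚP.neg-distribˡ-* 1ℚ (lin f v))) (cong -q_ (ℚP.*-identityˡ _)))))

    minus-zero : ∀ a b → a +q (-q b) ≡ 0ℚ → a ≡ b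
    minus-zero a b e = trans (solve 2 (λ a b → a := (a :+ :- b) :+ b) refl a b) (trans (cong (_+q b) e) (ℚP.+-identityˡ b))

    -- Elements that are listed but cancel out need no agreement. This matters where only the true
    -- support of a polynomial is controlled, as in `LeadMon`.
    lin-agree : ∀ f g v → (∀ x → coeff _≟_ v x ≢ 0ℚ → f x ≡ g x) → lin f v ≡ lin g v
    lin-agree f g v h = minus-zero _ _ (trans (sym eq) (lin-vanish _ v vanish))
      where
      eq : lin (λ x → f x +q (-q 1ℚ) *q g x) v ≡ lin f v +q (-q (lin g v))
      eq = trans (lin-+ f _ v) (cong (lin f v +q_) (trans (lin-* (-q 1ℚ) g v) (trans (sym (ℚP.neg-distribˡ-* 1ℚ (lin g v))) (cong -q_ (ℚP.*-identityˡ _)))))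
      vanish : ∀ x → coeff _≟_ v x *q (f x +q (-q 1ℚ) *q g x) ≡ 0ℚ
      vanish x with coeff _≟_ v x ℚ.≟ 0ℚ
      ... | yes z = trans (cong (_*q (f x +q (-q 1ℚ) *q g x)) z) (ℚP.*-zeroˡ (f x +q (-q 1ℚ) *q g x))
      ... | no nz = trans (cong (λ e → coeff _≟_ v x *q (e +q (-q 1ℚ) *q g x)) (h x nz))
          (solve 2 (λ c a → c :* (a :+ (:- con 1ℚ) :* a) := con 0ℚ) refl (coeff _≟_ v x) (g x))

    lin-≈ : ∀ f {u v} → FreeEq _≟_ u v → lin f u ≡ lin f v
    lin-≈ f {u} {v} eq = minus-zero _ _ (trans (sym (lin-minus f u v)) (lin-vanish f (u ++ scaleF (-q 1ℚ) v) vanish))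
      where
      zero-coeff : ∀ x → coeff _≟_ (u ++ scaleF (-q 1ℚ) v) x ≡ 0ℚ
      zero-coeff x = trans (coeff-lin (u ++ scaleF (-q 1ℚ) v) x) (trans (lin-minus (δ x) u v)
        (trans (cong₂ (λ a b → a +q (-q b)) (trans (sym (coeff-lin u x)) (eq x)) (sym (coeff-lin v x))) (ℚP.+-inverseʳ (coeff _≟_ v x))))
      vanish : ∀ x → coeff _≟_ (u ++ scaleF (-q 1ℚ) v) x *q f x ≡ 0ℚ
      vanish x = trans (cong (_*q f x) (zero-coeff x)) (ℚP.*-zeroˡ (f x))

    ≈-lin : ∀ {u v} → (∀ f → lin f u ≡ lin f v) → FreeEq _≟_ u v
    ≈-lin {u} {v} h x = trans (coeff-lin u x) (trans (h (δ x)) (sym (coeff-lin v x)))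

    coeff-∉ : ∀ {P : X → Set} {x} v → All (P ∘ proj₂) v → ¬ P x → coeff _≟_ v x ≡ 0ℚ
    coeff-∉ [] [] ¬p = refl
    coeff-∉ {x = x} ((c , y) ∷ v) (py ∷ pv) ¬p with y ≟ x
    ... | yes refl = ⊥-elim (¬p py)
    ... | no _ = coeff-∉ v pv ¬p

-- The polynomial ring

infixl 6 _⊕_

_⊕_ : ∀ {n} → Monomial n → Monomial n → Monomial n
a ⊕ b = zipWith _+_ a b

one : ∀ {n} → Monomial n
one = replicate _ 0

⊕-comm : ∀ {n} (a b : Monomial n) → a ⊕ b ≡ b ⊕ a
⊕-comm = VecP.zipWith-comm ℕP.+-comm

⊕-assoc : ∀ {n} (a b c : Monomial n) → (a ⊕ b) ⊕ c ≡ a ⊕ (b ⊕ c)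
⊕-assoc = VecP.zipWith-assoc ℕP.+-assoc

⊕-identityˡ : ∀ {n} (a : Monomial n) → one ⊕ a ≡ a
⊕-identityˡ = VecP.zipWith-identityˡ ℕP.+-identityˡ

module MonoD {n : ℕ} = Decidable (_≟ₘ_ {n})

infix 4 _≋_

-- A record, because `_≈ₚ_` unfolds to equations between coefficients, from which `p` and `q` cannot
-- be inferred.
record _≋_ {n} (p q : Poly n) : Set where
  constructor mk≋
  field coeffs : p ≈ₚ q
open _≋_ public

≋-lin : ∀ {n} {p q : Poly n} → (∀ f → lin f p ≡ lin f q) → p ≋ q
≋-lin {p = p} {q} h = mk≋ (MonoD.≈-lin {u = p} {q} h)

lin-≋ : ∀ {n} (f : Monomial n → ℚ) {p q : Poly n} → p ≋ q → lin f p ≡ lin f q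
lin-≋ f {p} {q} e = MonoD.lin-≈ f {p} {q} (coeffs e)

lin-term : ∀ {n} (f : Monomial n → ℚ) c a q →
  lin f (map (λ t → (c *q proj₁ t , a ⊕ proj₂ t)) q) ≡ c *q lin (λ b → f (a ⊕ b)) q
lin-term f c a [] = sym (ℚP.*-zeroʳ c)
lin-term f c a ((d , b) ∷ q) = trans (cong₂ _+q_ (ℚP.*-assoc c d (f (a ⊕ b))) (lin-term f c a q))
  (sym (ℚP.*-distribˡ-+ c (d *q f (a ⊕ b)) (lin (λ b → f (a ⊕ b)) q)))

-- Pairing with a product is an iterated pairing with the factors. Commutativity of the ring thus
-- becomes the exchange `lin-swap`, and associativity becomes that of adding exponents.
lin-mul : ∀ {n} (f : Monomial n → ℚ) p q → lin f (p *ₚ q) ≡ lin (λ a → lin (λ b → f (a ⊕ b)) q) p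
lin-mul f [] q = refl
lin-mul f ((c , a) ∷ p) q = trans (lin-++ f (map (λ t → (c *q proj₁ t , a ⊕ proj₂ t)) q) (p *ₚ q))
  (cong₂ _+q_ (lin-term f c a q) (lin-mul f p q))

negP : ∀ {n} → Poly n → Poly n
negP = scaleF (-q 1ℚ)

const : ∀ {n} → ℚ → Poly n
const c = (c , one) ∷ []

mono : ∀ {n} → Monomial n → Poly n
mono m = (1ℚ , m) ∷ []

lin-neg : ∀ {X} (f : X → ℚ) v → lin f (scaleF (-q 1ℚ) v) ≡ -q (lin f v)
lin-neg f v = trans (lin-scale f (-q 1ℚ) v) (trans (sym (ℚP.neg-distribˡ-* 1ℚ (lin f v))) (cong -q_ (ℚP.*-identityˡ (lin f v))))

lin-single : ∀ {X} (f : X → ℚ) c x → lin f ((c , x) ∷ []) ≡ c *q f x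
lin-single f c x = ℚP.+-identityʳ (c *q f x)

mul-cong : ∀ {n} {p p' q q' : Poly n} → p ≋ p' → q ≋ q' → (p *ₚ q) ≋ (p' *ₚ q')
mul-cong {p = p} {p'} {q} {q'} e e' = ≋-lin λ f → begin
  lin f (p *ₚ q)                              ≡⟨ lin-mul f p q ⟩
  lin (λ a → lin (λ b → f (a ⊕ b)) q) p       ≡⟨ lin-cong (λ a → lin-≋ _ e') p ⟩
  lin (λ a → lin (λ b → f (a ⊕ b)) q') p      ≡⟨ lin-≋ _ e ⟩
  lin (λ a → lin (λ b → f (a ⊕ b)) q') p'     ≡⟨ lin-mul f p' q' ⟨
  lin f (p' *ₚ q')                            ∎
  where open ≡-Reasoning

mul-comm : ∀ {n} (p q : Poly n) → (p *ₚ q) ≋ (q *ₚ p)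
mul-comm p q = ≋-lin λ f → begin
  lin f (p *ₚ q)                          ≡⟨ lin-mul f p q ⟩
  lin (λ a → lin (λ b → f (a ⊕ b)) q) p   ≡⟨ lin-swap (λ a b → f (a ⊕ b)) p q ⟩
  lin (λ b → lin (λ a → f (a ⊕ b)) p) q   ≡⟨ lin-cong (λ b → lin-cong (λ a → cong f (⊕-comm a b)) p) q ⟩
  lin (λ b → lin (λ a → f (b ⊕ a)) p) q   ≡⟨ lin-mul f q p ⟨
  lin f (q *ₚ p)                          ∎
  where open ≡-Reasoning

mul-assoc : ∀ {n} (p q r : Poly n) → ((p *ₚ q) *ₚ r) ≋ (p *ₚ (q *ₚ r))
mul-assoc p q r = ≋-lin λ f → begin
  lin f ((p *ₚ q) *ₚ r)                                             ≡⟨ lin-mul f (p *ₚ q) r ⟩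
  lin (λ a → lin (λ c → f (a ⊕ c)) r) (p *ₚ q)                      ≡⟨ lin-mul _ p q ⟩
  lin (λ a → lin (λ b → lin (λ c → f (a ⊕ b ⊕ c)) r) q) p           ≡⟨ lin-cong (λ a → lin-cong (λ b → lin-cong (λ c → cong f (⊕-assoc a b c)) r) q) p ⟩
  lin (λ a → lin (λ b → lin (λ c → f (a ⊕ (b ⊕ c))) r) q) p         ≡⟨ lin-cong (λ a → lin-mul (λ b → f (a ⊕ b)) q r) p ⟨
  lin (λ a → lin (λ b → f (a ⊕ b)) (q *ₚ r)) p                      ≡⟨ lin-mul f p (q *ₚ r) ⟨
  lin f (p *ₚ (q *ₚ r))                                             ∎
  where open ≡-Reasoning

mul-oneˡ : ∀ {n} (p : Poly n) → (oneP *ₚ p) ≋ p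
mul-oneˡ p = ≋-lin λ f → trans (lin-mul f oneP p)
  (trans (lin-single (λ a → lin (λ b → f (a ⊕ b)) p) 1ℚ one)
  (trans (ℚP.*-identityˡ (lin (λ b → f (one ⊕ b)) p)) (lin-cong (λ b → cong f (⊕-identityˡ b)) p)))

add-cong : ∀ {n} {p p' q q' : Poly n} → p ≋ p' → q ≋ q' → (p +ₚ q) ≋ (p' +ₚ q')
add-cong {p = p} {p'} {q} {q'} e e' = ≋-lin λ f →
  trans (lin-++ f p q) (trans (cong₂ _+q_ (lin-≋ f e) (lin-≋ f e')) (sym (lin-++ f p' q')))

add-comm : ∀ {n} (p q : Poly n) → (p +ₚ q) ≋ (q +ₚ p)
add-comm p q = ≋-lin λ f →
  trans (lin-++ f p q) (trans (ℚP.+-comm (lin f p) (lin f q)) (sym (lin-++ f q p)))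

distribˡ : ∀ {n} (p q r : Poly n) → (p *ₚ (q +ₚ r)) ≋ ((p *ₚ q) +ₚ (p *ₚ r))
distribˡ p q r = ≋-lin λ f → begin
  lin f (p *ₚ (q +ₚ r))                         ≡⟨ lin-mul f p (q +ₚ r) ⟩
  lin (λ a → lin (λ b → f (a ⊕ b)) (q ++ r)) p  ≡⟨ lin-cong (λ a → lin-++ (λ b → f (a ⊕ b)) q r) p ⟩
  lin (λ a → lin (λ b → f (a ⊕ b)) q +q lin (λ b → f (a ⊕ b)) r) p  ≡⟨ lin-+ (λ a → lin (λ b → f (a ⊕ b)) q) (λ a → lin (λ b → f (a ⊕ b)) r) p ⟩
  lin (λ a → lin (λ b → f (a ⊕ b)) q) p +q lin (λ a → lin (λ b → f (a ⊕ b)) r) p  ≡⟨ cong₂ _+q_ (lin-mul f p q) (lin-mul f p r) ⟨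
  lin f (p *ₚ q) +q lin f (p *ₚ r)              ≡⟨ lin-++ f (p *ₚ q) (p *ₚ r) ⟨
  lin f ((p *ₚ q) +ₚ (p *ₚ r))                  ∎
  where open ≡-Reasoning

add-inverseʳ : ∀ {n} (p : Poly n) → (p +ₚ negP p) ≋ zeroP
add-inverseʳ p = ≋-lin λ f →
  trans (lin-++ f p (negP p)) (trans (cong (lin f p +q_) (lin-neg f p)) (ℚP.+-inverseʳ (lin f p)))

neg-cong : ∀ {n} {p q : Poly n} → p ≋ q → negP p ≋ negP q
neg-cong {p = p} {q} e = ≋-lin λ f →
  trans (lin-neg f p) (trans (cong -q_ (lin-≋ f e)) (sym (lin-neg f q)))

≋-refl : ∀ {n} {p : Poly n} → p ≋ p
≋-refl = mk≋ λ m → refl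

≋-sym : ∀ {n} {p q : Poly n} → p ≋ q → q ≋ p
≋-sym e = mk≋ λ m → sym (coeffs e m)

≋-trans : ∀ {n} {p q r : Poly n} → p ≋ q → q ≋ r → p ≋ r
≋-trans e e' = mk≋ λ m → trans (coeffs e m) (coeffs e' m)

≋-reflexive : ∀ {n} {p q : Poly n} → p ≡ q → p ≋ q
≋-reflexive refl = ≋-refl

polyRing : ℕ → CommutativeRing 0ℓ 0ℓ
polyRing n = record
  { Carrier = Poly n ; _≈_ = _≋_ ; _+_ = _+ₚ_ ; _*_ = _*ₚ_ ; -_ = negP ; 0# = zeroP ; 1# = oneP
  ; isCommutativeRing = record
    { isRing = record
      { +-isAbelianGroup = record
        { isGroup = record
          { isMonoid = record
            { isSemigroup = record
              { isMagma = record
                { isEquivalence = record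
                  { refl = ≋-refl
                  ; sym = ≋-sym
                  ; trans = ≋-trans }
                ; ∙-cong = add-cong }
              ; assoc = λ p q r → ≋-reflexive (ListP.++-assoc p q r) }
            ; identity = (λ p → ≋-refl) , (λ p → ≋-reflexive (ListP.++-identityʳ p)) }
          ; inverse = (λ p → ≋-trans (add-comm (negP p) p) (add-inverseʳ p)) , add-inverseʳ
          ; ⁻¹-cong = neg-cong }
        ; comm = add-comm }
      ; *-cong = mul-cong
      ; *-assoc = mul-assoc
      ; *-identity = mul-oneˡ , λ p → ≋-trans (mul-comm p oneP) (mul-oneˡ p)
      ; distrib = distribˡ , λ p q r →
          ≋-trans (mul-comm (q +ₚ r) p)
          (≋-trans (distribˡ p q r)
            (add-cong (mul-comm p q) (mul-comm p r)))
      }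
    ; *-comm = mul-comm } }

ℚ-ring : AlmostCommutativeRing 0ℓ 0ℓ
ℚ-ring = fromCommutativeRing ℚP.+-*-commutativeRing

-- ℚ-algebras, as the structure that the ring solver needs to normalise coefficients.
IsAlgebra : CommutativeRing 0ℓ 0ℓ → Set
IsAlgebra R = AlmostCommutativeRing.rawRing ℚ-ring -Raw-AlmostCommutative⟶ fromCommutativeRing R

scale≈const* : ∀ {n} c (p : Poly n) → scaleF c p ≋ (const c *ₚ p)
scale≈const* c p = ≋-lin λ f → trans (lin-scale f c p) (sym (trans (lin-mul f (const c) p)
  (trans (lin-single (λ a → lin (λ b → f (a ⊕ b)) p) c one) (cong (c *q_) (lin-cong (λ b → cong f (⊕-identityˡ b)) p)))))

polyAlgebra : ∀ n → IsAlgebra (polyRing n)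
polyAlgebra n = record
  { ⟦_⟧ = const
  ; +-homo = λ c d → ≋-lin λ f →
      trans (lin-single f (c +q d) one) (trans (ℚP.*-distribʳ-+ (f one) c d) (sym (trans (lin-++ f (const c) (const d)) (cong₂ _+q_ (lin-single f c one) (lin-single f d one)))))
  ; *-homo = λ c d → scale≈const* c (const d)
  ; -‿homo = λ c → ≋-reflexive (cong const (trans (cong -q_ (sym (ℚP.*-identityˡ c))) (ℚP.neg-distribˡ-* 1ℚ c)))
  ; 0-homo = ≋-lin λ f → trans (lin-single f 0ℚ one) (ℚP.*-zeroˡ (f one))
  ; 1-homo = ≋-refl
  }

ℚAlgebra : IsAlgebra ℚP.+-*-commutativeRing
ℚAlgebra = -raw-almostCommutative⟶ ℚ-ring

-- Symmetric polynomials and exterior algebra over a commutative ring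

module Symmetric (R : CommutativeRing 0ℓ 0ℓ) (alg : IsAlgebra R) where

  open CommutativeRing R public using (Carrier; _≈_; +-cong; *-cong; -‿cong)
    renaming (_+_ to _⊞_; _*_ to _⊠_; -_ to ⊟_; 0# to 𝟘; 1# to 𝟙; refl to ≈-refl; sym to ≈-sym; trans to ≈-trans; reflexive to ≈-reflexive)
  private module Hom = _-Raw-AlmostCommutative⟶_ alg

  -- The structure map, adjusted so that the solver constants 0 and 1 denote 𝟘 and 𝟙 definitionally.
  scalar : ℚ → Carrier
  scalar c with c ℚ.≟ 0ℚ | c ℚ.≟ 1ℚ
  ... | yes _ | _     = 𝟘
  ... | no _  | yes _ = 𝟙
  ... | no _  | no _  = Hom.⟦ c ⟧

  scalar-≈ : ∀ c → scalar c ≈ Hom.⟦ c ⟧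
  scalar-≈ c with c ℚ.≟ 0ℚ | c ℚ.≟ 1ℚ
  ... | yes refl | _        = ≈-sym Hom.0-homo
  ... | no _     | yes refl = ≈-sym Hom.1-homo
  ... | no _     | no _     = ≈-refl

  scalarAlgebra : IsAlgebra R
  scalarAlgebra = record
    { ⟦_⟧ = scalar
    ; +-homo = λ c d → ≈-trans (scalar-≈ (c +q d)) (≈-trans (Hom.+-homo c d) (≈-sym (+-cong (scalar-≈ c) (scalar-≈ d))))
    ; *-homo = λ c d → ≈-trans (scalar-≈ (c *q d)) (≈-trans (Hom.*-homo c d) (≈-sym (*-cong (scalar-≈ c) (scalar-≈ d))))
    ; -‿homo = λ c → ≈-trans (scalar-≈ (-q c)) (≈-trans (Hom.-‿homo c) (≈-sym (-‿cong (scalar-≈ c))))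
    ; 0-homo = ≈-refl
    ; 1-homo = ≈-refl
    }

  decideScalars : ∀ c d → Maybe (scalar c ≈ scalar d)
  decideScalars c d with c ℚ.≟ d
  ... | yes refl = just ≈-refl
  ... | no _     = nothing

  open RingSolver (AlmostCommutativeRing.rawRing ℚ-ring) (fromCommutativeRing R) scalarAlgebra decideScalars public
    using (solve; _:=_; _:+_; _:*_; :-_; con)
  open SetoidReasoning (CommutativeRing.setoid R) public

  sumN : ℕ → (ℕ → Carrier) → Carrier
  sumN zero f = 𝟘
  sumN (suc i) f = sumN i f ⊞ f i

  sumN-cong : ∀ i {f g} → (∀ j → j < i → f j ≈ g j) → sumN i f ≈ sumN i g
  sumN-cong zero h = ≈-refl
  sumN-cong (suc i) h = +-cong (sumN-cong i λ j j<i → h j (ℕP.m≤n⇒m≤1+n j<i)) (h i ℕP.≤-refl)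

  sumN-front : ∀ i f → sumN (suc i) f ≈ f 0 ⊞ sumN i (f ∘ suc)
  sumN-front zero f = solve 1 (λ a → con 0ℚ :+ a := a :+ con 0ℚ) ≈-refl (f 0)
  sumN-front (suc i) f = ≈-trans (+-cong (sumN-front i f) ≈-refl)
    (solve 3 (λ a b c → (a :+ b) :+ c := a :+ (b :+ c)) ≈-refl (f 0) (sumN i (f ∘ suc)) (f (suc i)))

  sumN-+ : ∀ i f g → sumN i (λ j → f j ⊞ g j) ≈ sumN i f ⊞ sumN i g
  sumN-+ zero f g = solve 0 (con 0ℚ := con 0ℚ :+ con 0ℚ) ≈-refl
  sumN-+ (suc i) f g = ≈-trans (+-cong (sumN-+ i f g) ≈-refl)
    (solve 4 (λ a b c d → (a :+ b) :+ (c :+ d) := (a :+ c) :+ (b :+ d)) ≈-refl (sumN i f) (sumN i g) (f i) (g i))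

  sumN-* : ∀ i c f → sumN i (λ j → c ⊠ f j) ≈ c ⊠ sumN i f
  sumN-* zero c f = solve 1 (λ c → con 0ℚ := c :* con 0ℚ) ≈-refl c
  sumN-* (suc i) c f = ≈-trans (+-cong (sumN-* i c f) ≈-refl)
    (solve 3 (λ c a b → c :* a :+ c :* b := c :* (a :+ b)) ≈-refl c (sumN i f) (f i))

  sumN-0 : ∀ i f → (∀ j → j < i → f j ≈ 𝟘) → sumN i f ≈ 𝟘
  sumN-0 zero f h = ≈-refl
  sumN-0 (suc i) f h = ≈-trans (+-cong (sumN-0 i f λ j j<i → h j (ℕP.m≤n⇒m≤1+n j<i)) (h i ℕP.≤-refl))
    (solve 0 (con 0ℚ :+ con 0ℚ := con 0ℚ) ≈-refl)

  -- ε is the elementary symmetric polynomial with signs, i.e. evaluated at the negated variables.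
  e h ε : List Carrier → ℕ → Carrier
  e []       zero    = 𝟙
  e []       (suc d) = 𝟘
  e (x ∷ xs) zero    = 𝟙
  e (x ∷ xs) (suc d) = e xs (suc d) ⊞ (x ⊠ e xs d)
  h []       zero    = 𝟙
  h []       (suc d) = 𝟘
  h (x ∷ xs) zero    = 𝟙
  h (x ∷ xs) (suc d) = h xs (suc d) ⊞ (x ⊠ h (x ∷ xs) d)
  ε []       zero    = 𝟙
  ε []       (suc d) = 𝟘
  ε (x ∷ xs) zero    = 𝟙
  ε (x ∷ xs) (suc d) = ε xs (suc d) ⊞ (⊟ (x ⊠ ε xs d))

  ε-zero : ∀ xs → ε xs 0 ≈ 𝟙
  ε-zero [] = ≈-refl
  ε-zero (x ∷ xs) = ≈-refl

  h-zero : ∀ xs → h xs 0 ≈ 𝟙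
  h-zero [] = ≈-refl
  h-zero (x ∷ xs) = ≈-refl

  e-zero : ∀ xs → e xs 0 ≈ 𝟙
  e-zero [] = ≈-refl
  e-zero (x ∷ xs) = ≈-refl

  sgn : ℕ → Carrier
  sgn zero = 𝟙
  sgn (suc d) = ⊟ sgn d

  ε-sgn : ∀ xs d → ε xs d ≈ sgn d ⊠ e xs d
  ε-sgn [] zero = solve 0 (con 1ℚ := con 1ℚ :* con 1ℚ) ≈-refl
  ε-sgn [] (suc d) = solve 1 (λ s → con 0ℚ := (:- s) :* con 0ℚ) ≈-refl (sgn d)
  ε-sgn (x ∷ xs) zero = solve 0 (con 1ℚ := con 1ℚ :* con 1ℚ) ≈-refl
  ε-sgn (x ∷ xs) (suc d) = ≈-trans (+-cong (ε-sgn xs (suc d)) (-‿cong (*-cong ≈-refl (ε-sgn xs d))))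
    (solve 4 (λ s a x b → (:- s) :* a :+ :- (x :* (s :* b)) := (:- s) :* (a :+ x :* b)) ≈-refl (sgn d) (e xs (suc d)) x (e xs d))

  e-sgn : ∀ xs d → e xs d ≈ sgn d ⊠ ε xs d
  e-sgn [] zero = solve 0 (con 1ℚ := con 1ℚ :* con 1ℚ) ≈-refl
  e-sgn [] (suc d) = solve 1 (λ s → con 0ℚ := (:- s) :* con 0ℚ) ≈-refl (sgn d)
  e-sgn (x ∷ xs) zero = solve 0 (con 1ℚ := con 1ℚ :* con 1ℚ) ≈-refl
  e-sgn (x ∷ xs) (suc d) = ≈-trans (+-cong (e-sgn xs (suc d)) (*-cong ≈-refl (e-sgn xs d)))
    (solve 4 (λ s a x b → (:- s) :* a :+ (x :* (s :* b)) := (:- s) :* (a :+ :- (x :* b))) ≈-refl (sgn d) (ε xs (suc d)) x (ε xs d))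

  ε-vanish : ∀ xs d → length xs < d → ε xs d ≈ 𝟘
  ε-vanish [] (suc d) _ = ≈-refl
  ε-vanish (x ∷ xs) (suc d) (s≤s lt) =
    ≈-trans (+-cong (ε-vanish xs (suc d) (ℕP.m≤n⇒m≤1+n lt)) (-‿cong (*-cong ≈-refl (ε-vanish xs d lt))))
      (solve 1 (λ x → con 0ℚ :+ :- (x :* con 0ℚ) := con 0ℚ) ≈-refl x)

  -- Convolution of sequences, as products of generating functions

  infix 8 _⋆_
  _⋆_ : (ℕ → Carrier) → (ℕ → Carrier) → ℕ → Carrier
  (f ⋆ g) d = sumN (suc d) (λ a → f a ⊠ g (d ∸ a))

  -- In generating functions, the hypotheses say F (1 - yT) = F' and G = G' (1 - yT), so F G = F'
  -- G'.
  ⋆-step : ∀ f g f' g' y → f 0 ≈ f' 0 → g 0 ≈ g' 0 →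
    (∀ a → f (suc a) ≈ f' (suc a) ⊞ y ⊠ f a) → (∀ a → g (suc a) ≈ g' (suc a) ⊞ ⊟ (y ⊠ g' a)) →
    ∀ d → (f ⋆ g) d ≈ (f' ⋆ g') d
  ⋆-step f g f' g' y f0 g0 fs gs zero = +-cong ≈-refl (*-cong f0 g0)
  ⋆-step f g f' g' y f0 g0 fs gs (suc d) = begin
    sumN (suc d) (λ a → f a ⊠ g (suc d ∸ a)) ⊞ f (suc d) ⊠ g (d ∸ d)
      ≈⟨ +-cong (sumN-cong (suc d) λ { a (s≤s a≤d) → expand a a≤d }) (*-cong ≈-refl last) ⟩
    sumN (suc d) (λ a → f a ⊠ g' (suc d ∸ a) ⊞ (⊟ y) ⊠ (f a ⊠ g' (d ∸ a))) ⊞ f (suc d) ⊠ g' (d ∸ d)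
      ≈⟨ +-cong (≈-trans (sumN-+ (suc d) _ _) (+-cong ≈-refl (sumN-* (suc d) (⊟ y) _))) ≈-refl ⟩
    (sumN (suc d) (λ a → f a ⊠ g' (suc d ∸ a)) ⊞ (⊟ y) ⊠ S) ⊞ f (suc d) ⊠ g' (d ∸ d)
      ≈⟨ solve 3 (λ a b c → (a :+ b) :+ c := (a :+ c) :+ b) ≈-refl _ _ _ ⟩
    sumN (suc (suc d)) (λ a → f a ⊠ g' (suc d ∸ a)) ⊞ (⊟ y) ⊠ S
      ≈⟨ +-cong (sumN-front (suc d) _) ≈-refl ⟩
    (f 0 ⊠ g' (suc d) ⊞ sumN (suc d) (λ a → f (suc a) ⊠ g' (d ∸ a))) ⊞ (⊟ y) ⊠ S
      ≈⟨ +-cong (+-cong (*-cong f0 ≈-refl) (sumN-cong (suc d) λ a _ → ≈-trans (*-cong (fs a) ≈-refl)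
          (solve 4 (λ a b c d → (a :+ b :* c) :* d := a :* d :+ b :* (c :* d)) ≈-refl (f' (suc a)) y (f a) (g' (d ∸ a))))) ≈-refl ⟩
    (f' 0 ⊠ g' (suc d) ⊞ sumN (suc d) (λ a → f' (suc a) ⊠ g' (d ∸ a) ⊞ y ⊠ (f a ⊠ g' (d ∸ a)))) ⊞ (⊟ y) ⊠ S
      ≈⟨ +-cong (+-cong ≈-refl (≈-trans (sumN-+ (suc d) _ _) (+-cong ≈-refl (sumN-* (suc d) y _)))) ≈-refl ⟩
    (f' 0 ⊠ g' (suc d) ⊞ (sumN (suc d) (λ a → f' (suc a) ⊠ g' (d ∸ a)) ⊞ y ⊠ S)) ⊞ (⊟ y) ⊠ S
      ≈⟨ solve 4 (λ a b y s → (a :+ (b :+ y :* s)) :+ (:- y) :* s := a :+ b) ≈-refl _ _ y S ⟩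
    f' 0 ⊠ g' (suc d) ⊞ sumN (suc d) (λ a → f' (suc a) ⊠ g' (d ∸ a))
      ≈⟨ sumN-front (suc d) (λ a → f' a ⊠ g' (suc d ∸ a)) ⟨
    sumN (suc (suc d)) (λ a → f' a ⊠ g' (suc d ∸ a)) ∎
    where
    S = sumN (suc d) (λ a → f a ⊠ g' (d ∸ a))
    last : g (d ∸ d) ≈ g' (d ∸ d)
    last rewrite ℕP.n∸n≡0 d = g0
    expand : ∀ a → a ≤ d → f a ⊠ g (suc d ∸ a) ≈ f a ⊠ g' (suc d ∸ a) ⊞ (⊟ y) ⊠ (f a ⊠ g' (d ∸ a))
    expand a a≤d rewrite ℕP.+-∸-assoc 1 a≤d = ≈-trans (*-cong ≈-refl (gs (d ∸ a)))
      (solve 4 (λ a b y c → a :* (b :+ :- (y :* c)) := a :* b :+ (:- y) :* (a :* c)) ≈-refl (f a) (g' (suc (d ∸ a))) y (g' (d ∸ a)))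

  -- Each y in `Y` contributes 1/(1 - yT) to the generating function of `h` and 1 - yT to that of
  -- `ε`. These cancel, and only the factors 1 - zT for z in `Z` remain.
  h⋆ε : ∀ Y Z d → (h Y ⋆ ε (Y ++ Z)) d ≈ ε Z d
  h⋆ε [] Z d = begin
    sumN (suc d) (λ a → h [] a ⊠ ε Z (d ∸ a))
      ≈⟨ sumN-front d _ ⟩
    𝟙 ⊠ ε Z d ⊞ sumN d (λ a → 𝟘 ⊠ ε Z (d ∸ suc a))
      ≈⟨ +-cong ≈-refl (sumN-0 d _ λ a _ → solve 1 (λ x → con 0ℚ :* x := con 0ℚ) ≈-refl _) ⟩
    𝟙 ⊠ ε Z d ⊞ 𝟘
      ≈⟨ solve 1 (λ x → con 1ℚ :* x :+ con 0ℚ := x) ≈-refl (ε Z d) ⟩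
    ε Z d ∎
  h⋆ε (y ∷ Y) Z d = ≈-trans
    (⋆-step (h (y ∷ Y)) (ε (y ∷ Y ++ Z)) (h Y) (ε (Y ++ Z)) y (≈-sym (h-zero Y)) (≈-sym (ε-zero (Y ++ Z)))
      (λ a → ≈-refl) (λ a → ≈-refl) d)
    (h⋆ε Y Z d)

  e-cong-∷ : ∀ x {xs ys} → (∀ d → e xs d ≈ e ys d) → ∀ d → e (x ∷ xs) d ≈ e (x ∷ ys) d
  e-cong-∷ x eq zero = ≈-refl
  e-cong-∷ x eq (suc d) = +-cong (eq (suc d)) (*-cong ≈-refl (eq d))

  e-swap : ∀ x y xs d → e (x ∷ y ∷ xs) d ≈ e (y ∷ x ∷ xs) d
  e-swap x y xs zero = ≈-refl
  e-swap x y xs (suc zero) = +-cong (+-cong ≈-refl (*-cong ≈-refl (e-zero xs))) (*-cong ≈-refl ≈-refl) ⟨trans⟩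
    (solve 3 (λ x y a → (a :+ y :* con 1ℚ) :+ x :* con 1ℚ := (a :+ x :* con 1ℚ) :+ y :* con 1ℚ) ≈-refl x y (e xs 1) ⟨trans⟩
     +-cong (+-cong ≈-refl (*-cong ≈-refl (≈-sym (e-zero xs)))) ≈-refl)
    where infixr 4 _⟨trans⟩_
          _⟨trans⟩_ = ≈-trans
  e-swap x y xs (suc (suc d)) =
    solve 5 (λ x y a b c → (a :+ y :* b) :+ x :* (b :+ y :* c) := (a :+ x :* b) :+ y :* (b :+ x :* c)) ≈-refl x y
      (e xs (suc (suc d))) (e xs (suc d)) (e xs d)

  e-↭ : ∀ {xs ys} → xs ↭ ys → ∀ d → e xs d ≈ e ys d
  e-↭ Perm.refl d = ≈-refl
  e-↭ (Perm.prep x p) d = e-cong-∷ x (e-↭ p) d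
  e-↭ (Perm.swap x y p) d = ≈-trans (e-swap x y _ d) (e-cong-∷ y (e-cong-∷ x (e-↭ p)) d)
  e-↭ (Perm.trans p q) d = ≈-trans (e-↭ p d) (e-↭ q d)

  ε-↭ : ∀ {xs ys} → xs ↭ ys → ∀ d → ε xs d ≈ ε ys d
  ε-↭ {xs} {ys} p d = ≈-trans (ε-sgn xs d) (≈-trans (*-cong ≈-refl (e-↭ p d)) (≈-sym (ε-sgn ys d)))

  h-cong-∷ : ∀ x {xs ys} → (∀ d → h xs d ≈ h ys d) → ∀ d → h (x ∷ xs) d ≈ h (x ∷ ys) d
  h-cong-∷ x eq zero = ≈-refl
  h-cong-∷ x eq (suc d) = +-cong (eq (suc d)) (*-cong ≈-refl (h-cong-∷ x eq d))

  -- Unlike `e`, the recursion of `h` keeps its first variable. Symmetry in degree d + 2 therefore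
  -- uses the induction hypothesis in degrees d + 1 and d to expand by the other variable.
  h-swap : ∀ x y xs d → h (x ∷ y ∷ xs) d ≈ h (y ∷ x ∷ xs) d
  h-swap x y xs zero = ≈-refl
  h-swap x y xs (suc zero) =
    solve 3 (λ x y a → (a :+ y :* con 1ℚ) :+ x :* con 1ℚ := (a :+ x :* con 1ℚ) :+ y :* con 1ℚ) ≈-refl x y (h xs 1)
  h-swap x y xs (suc (suc d)) = begin
    (h xs (2 + d) ⊞ y ⊠ h (y ∷ xs) (suc d)) ⊞ x ⊠ h (x ∷ y ∷ xs) (suc d)
      ≈⟨ +-cong ≈-refl (*-cong ≈-refl (≈-trans (h-swap x y xs (suc d)) (+-cong ≈-refl (*-cong ≈-refl (≈-sym (h-swap x y xs d)))))) ⟩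
    (h xs (2 + d) ⊞ y ⊠ h (y ∷ xs) (suc d)) ⊞ x ⊠ (h (x ∷ xs) (suc d) ⊞ y ⊠ h (x ∷ y ∷ xs) d)
      ≈⟨ solve 6 (λ x y a b c f → (a :+ y :* b) :+ x :* (c :+ y :* f) := (a :+ x :* c) :+ y :* (b :+ x :* f)) ≈-refl x y
          (h xs (2 + d)) (h (y ∷ xs) (suc d)) (h (x ∷ xs) (suc d)) (h (x ∷ y ∷ xs) d) ⟩
    (h xs (2 + d) ⊞ x ⊠ h (x ∷ xs) (suc d)) ⊞ y ⊠ h (x ∷ y ∷ xs) (suc d)
      ≈⟨ +-cong ≈-refl (*-cong ≈-refl (h-swap x y xs (suc d))) ⟩
    (h xs (2 + d) ⊞ x ⊠ h (x ∷ xs) (suc d)) ⊞ y ⊠ h (y ∷ x ∷ xs) (suc d) ∎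

  h-↭ : ∀ {xs ys} → xs ↭ ys → ∀ d → h xs d ≈ h ys d
  h-↭ Perm.refl d = ≈-refl
  h-↭ (Perm.prep x p) d = h-cong-∷ x (h-↭ p) d
  h-↭ (Perm.swap x y p) d = ≈-trans (h-swap x y _ d) (h-cong-∷ y (h-cong-∷ x (h-↭ p)) d)
  h-↭ (Perm.trans p q) d = ≈-trans (h-↭ p d) (h-↭ q d)

  sumN-split : ∀ a b f → sumN (a + b) f ≈ sumN a f ⊞ sumN b (λ j → f (a + j))
  sumN-split a zero f rewrite ℕP.+-identityʳ a = solve 1 (λ x → x := x :+ con 0ℚ) ≈-refl (sumN a f)
  sumN-split a (suc b) f rewrite ℕP.+-suc a b = ≈-trans (+-cong (sumN-split a b f) ≈-refl)
    (solve 3 (λ x y z → (x :+ y) :+ z := x :+ (y :+ z)) ≈-refl _ _ _)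

  -- Multiplication of the generating function by T^b. A truncated subtraction `m ∸ b` in the index
  -- would give `f 0` where the shifted sequence has to vanish.
  pad : ℕ → (ℕ → Carrier) → ℕ → Carrier
  pad zero f m = f m
  pad (suc b) f zero = 𝟘
  pad (suc b) f (suc m) = pad b f m

  pad-+ : ∀ b f d → pad b f (b + d) ≡ f d
  pad-+ zero f d = refl
  pad-+ (suc b) f d = pad-+ b f d

  pad-cases : ∀ b f m → (pad b f m ≡ 𝟘) ⊎ (∃ λ d → (b + d ≡ m) × (pad b f m ≡ f d))
  pad-cases zero f m = inj₂ (m , refl , refl)
  pad-cases (suc b) f zero = inj₁ refl
  pad-cases (suc b) f (suc m) with pad-cases b f m
  ... | inj₁ z = inj₁ z
  ... | inj₂ (d , eq , eq') = inj₂ (d , cong suc eq , eq')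

  pad-⋆ : ∀ b f g d → (pad b f ⋆ g) (b + d) ≈ (f ⋆ g) d
  pad-⋆ zero f g d = ≈-refl
  pad-⋆ (suc b) f g d = ≈-trans (sumN-front (suc (b + d)) _)
    (≈-trans (solve 2 (λ x y → con 0ℚ :* x :+ y := y) ≈-refl _ _) (pad-⋆ b f g d))

  -- Elements of the exterior algebra of a free module of rank i, by their coordinates at the subsets
  -- of the basis; the head of the vector belongs to basis element i - 1.

  Form : ℕ → Set
  Form i = Vec Bool i → Carrier

  unit : ∀ {i} → Form i
  unit [] = 𝟙
  unit (false ∷ C) = unit C
  unit (true ∷ C) = 𝟘

  -- Left exterior multiplication by the vector with coordinates `r`. For ω = ω₀ + e ∧ ω₁ with e the
  -- last basis vector, the part along e is r_e ω₀ - r' ∧ ω₁; the sign comes from moving r' past e.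
  wedge : (ℕ → Carrier) → ∀ {i} → Form i → Form i
  wedge r ω [] = 𝟘
  wedge r ω (false ∷ C) = wedge r (ω ∘ (false ∷_)) C
  wedge r {suc i} ω (true ∷ C) = r i ⊠ ω (false ∷ C) ⊞ ⊟ wedge r (ω ∘ (true ∷_)) C

  -- The interior product with the functional that takes the values `v` on the basis.
  contract : (ℕ → Carrier) → ∀ {i} → Form i → Form i
  contract v ω [] = 𝟘
  contract v {suc i} ω (false ∷ C) = contract v (ω ∘ (false ∷_)) C ⊞ v i ⊠ ω (true ∷ C)
  contract v ω (true ∷ C) = ⊟ contract v (ω ∘ (true ∷_)) C

  wedge-linear : ∀ r {i} (ω ω' ω'' : Form i) a b → (∀ C → ω C ≈ a ⊠ ω' C ⊞ b ⊠ ω'' C) →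
    ∀ C → wedge r ω C ≈ a ⊠ wedge r ω' C ⊞ b ⊠ wedge r ω'' C
  wedge-linear r ω ω' ω'' a b eq [] = solve 2 (λ a b → con 0ℚ := a :* con 0ℚ :+ b :* con 0ℚ) ≈-refl a b
  wedge-linear r ω ω' ω'' a b eq (false ∷ C) = wedge-linear r _ _ _ a b (eq ∘ (false ∷_)) C
  wedge-linear r {suc i} ω ω' ω'' a b eq (true ∷ C) = ≈-trans
    (+-cong (*-cong ≈-refl (eq (false ∷ C))) (-‿cong (wedge-linear r _ _ _ a b (eq ∘ (true ∷_)) C)))
    (solve 7 (λ r a x b y p q → r :* (a :* x :+ b :* y) :+ :- (a :* p :+ b :* q) :=
        a :* (r :* x :+ :- p) :+ b :* (r :* y :+ :- q)) ≈-refl (r i) a (ω' (false ∷ C)) b (ω'' (false ∷ C)) _ _)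

  contract-linear : ∀ v {i} (ω ω' ω'' : Form i) a b → (∀ C → ω C ≈ a ⊠ ω' C ⊞ b ⊠ ω'' C) →
    ∀ C → contract v ω C ≈ a ⊠ contract v ω' C ⊞ b ⊠ contract v ω'' C
  contract-linear v ω ω' ω'' a b eq [] = solve 2 (λ a b → con 0ℚ := a :* con 0ℚ :+ b :* con 0ℚ) ≈-refl a b
  contract-linear v ω ω' ω'' a b eq (true ∷ C) = ≈-trans (-‿cong (contract-linear v _ _ _ a b (eq ∘ (true ∷_)) C))
    (solve 4 (λ a p b q → :- (a :* p :+ b :* q) := a :* (:- p) :+ b :* (:- q)) ≈-refl a _ b _)
  contract-linear v {suc i} ω ω' ω'' a b eq (false ∷ C) = ≈-trans
    (+-cong (contract-linear v _ _ _ a b (eq ∘ (false ∷_)) C) (*-cong ≈-refl (eq (true ∷ C))))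
    (solve 7 (λ v a x b y p q → (a :* p :+ b :* q) :+ v :* (a :* x :+ b :* y) :=
        a :* (p :+ v :* x) :+ b :* (q :+ v :* y)) ≈-refl (v i) a (ω' (true ∷ C)) b (ω'' (true ∷ C)) _ _)

  -- The antiderivation law of the interior product, obtained by splitting off the last basis
  -- vector. It does the work of adjugate matrices: a row orthogonal to `v` can be pulled out of a
  -- contraction.
  contract-wedge : ∀ v r {i} (ω : Form i) C →
    contract v (wedge r ω) C ≈ sumN i (λ j → r j ⊠ v j) ⊠ ω C ⊞ ⊟ wedge r (contract v ω) C
  contract-wedge v r ω [] = solve 1 (λ w → con 0ℚ := con 0ℚ :* w :+ :- con 0ℚ) ≈-refl (ω [])
  contract-wedge v r {suc i} ω (false ∷ C) = begin
    contract v (wedge r ω₀) C ⊞ v i ⊠ (r i ⊠ ω₀ C ⊞ ⊟ wedge r ω₁ C)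
      ≈⟨ +-cong (contract-wedge v r ω₀ C) ≈-refl ⟩
    (s ⊠ ω₀ C ⊞ ⊟ wedge r (contract v ω₀) C) ⊞ v i ⊠ (r i ⊠ ω₀ C ⊞ ⊟ wedge r ω₁ C)
      ≈⟨ solve 6 (λ s w p v r q → (s :* w :+ :- p) :+ v :* (r :* w :+ :- q) :=
           (s :+ r :* v) :* w :+ :- (con 1ℚ :* p :+ v :* q)) ≈-refl s (ω₀ C) _ (v i) (r i) _ ⟩
    (s ⊞ r i ⊠ v i) ⊠ ω₀ C ⊞ ⊟ (𝟙 ⊠ wedge r (contract v ω₀) C ⊞ v i ⊠ wedge r ω₁ C)
      ≈⟨ +-cong ≈-refl (-‿cong (wedge-linear r _ _ _ 𝟙 (v i)
           (λ C → solve 2 (λ p q → p :+ q := con 1ℚ :* p :+ q) ≈-refl _ _) C)) ⟨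
    (s ⊞ r i ⊠ v i) ⊠ ω₀ C ⊞ ⊟ wedge r (contract v ω ∘ (false ∷_)) C ∎
    where
    s = sumN i (λ j → r j ⊠ v j)
    ω₀ = ω ∘ (false ∷_)
    ω₁ = ω ∘ (true ∷_)
    
  contract-wedge v r {suc i} ω (true ∷ C) = begin
    ⊟ contract v (wedge r ω ∘ (true ∷_)) C
      ≈⟨ -‿cong (contract-linear v _ ω₀ (wedge r ω₁) (r i) (⊟ 𝟙)
           (λ C → solve 2 (λ p q → p :+ :- q := p :+ (:- con 1ℚ) :* q) ≈-refl _ _) C) ⟩
    ⊟ (r i ⊠ contract v ω₀ C ⊞ ⊟ 𝟙 ⊠ contract v (wedge r ω₁) C)
      ≈⟨ -‿cong (+-cong ≈-refl (*-cong ≈-refl (contract-wedge v r ω₁ C))) ⟩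
    ⊟ (r i ⊠ contract v ω₀ C ⊞ ⊟ 𝟙 ⊠ (s ⊠ ω₁ C ⊞ ⊟ wedge r (contract v ω₁) C))
      -- The zero multiple of `q` is the second summand that the form of `wedge-linear` asks for.
      ≈⟨ solve 6 (λ r p s w q v → :- (r :* p :+ (:- con 1ℚ) :* (s :* w :+ :- q)) :=
           (s :+ r :* v) :* w :+ :- (r :* (p :+ v :* w) :+ :- ((:- con 1ℚ) :* q :+ con 0ℚ :* q))) ≈-refl
           (r i) (contract v ω₀ C) s (ω₁ C) (wedge r (contract v ω₁) C) (v i) ⟩
    (s ⊞ r i ⊠ v i) ⊠ ω₁ C ⊞ ⊟ (r i ⊠ (contract v ω₀ C ⊞ v i ⊠ ω₁ C) ⊞ ⊟ (⊟ 𝟙 ⊠ wedge r (contract v ω₁) C ⊞ 𝟘 ⊠ wedge r (contract v ω₁) C))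
      ≈⟨ +-cong ≈-refl (-‿cong (+-cong ≈-refl (-‿cong (wedge-linear r _ _ (contract v ω₁) (⊟ 𝟙) (𝟘)
           (λ C → solve 1 (λ p → :- p := (:- con 1ℚ) :* p :+ con 0ℚ :* p) ≈-refl _) C)))) ⟨
    (s ⊞ r i ⊠ v i) ⊠ ω₁ C ⊞ ⊟ (r i ⊠ (contract v ω₀ C ⊞ v i ⊠ ω₁ C) ⊞ ⊟ wedge r (contract v ω ∘ (true ∷_)) C) ∎
    where
    s = sumN i (λ j → r j ⊠ v j)
    ω₀ = ω ∘ (false ∷_)
    ω₁ = ω ∘ (true ∷_)

  wedges : List (ℕ → Carrier) → ∀ {i} → Form i
  wedges [] = unit
  wedges (r ∷ rs) = wedge r (wedges rs)

  allTrue : ∀ i → Vec Bool i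
  allTrue i = replicate i true

  -- A contraction at a subset collects the values at the subsets with one more element, and the
  -- full set has none above it.
  contract-top : ∀ v {i} (ω : Form i) → contract v ω (allTrue i) ≈ 𝟘
  contract-top v {zero} ω = ≈-refl
  contract-top v {suc i} ω = ≈-trans (-‿cong (contract-top v {i} (ω ∘ (true ∷_)))) (solve 0 (:- con 0ℚ := con 0ℚ) ≈-refl)

  contract-unit : ∀ v {i} (C : Vec Bool i) → contract v unit C ≈ 𝟘
  contract-unit v [] = ≈-refl
  contract-unit v {suc i} (false ∷ C) = ≈-trans (+-cong (contract-unit v C) ≈-refl) (solve 1 (λ v → con 0ℚ :+ v :* con 0ℚ := con 0ℚ) ≈-refl (v i))
  contract-unit v (true ∷ C) = ≈-trans (-‿cong (contract-0 C)) (solve 0 (:- con 0ℚ := con 0ℚ) ≈-refl)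
    where
    contract-0 : ∀ {i} (C : Vec Bool i) → contract v (λ _ → 𝟘) C ≈ 𝟘
    contract-0 [] = ≈-refl
    contract-0 {suc i} (false ∷ C) = ≈-trans (+-cong (contract-0 C) ≈-refl) (solve 1 (λ v → con 0ℚ :+ v :* con 0ℚ := con 0ℚ) ≈-refl (v i))
    contract-0 (true ∷ C) = ≈-trans (-‿cong (contract-0 C)) (solve 0 (:- con 0ℚ := con 0ℚ) ≈-refl)

  -- Rows are defined on all of ℕ, so the same rows give forms of every rank. Avoiding the last
  -- basis vector lowers the rank, which lets the determinant of the earlier rows appear when a
  -- larger one is expanded along its newest row.
  wedges-false : ∀ rs {i} (C : Vec Bool i) → wedges rs (false ∷ C) ≈ wedges rs C
  wedges-false [] C = ≈-refl
  wedges-false (r ∷ rs) C = go C _ _ (wedges-false rs)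
    where
    go : ∀ {i} (C : Vec Bool i) (ω ω' : Form i) → (∀ C → ω C ≈ ω' C) → wedge r ω C ≈ wedge r ω' C
    go [] ω ω' eq = ≈-refl
    go (false ∷ C) ω ω' eq = go C _ _ (eq ∘ (false ∷_))
    go (true ∷ C) ω ω' eq = +-cong (*-cong ≈-refl (eq (false ∷ C))) (-‿cong (go C _ _ (eq ∘ (true ∷_))))

  record IsIdeal (I : Carrier → Set) : Set where
    field
      ideal-≈ : ∀ {x y} → x ≈ y → I x → I y
      ideal-0 : I 𝟘
      ideal-+ : ∀ {x y} → I x → I y → I (x ⊞ y)
      ideal-* : ∀ a {x} → I x → I (a ⊠ x)

    ideal-neg : ∀ {x} → I x → I (⊟ x)
    ideal-neg {x} i = ideal-≈ (solve 1 (λ x → (:- con 1ℚ) :* x := :- x) ≈-refl x) (ideal-* _ i)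

    ideal-cancel : ∀ {x y} → I (x ⊞ y) → I x → I y
    ideal-cancel {x} {y} i j = ideal-≈ (solve 2 (λ x y → (x :+ y) :+ :- x := y) ≈-refl x y) (ideal-+ i (ideal-neg j))

    ideal-sum : ∀ n f → (∀ j → j < n → I (f j)) → I (sumN n f)
    ideal-sum zero f h = ideal-0
    ideal-sum (suc n) f h = ideal-+ (ideal-sum n f λ j j<n → h j (ℕP.m≤n⇒m≤1+n j<n)) (h n ℕP.≤-refl)

    ideal-wedge : ∀ r {i} (ω : Form i) → (∀ C → I (ω C)) → ∀ C → I (wedge r ω C)
    ideal-wedge r ω h [] = ideal-0
    ideal-wedge r ω h (false ∷ C) = ideal-wedge r _ (h ∘ (false ∷_)) C
    ideal-wedge r ω h (true ∷ C) = ideal-+ (ideal-* _ (h (false ∷ C))) (ideal-neg (ideal-wedge r _ (h ∘ (true ∷_)) C))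

    -- The contraction kills the unit and passes each row by the antiderivation law, at the cost of
    -- a multiple of the pairing of that row with `v`.
    contract-wedges : ∀ v rs {i} → All (λ r → I (sumN i (λ j → r j ⊠ v j))) rs → (C : Vec Bool i) → I (contract v (wedges rs) C)
    contract-wedges v [] [] C = ideal-≈ (≈-sym (contract-unit v C)) ideal-0
    contract-wedges v (r ∷ rs) (ir ∷ irs) C = ideal-≈ (≈-sym (contract-wedge v r (wedges rs) C))
      (ideal-+ (ideal-≈ (solve 2 (λ a b → b :* a := a :* b) ≈-refl _ _) (ideal-* (wedges rs C) ir))
        (ideal-neg (ideal-wedge r _ (contract-wedges v rs irs) C)))

    -- The contraction of the product of the rows with v has the determinant times v i as a coordinate.
    cramer : ∀ v rs i → v i ≈ 𝟙 → All (λ r → I (sumN (suc i) (λ j → r j ⊠ v j))) rs → I (wedges rs (allTrue (suc i)))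
    cramer v rs i v1 irs = ideal-≈ (begin
      contract v (wedges rs) (false ∷ allTrue i)
        ≈⟨ +-cong (contract-top v {i} (wedges rs ∘ (false ∷_))) (*-cong v1 ≈-refl) ⟩
      𝟘 ⊞ 𝟙 ⊠ wedges rs (allTrue (suc i))
        ≈⟨ solve 1 (λ x → con 0ℚ :+ con 1ℚ :* x := x) ≈-refl _ ⟩
      wedges rs (allTrue (suc i)) ∎) (contract-wedges v rs irs (false ∷ allTrue i))

-- Used for evaluation at a point, with values in ℚ, and for permutations of the variables.
module Homomorphism (R : CommutativeRing 0ℓ 0ℓ) (algR : IsAlgebra R) (S : CommutativeRing 0ℓ 0ℓ) (algS : IsAlgebra S) where
  private
    module A = Symmetric R algR
    module B = Symmetric S algS

  module _ (f : A.Carrier → B.Carrier)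
    (f-+ : ∀ x y → f (x A.⊞ y) B.≈ f x B.⊞ f y)
    (f-* : ∀ x y → f (x A.⊠ y) B.≈ f x B.⊠ f y)
    (f-0 : f A.𝟘 B.≈ B.𝟘) (f-1 : f A.𝟙 B.≈ B.𝟙) where

    hom-e : ∀ xs d → f (A.e xs d) B.≈ B.e (map f xs) d
    hom-e [] zero = f-1
    hom-e [] (suc d) = f-0
    hom-e (x ∷ xs) zero = f-1
    hom-e (x ∷ xs) (suc d) = B.≈-trans (f-+ _ _) (B.+-cong (hom-e xs (suc d))
      (B.≈-trans (f-* _ _) (B.*-cong B.≈-refl (hom-e xs d))))

    hom-h : ∀ xs d → f (A.h xs d) B.≈ B.h (map f xs) d
    hom-h [] zero = f-1
    hom-h [] (suc d) = f-0
    hom-h (x ∷ xs) zero = f-1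
    hom-h (x ∷ xs) (suc d) = B.≈-trans (f-+ _ _) (B.+-cong (hom-h xs (suc d))
      (B.≈-trans (f-* _ _) (B.*-cong B.≈-refl (hom-h (x ∷ xs) d))))

    hom-sumN : ∀ i g → f (A.sumN i g) B.≈ B.sumN i (f ∘ g)
    hom-sumN zero g = f-0
    hom-sumN (suc i) g = B.≈-trans (f-+ _ _) (B.+-cong (hom-sumN i g) B.≈-refl)

    module _ (f-neg : ∀ x → f (A.⊟ x) B.≈ B.⊟ f x) where

      hom-ε : ∀ xs d → f (A.ε xs d) B.≈ B.ε (map f xs) d
      hom-ε [] zero = f-1
      hom-ε [] (suc d) = f-0
      hom-ε (x ∷ xs) zero = f-1
      hom-ε (x ∷ xs) (suc d) = B.≈-trans (f-+ _ _) (B.+-cong (hom-ε xs (suc d))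
        (B.≈-trans (f-neg _) (B.-‿cong (B.≈-trans (f-* _ _) (B.*-cong B.≈-refl (hom-ε xs d))))))

-- Supports, leading monomials and ideals

module PolySym {n : ℕ} = Symmetric (polyRing n) (polyAlgebra n)
open PolySym using (IsIdeal) public

degree : ∀ {n} → Monomial n → ℕ
degree = Vec.sum

degree-⊕ : ∀ {n} (a b : Monomial n) → degree (a ⊕ b) ≡ degree a + degree b
degree-⊕ [] [] = refl
degree-⊕ (x ∷ a) (y ∷ b) = trans (cong (x + y +_) (degree-⊕ a b)) (+-interchange x y (degree a) (degree b))

<nl-⊕ : ∀ {n} {a b : Monomial n} c → a <nl b → (a ⊕ c) <nl (b ⊕ c)
<nl-⊕ {a = []} {[]} [] ()
<nl-⊕ {a = x ∷ a} {y ∷ b} (z ∷ c) (inj₁ a<b) = inj₁ (<nl-⊕ c a<b)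
<nl-⊕ {a = x ∷ a} {y ∷ b} (z ∷ c) (inj₂ (refl , x<y)) = inj₂ (refl , ℕP.+-monoˡ-< z x<y)

<nl-trans : ∀ {n} {a b c : Monomial n} → a <nl b → b <nl c → a <nl c
<nl-trans {a = []} {[]} {[]} ()
<nl-trans {a = _ ∷ _} {_ ∷ _} {_ ∷ _} (inj₁ p) (inj₁ q) = inj₁ (<nl-trans p q)
<nl-trans {a = _ ∷ _} {_ ∷ _} {_ ∷ _} (inj₁ p) (inj₂ (refl , _)) = inj₁ p
<nl-trans {a = _ ∷ _} {_ ∷ _} {_ ∷ _} (inj₂ (refl , _)) (inj₁ q) = inj₁ q
<nl-trans {a = _ ∷ _} {_ ∷ _} {_ ∷ _} (inj₂ (refl , p)) (inj₂ (refl , q)) = inj₂ (refl , ℕP.<-trans p q)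

<nl-irrefl : ∀ {n} {a : Monomial n} → ¬ (a <nl a)
<nl-irrefl {a = _ ∷ _} (inj₁ p) = <nl-irrefl p
<nl-irrefl {a = _ ∷ _} (inj₂ (_ , p)) = ℕP.<-irrefl refl p

expAt-ext : ∀ {n} (a b : Monomial n) → (∀ j → expAt a j ≡ expAt b j) → a ≡ b
expAt-ext [] [] h = refl
expAt-ext (x ∷ a) (y ∷ b) h = cong₂ _∷_ (h 0) (expAt-ext a b (h ∘ suc))

<nl-expAt : ∀ {n} (a b : Monomial n) i → (∀ j → i < j → expAt a j ≡ expAt b j) → expAt a i < expAt b i → a <nl b
<nl-expAt (x ∷ a) (y ∷ b) zero eq lt = inj₂ (expAt-ext a b (λ j → eq (suc j) (s≤s z≤n)) , lt)
<nl-expAt (x ∷ a) (y ∷ b) (suc i) eq lt = inj₁ (<nl-expAt a b i (λ j i<j → eq (suc j) (s≤s i<j)) lt)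

expAt-⊕ : ∀ {n} (a b : Monomial n) i → expAt (a ⊕ b) i ≡ expAt a i + expAt b i
expAt-⊕ [] [] i = refl
expAt-⊕ (x ∷ a) (y ∷ b) zero = refl
expAt-⊕ (x ∷ a) (y ∷ b) (suc i) = expAt-⊕ a b i

expAt-one : ∀ n i → expAt (one {n}) i ≡ 0
expAt-one zero i = refl
expAt-one (suc n) zero = refl
expAt-one (suc n) (suc i) = expAt-one n i

power : ∀ n → ℕ → ℕ → Monomial n
power zero b d = []
power (suc n) zero d = d ∷ one
power (suc n) (suc b) d = 0 ∷ power n b d

expAt-power : ∀ {n b} d → b < n → expAt (power n b d) b ≡ d
expAt-power {suc n} {zero} d lt = refl
expAt-power {suc n} {suc b} d (s≤s lt) = expAt-power d lt

expAt-power-≢ : ∀ n {b j} d → j ≢ b → expAt (power n b d) j ≡ 0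
expAt-power-≢ zero d ne = refl
expAt-power-≢ (suc n) {zero} {zero} d ne = ⊥-elim (ne refl)
expAt-power-≢ (suc n) {zero} {suc j} d ne = expAt-one n j
expAt-power-≢ (suc n) {suc b} {zero} d ne = refl
expAt-power-≢ (suc n) {suc b} {suc j} d ne = expAt-power-≢ n d (ne ∘ cong suc)

power-0 : ∀ n b → power n b 0 ≡ one
power-0 zero b = refl
power-0 (suc n) zero = refl
power-0 (suc n) (suc b) = cong (0 ∷_) (power-0 n b)

power-suc : ∀ n b d → power n b 1 ⊕ power n b d ≡ power n b (suc d)
power-suc zero b d = refl
power-suc (suc n) zero d = cong (suc d ∷_) (⊕-identityˡ one)
power-suc (suc n) (suc b) d = cong (0 ∷_) (power-suc n b d)

x[_] : ∀ {n} → ℕ → Poly n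
x[ p ] = mono (power _ p 1)

unitVec-power : ∀ {n} (i : Fin n) → unitVec i ≡ power n (toℕ i) 1
unitVec-power {suc n} Fin.zero = cong (1 ∷_) (zeros n)
  where
  zeros : ∀ n → tabulate {n = n} (λ _ → 0) ≡ one
  zeros zero = refl
  zeros (suc n) = cong (0 ∷_) (zeros n)
unitVec-power {suc n} (Fin.suc i) = cong (0 ∷_) (unitVec-power i)

var-x : ∀ {n} (i : Fin n) → var i ≡ x[ toℕ i ]
var-x i = cong mono (unitVec-power i)

-- A list can contain terms that cancel, so a condition on the support is imposed on some
-- representative rather than on the given list.
record Supp {n} (P : Monomial n → Set) (p : Poly n) : Set where
  constructor supp
  field
    terms : Poly n
    allTerms : All (P ∘ proj₂) terms
    ≋terms : p ≋ terms

All-mul : ∀ {n} {P Q S : Monomial n → Set} → (∀ {a b} → P a → Q b → S (a ⊕ b)) →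
  ∀ {p q} → All (P ∘ proj₂) p → All (Q ∘ proj₂) q → All (S ∘ proj₂) (p *ₚ q)
All-mul f [] qs = []
All-mul {P = P} {Q} {S} f {p = (c , a) ∷ p} {q} (pa ∷ ps) qs = AllP.++⁺ (AllP.map⁺ (All.map (f pa) qs)) (All-mul {P = P} {Q} {S} f ps qs)

All-scale : ∀ {X : Set} {P : X → Set} c {v : Free X} → All (P ∘ proj₂) v → All (P ∘ proj₂) (scaleF c v)
All-scale c = AllP.map⁺

Supp-map : ∀ {n} {P Q : Monomial n → Set} {p} → (∀ {a} → P a → Q a) → Supp P p → Supp Q p
Supp-map f (supp R a e) = supp R (All.map f a) e

Supp-≋ : ∀ {n} {P : Monomial n → Set} {p q} → p ≋ q → Supp P p → Supp P q
Supp-≋ e (supp R a e') = supp R a (≋-trans (≋-sym e) e')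

Supp-+ : ∀ {n} {P : Monomial n → Set} {p q} → Supp P p → Supp P q → Supp P (p +ₚ q)
Supp-+ (supp R a e) (supp R' a' e') = supp (R ++ R') (AllP.++⁺ a a') (add-cong e e')

Supp-neg : ∀ {n} {P : Monomial n → Set} {p} → Supp P p → Supp P (negP p)
Supp-neg {P = P} (supp R a e) = supp (negP R) (All-scale {P = P} (-q 1ℚ) a) (neg-cong e)

Supp-* : ∀ {n} {P Q S : Monomial n → Set} → (∀ {a b} → P a → Q b → S (a ⊕ b)) → ∀ {p q} →
  Supp P p → Supp Q q → Supp S (p *ₚ q)
Supp-* {P = P} {Q} {S} f (supp R a e) (supp R' a' e') = supp (R *ₚ R') (All-mul {P = P} {Q} {S} f a a') (mul-cong e e')

Supp-0 : ∀ {n} {P : Monomial n → Set} → Supp P zeroP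
Supp-0 = supp [] [] ≋-refl

Supp-mono : ∀ {n} {P : Monomial n → Set} {m} → P m → Supp P (mono m)
Supp-mono pm = supp (mono _) (pm ∷ []) ≋-refl

-- A monic leading term with an explicit tail: it is stable under products by construction, and the
-- tail is what `reduce` later rewrites the monomial to.
record Lead {n} (p : Poly n) (m : Monomial n) : Set where
  constructor mkLead
  field
    tail : Poly n
    tail-< : All ((_<nl m) ∘ proj₂) tail
    ≋lead : p ≋ (mono m +ₚ tail)

Lead-≋ : ∀ {n} {p q : Poly n} {m} → p ≋ q → Lead p m → Lead q m
Lead-≋ e (mkLead R a e') = mkLead R a (≋-trans (≋-sym e) e')

Lead-mono : ∀ {n} (m : Monomial n) → Lead (mono m) m
Lead-mono m = mkLead [] [] ≋-refl

Lead-+ : ∀ {n} {p q : Poly n} {m} → Lead p m → Supp (_<nl m) q → Lead (p +ₚ q) m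
Lead-+ (mkLead R a e) (supp R' a' e') = mkLead (R ++ R') (AllP.++⁺ a a') (add-cong e e')

Lead-* : ∀ {n} {p q : Poly n} {a b} → Lead p a → Lead q b → Lead (p *ₚ q) (a ⊕ b)
Lead-* {n} {p} {q} {a} {b} (mkLead R r e) (mkLead R' r' e') = mkLead
  ((mono a *ₚ R') +ₚ (R *ₚ (mono b +ₚ R')))
  (AllP.++⁺
    (All-mul {P = _≡ a} {Q = _<nl b} {S = _<nl (a ⊕ b)} (λ { {_} {c} refl c<b → subst (_<nl (a ⊕ b)) (⊕-comm c a) (subst ((c ⊕ a) <nl_) (⊕-comm b a) (<nl-⊕ a c<b)) }) {p = mono a} (refl ∷ []) r')
    (All-mul {P = _<nl a} {Q = λ c → c ≡ b ⊎ c <nl b} {S = _<nl (a ⊕ b)} both r (inj₁ refl ∷ All.map inj₂ r')))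
  (≋-trans (mul-cong e e') (PolySym.solve 4 (λ a b r s → (a :+ r) :* (b :+ s) := a :* b :+ (a :* s :+ r :* (b :+ s))) ≋-refl (mono a) (mono b) R R'))
  where
  open PolySym using (_:+_; _:*_; _:=_)
  both : ∀ {c d} → c <nl a → d ≡ b ⊎ d <nl b → (c ⊕ d) <nl (a ⊕ b)
  both c<a (inj₁ refl) = <nl-⊕ b c<a
  both {c} {d} c<a (inj₂ d<b) = <nl-trans (<nl-⊕ d c<a)
    (subst (_<nl (a ⊕ b)) (⊕-comm d a) (subst ((d ⊕ a) <nl_) (⊕-comm b a) (<nl-⊕ a d<b)))

coeff-∈ : ∀ {n} {P : Monomial n → Set} (v : Poly n) {m} → All (P ∘ proj₂) v → coeffP v m ≢ 0ℚ → P m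
coeff-∈ [] [] nz = ⊥-elim (nz refl)
coeff-∈ {P = P} ((c , y) ∷ v) {m} (py ∷ pv) nz with y ≟ₘ m
... | yes refl = py
... | no _ = coeff-∈ {P = P} v pv nz

Lead⇒LeadMon : ∀ {n} {p : Poly n} {m} → Lead p m → LeadMon p m
Lead⇒LeadMon {p = p} {m} (mkLead R a e) = nonzero , λ m' nz → coeff-∈ {P = _≤nl m} (mono m +ₚ R) (inj₁ refl ∷ All.map inj₂ a) (subst (_≢ 0ℚ) (coeffs e m') nz)
  where
  nonzero : coeffP p m ≢ 0ℚ
  nonzero z with trans (sym z) (coeffs e m)
  ... | eq with m ≟ₘ m
  ...   | no ne = ne refl
  ...   | yes _ with trans eq (cong (1ℚ +q_) (MonoD.coeff-∉ {P = _<nl m} R a <nl-irrefl))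
  ...     | ()

-- Monomials in an initial segment of the variables

record UsesBelow {n} (b : ℕ) (m : Monomial n) : Set where
  constructor usesBelow
  field zeroAbove : ∀ j → b ≤ j → expAt m j ≡ 0

record Bounded {n} (b d : ℕ) (m : Monomial n) : Set where
  constructor bounded
  field
    above : UsesBelow (suc b) m
    bound : expAt m b ≤ d

UsesBelow-⊕ : ∀ {n b} {a c : Monomial n} → UsesBelow b a → UsesBelow b c → UsesBelow b (a ⊕ c)
UsesBelow-⊕ {a = a} {c} f g = usesBelow λ j le → trans (expAt-⊕ a c j) (cong₂ _+_ (UsesBelow.zeroAbove f j le) (UsesBelow.zeroAbove g j le))

UsesBelow-mono : ∀ {n b b'} {a : Monomial n} → b ≤ b' → UsesBelow b a → UsesBelow b' a
UsesBelow-mono le f = usesBelow λ j le' → UsesBelow.zeroAbove f j (ℕP.≤-trans le le')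

UsesBelow-one : ∀ {n b} → UsesBelow b (one {n})
UsesBelow-one {n} = usesBelow λ j _ → expAt-one n j

UsesBelow-power : ∀ {n} b d → UsesBelow (suc b) (power n b d)
UsesBelow-power {n} b d = usesBelow λ j b<j → expAt-power-≢ n d (λ { refl → ℕP.<-irrefl refl b<j })

Bounded-⊕ : ∀ {n b d d'} {a c : Monomial n} → Bounded b d a → Bounded b d' c → Bounded b (d + d') (a ⊕ c)
Bounded-⊕ {b = b} {a = a} {c} (bounded u l) (bounded u' l') = bounded (UsesBelow-⊕ u u') (subst (_≤ _) (sym (expAt-⊕ a c b)) (ℕP.+-mono-≤ l l'))

UsesBelow⇒Bounded : ∀ {n b d} {a : Monomial n} → UsesBelow b a → Bounded b d a
UsesBelow⇒Bounded {b = b} {d} f = bounded (UsesBelow-mono (ℕP.n≤1+n b) f) (subst (_≤ d) (sym (UsesBelow.zeroAbove f b ℕP.≤-refl)) z≤n)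

Bounded⇒<nl : ∀ {n b d} {a c : Monomial n} → Bounded b d a → UsesBelow (suc b) c → d < expAt c b → a <nl c
Bounded⇒<nl {b = b} {a = a} {c} (bounded u l) u' lt = <nl-expAt a c b (λ j b<j → trans (UsesBelow.zeroAbove u j b<j) (sym (UsesBelow.zeroAbove u' j b<j))) (ℕP.≤-<-trans l lt)

-- Descending, so that the recursion of `h` splits off the largest variable first, the one whose
-- exponent decides the neglex comparison.
segment : ℕ → ℕ → List ℕ
segment o zero = []
segment o (suc j) = o + j ∷ segment o j

seg : ∀ {n} → ℕ → ℕ → List (Poly n)
seg o j = map x[_] (segment o j)

h-UsesBelow : ∀ {n} o j d → Supp {n} (UsesBelow (o + j)) (PolySym.h (seg o j) d)
h-UsesBelow {n} o zero zero = Supp-mono UsesBelow-one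
h-UsesBelow o zero (suc d) = Supp-0
h-UsesBelow {n} o (suc j) zero = Supp-mono UsesBelow-one
h-UsesBelow {n} o (suc j) (suc d) = Supp-+
  (Supp-map (UsesBelow-mono (ℕP.+-monoʳ-≤ o (ℕP.n≤1+n j))) (h-UsesBelow o j (suc d)))
  (Supp-* UsesBelow-⊕ (Supp-mono (subst (λ b → UsesBelow b (power n (o + j) 1)) (sym (ℕP.+-suc o j)) (UsesBelow-power (o + j) 1))) (h-UsesBelow o (suc j) d))

h-Bounded : ∀ {n} o j d → o + j < n → Supp {n} (Bounded (o + j) d) (PolySym.h (seg o (suc j)) d)
h-Bounded {n} o j zero lt = Supp-mono (UsesBelow⇒Bounded UsesBelow-one)
h-Bounded {n} o j (suc d) lt = Supp-+ (Supp-map UsesBelow⇒Bounded (h-UsesBelow o j (suc d)))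
  (Supp-* Bounded-⊕ (Supp-mono (bounded (UsesBelow-power (o + j) 1) (ℕP.≤-reflexive (expAt-power 1 lt)))) (h-Bounded o j d lt))

-- One summand of the recursion gains a factor of the largest variable; the other avoids this
-- variable and is therefore smaller in neglex order.
h-Lead : ∀ {n} o j d → o + j < n → Lead {n} (PolySym.h (seg o (suc j)) d) (power n (o + j) d)
h-Lead {n} o j zero lt = subst (Lead oneP) (sym (power-0 n (o + j))) (Lead-mono one)
h-Lead {n} o j (suc d) lt = Lead-≋ (add-comm (x[ o + j ] *ₚ PolySym.h (seg o (suc j)) d) (PolySym.h (seg o j) (suc d))) (Lead-+
  (subst (Lead _) (power-suc n (o + j) d) (Lead-* (Lead-mono (power n (o + j) 1)) (h-Lead o j d lt)))
  (Supp-map (λ u → Bounded⇒<nl (UsesBelow⇒Bounded u) (UsesBelow-power (o + j) (suc d)) (subst (0 <_) (sym (expAt-power (suc d) lt)) (s≤s z≤n)))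
    (h-UsesBelow o j (suc d))))

-- Membership in a finitely generated ideal

record Member {n} (gs : List (Poly n)) (p : Poly n) : Set where
  constructor member
  field inIdeal : InIdeal gs p
open Member public

Member-isIdeal : ∀ {n} (gs : List (Poly n)) → IsIdeal (Member gs)
Member-isIdeal gs = record
  { ideal-≈ = λ { {p} {q} e (member (cs , g , e')) → member (cs , g , λ m → trans (sym (coeffs e m)) (e' m)) }
  ; ideal-0 = member ([] , [] , λ m → refl)
  ; ideal-+ = λ { {p} {q} (member (cs , g , e)) (member (cs' , g' , e')) → member (cs ++ cs' , AllP.++⁺ g g' ,
      coeffs (≋-trans (add-cong {p = p} {sumP (map expand cs)} {q} {sumP (map expand cs')} (mk≋ e) (mk≋ e')) (≋-reflexive (combine cs cs')))) }
  ; ideal-* = λ { a {p} (member (cs , g , e)) → member (map (λ c → (a *ₚ proj₁ c , proj₂ c)) cs , AllP.map⁺ g ,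
      coeffs (≋-trans (mul-cong {p = a} {a} {p} {sumP (map expand cs)} ≋-refl (mk≋ e)) (distribute a cs))) }
  }
  where
  expand = λ (c : Poly _ × Poly _) → proj₁ c *ₚ proj₂ c
  combine : ∀ cs cs' → sumP (map expand cs) +ₚ sumP (map expand cs') ≡ sumP (map expand (cs ++ cs'))
  combine cs cs' = sym (trans (cong sumP (ListP.map-++ expand cs cs')) (sym (ListP.concat-++ (map expand cs) (map expand cs'))))
  distribute : ∀ a cs → (a *ₚ sumP (map expand cs)) ≋ sumP (map expand (map (λ c → (a *ₚ proj₁ c , proj₂ c)) cs))
  distribute a [] = mul-comm a []
  distribute a ((b , g) ∷ cs) = ≋-trans (distribˡ a (b *ₚ g) (sumP (map expand cs)))
    (add-cong (≋-sym (mul-assoc a b g)) (distribute a cs))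

module Ideal {n} (gs : List (Poly n)) where
  open IsIdeal (Member-isIdeal gs) public

  ideal-gen : ∀ {g} → g ∈ gs → Member gs g
  ideal-gen {g} g∈ = member ((oneP , g) ∷ [] , g∈ ∷ [] ,
    coeffs (≋-trans (≋-sym (mul-oneˡ g)) (≋-reflexive (sym (ListP.++-identityʳ (oneP *ₚ g))))))

  ideal-elim : (P : Poly n → Set) → (∀ {p q} → p ≋ q → P p → P q) → P zeroP → (∀ {p q} → P p → P q → P (p +ₚ q)) →
    (∀ a {g} → g ∈ gs → P (a *ₚ g)) → ∀ {p} → Member gs p → P p
  ideal-elim P P-≋ P-0 P-+ P-gen (member (cs , g , e)) = P-≋ (mk≋ λ m → sym (e m)) (go cs g)
    where
    go : ∀ cs → All (λ c → proj₂ c ∈ gs) cs → P (sumP (map (λ c → proj₁ c *ₚ proj₂ c) cs))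
    go [] [] = P-0
    go ((a , g) ∷ cs) (g∈ ∷ gs∈) = P-+ (P-gen a g∈) (go cs gs∈)

-- The determinants with leading monomial x(S)*

unique-↭ : ∀ {A : Set} {xs ys : List A} → Unique xs → Unique ys → (∀ {x} → x ∈ xs → x ∈ ys) → (∀ {x} → x ∈ ys → x ∈ xs) → xs ↭ ys
unique-↭ u v f g = ∼bag⇒↭ (MemK.unique∧set⇒bag u v (mk⇔ f g))

falses : ∀ {n} → Vec Bool n → ℕ
falses [] = 0
falses (true ∷ B) = falses B
falses (false ∷ B) = suc (falses B)

expo : ∀ {n} → Vec Bool n → Monomial n
expo [] = []
expo (true ∷ B) = suc (falses B) ∷ expo B
expo (false ∷ B) = 0 ∷ expo B

∣∣+falses : ∀ {n} (B : Subset n) → ∣ B ∣ + falses B ≡ n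
∣∣+falses [] = refl
∣∣+falses (true ∷ B) = cong suc (∣∣+falses B)
∣∣+falses (false ∷ B) = trans (ℕP.+-suc ∣ B ∣ (falses B)) (cong suc (∣∣+falses B))

∈-segment⁺ : ∀ {o j q} → o ≤ q → q < o + j → q ∈ segment o j
∈-segment⁺ {o} {zero} {q} o≤q q<o = ⊥-elim (ℕP.<⇒≱ (subst (q <_) (ℕP.+-identityʳ o) q<o) o≤q)
∈-segment⁺ {o} {suc j} {q} o≤q q<o with q ℕ.≟ o + j
... | yes refl = here refl
... | no ne = there (∈-segment⁺ o≤q (ℕP.≤∧≢⇒< (ℕP.≤-pred (subst (q <_) (ℕP.+-suc o j) q<o)) ne))

∈-segment⁻ : ∀ {o} j {q} → q ∈ segment o j → o ≤ q × q < o + j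
∈-segment⁻ {o} (suc j) (here refl) = ℕP.m≤m+n o j , ℕP.≤-reflexive (sym (ℕP.+-suc o j))
∈-segment⁻ {o} (suc j) (there q∈) with ∈-segment⁻ j q∈
... | le , lt = le , ℕP.<-≤-trans lt (ℕP.+-monoʳ-≤ o (ℕP.n≤1+n j))

segment-unique : ∀ o j → Unique (segment o j)
segment-unique o zero = AllPairs.[]
segment-unique o (suc j) = All.tabulate (λ {q} q∈ eq → ℕP.<-irrefl (sym eq) (proj₂ (∈-segment⁻ j q∈))) AllPairs.∷ segment-unique o j

segment-length : ∀ o j → length (segment o j) ≡ j
segment-length o zero = refl
segment-length o (suc j) = cong suc (segment-length o j)

map-toℕ-allFin : ∀ n b l → b + l ≡ n → map toℕ (allFin n) ↭ segment 0 b ++ segment b l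
map-toℕ-allFin n b l refl = unique-↭
  (UniqueP.map⁺ FinP.toℕ-injective (UniqueP.allFin⁺ n))
  (UniqueP.++⁺ (segment-unique 0 b) (segment-unique b l)
    (λ { (q∈ , q∈') → ℕP.<⇒≱ (proj₂ (∈-segment⁻ b q∈)) (proj₁ (∈-segment⁻ l q∈')) }))
  to from
  where
  to : ∀ {q} → q ∈ map toℕ (allFin n) → q ∈ segment 0 b ++ segment b l
  to q∈ with MemP.∈-map⁻ toℕ q∈
  ... | i , _ , refl with toℕ i ℕ.<? b
  ...   | yes lt = MemP.∈-++⁺ˡ (∈-segment⁺ z≤n lt)
  ...   | no ge = MemP.∈-++⁺ʳ (segment 0 b) (∈-segment⁺ (ℕP.≮⇒≥ ge) (FinP.toℕ<n i))
  from' : ∀ {q} → q < n → q ∈ map toℕ (allFin n)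
  from' {q} lt = subst (_∈ map toℕ (allFin n)) (FinP.toℕ-fromℕ< lt) (MemP.∈-map⁺ toℕ (MemP.∈-allFin (fromℕ< lt)))
  from : ∀ {q} → q ∈ segment 0 b ++ segment b l → q ∈ map toℕ (allFin n)
  from q∈ with MemP.∈-++⁻ (segment 0 b) q∈
  ... | inj₁ q∈' = from' (ℕP.<-≤-trans (proj₂ (∈-segment⁻ b q∈')) (ℕP.m≤m+n b l))
  ... | inj₂ q∈' = from' (proj₂ (∈-segment⁻ l q∈'))

vars : ∀ {n} → List (Fin n) → List (Poly n)
vars = map var

vars-x : ∀ {n} (is : List (Fin n)) → vars is ≡ map x[_] (map toℕ is)
vars-x is = trans (ListP.map-cong var-x is) (ListP.map-∘ is)

allVars-split : ∀ n b l → b + l ≡ n → vars (allFin n) ↭ seg 0 b ++ seg b l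
allVars-split n b l eq = subst (_↭ seg 0 b ++ seg b l) (sym (vars-x (allFin n)))
  (subst (map x[_] (map toℕ (allFin n)) ↭_) (ListP.map-++ x[_] (segment 0 b) (segment b l))
    (PermP.map⁺ x[_] (map-toℕ-allFin n b l eq)))

module Determinant {n : ℕ} (I : Poly n → Set) (isIdeal : IsIdeal I) (k i : ℕ) (k+i≡n : k + i ≡ n)
  (ε∈I : ∀ d → i < d → I (PolySym.ε (vars (allFin n)) d)) where

  open PolySym {n} hiding (IsIdeal)
  open IsIdeal isIdeal

  -- With b = p + 1 and columns counted from 0, this is the complete symmetric polynomial of degree
  -- k + 1 + j - b, and zero if that is negative.
  row : ℕ → ℕ → Poly n
  row p j = pad (suc p) (h (seg 0 (suc p))) (suc k + j)

  column : ℕ → Poly n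
  column j = ε (vars (allFin n)) (i ∸ j)

  -- The convolution of the shifted sequence with `G` in degree n + 1 splits after index k. Up to
  -- there the factor from `G` has degree above `i`, so these terms lie in `I`; the other i + 1
  -- terms form the pairing with `column`. The whole sum vanishes.
  row-orthogonal : ∀ p → p < n → I (sumN (suc i) (λ j → row p j ⊠ column j))
  row-orthogonal p p<n = ideal-cancel (ideal-≈ (≈-sym total) ideal-0) first
    where
    F = pad (suc p) (h (seg 0 (suc p)))
    G = ε (vars (allFin n))
    term = λ a → F a ⊠ G (suc n ∸ a)
    first : I (sumN (suc k) term)
    first = ideal-sum (suc k) term λ { a (s≤s a≤k) → ideal-* (F a) (ε∈I (suc n ∸ a) (ℕP.m+n≤o⇒m≤o∸n (suc i)
      (ℕP.≤-trans (ℕP.+-monoʳ-≤ (suc i) a≤k) (ℕP.≤-reflexive (cong suc (trans (ℕP.+-comm i k) k+i≡n)))))) }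
    rest : sumN (suc i) (λ j → term (suc k + j)) ≈ sumN (suc i) (λ j → row p j ⊠ column j)
    rest = sumN-cong (suc i) λ j _ → *-cong (≈-refl {F (suc k + j)}) (≈-reflexive (cong G
      (trans (cong (_∸ (k + j)) (sym k+i≡n)) (ℕP.[m+n]∸[m+o]≡n∸o k i j))))
    total : sumN (suc k) term ⊞ sumN (suc i) (λ j → row p j ⊠ column j) ≈ 𝟘
    total = begin
      sumN (suc k) term ⊞ sumN (suc i) (λ j → row p j ⊠ column j) ≈⟨ +-cong (≈-refl {sumN (suc k) term}) rest ⟨
      sumN (suc k) term ⊞ sumN (suc i) (λ j → term (suc k + j))   ≈⟨ sumN-split (suc k) (suc i) term ⟨
      sumN (suc k + suc i) term ≈⟨ ≈-reflexive (cong (λ l → sumN l term) (cong suc (trans (ℕP.+-suc k i) (cong suc k+i≡n)))) ⟩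
      (F ⋆ G) (suc n) ≈⟨ ≈-reflexive (cong (λ l → (F ⋆ G) (suc l)) (sym (ℕP.m+[n∸m]≡n (ℕP.<⇒≤ p<n)))) ⟩
      (F ⋆ G) (suc p + (n ∸ p)) ≈⟨ pad-⋆ (suc p) (h (seg 0 (suc p))) G (n ∸ p) ⟩
      (h (seg 0 (suc p)) ⋆ G) (n ∸ p)
        ≈⟨ sumN-cong (suc (n ∸ p)) (λ a _ → *-cong (≈-refl {h (seg 0 (suc p)) a}) (ε-↭ (allVars-split n (suc p) l sp+l≡n) (n ∸ p ∸ a))) ⟩
      (h (seg 0 (suc p)) ⋆ ε (seg 0 (suc p) ++ seg (suc p) l)) (n ∸ p) ≈⟨ h⋆ε (seg 0 (suc p)) (seg (suc p) l) (n ∸ p) ⟩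
      ε (seg (suc p) l) (n ∸ p) ≈⟨ ε-vanish (seg (suc p) l) (n ∸ p) short ⟩
      𝟘 ∎
      where
      l = n ∸ suc p
      sp+l≡n : suc p + l ≡ n
      sp+l≡n = ℕP.m+[n∸m]≡n p<n
      -- There are n - p - 1 variables left, one fewer than the degree.
      short : length (seg {n} (suc p) l) < n ∸ p
      short = subst (_< n ∸ p) (sym (trans (ListP.length-map x[_] (segment (suc p) l)) (segment-length (suc p) l)))
        (ℕP.∸-monoʳ-< (ℕP.n<1+n p) p<n)

  -- The accumulator puts the row of the largest variable outermost in the wedge product, so that
  -- the expansion starts with the variable that decides the order.
  rows : ∀ {l} → ℕ → Vec Bool l → List (ℕ → Poly n) → List (ℕ → Poly n)
  rows o [] rs = rs
  rows o (true ∷ B) rs = rows (suc o) B (row o ∷ rs)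
  rows o (false ∷ B) rs = rows (suc o) B rs

  leadOf : ∀ {l} → ℕ → Vec Bool l → Monomial n → Monomial n
  leadOf o [] m = m
  leadOf o (true ∷ B) m = leadOf (suc o) B (m ⊕ power n o (suc (falses B)))
  leadOf o (false ∷ B) m = leadOf (suc o) B m

  det : List (ℕ → Poly n) → Poly n
  det rs = wedges rs (allTrue (length rs))

  Supp-wedge : ∀ {P Q S : Monomial n → Set} → (∀ {a b} → P a → Q b → S (a ⊕ b)) → ∀ r {j} (ω : Form j) →
    (∀ l → l < j → Supp P (r l)) → (∀ C → Supp Q (ω C)) → ∀ C → Supp S (wedge r ω C)
  Supp-wedge f r ω hr hω [] = Supp-0
  Supp-wedge {P} {Q} {S} f r ω hr hω (false ∷ C) =
    Supp-wedge {P} {Q} {S} f r _ (λ l l<j → hr l (ℕP.m≤n⇒m≤1+n l<j)) (hω ∘ (false ∷_)) C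
  Supp-wedge {P} {Q} {S} f r {suc j} ω hr hω (true ∷ C) = Supp-+ (Supp-* {P = P} {Q} {S} f (hr j ℕP.≤-refl) (hω (false ∷ C)))
    (Supp-neg (Supp-wedge {P} {Q} {S} f r _ (λ l l<j → hr l (ℕP.m≤n⇒m≤1+n l<j)) (hω ∘ (true ∷_)) C))

  row-UsesBelow : ∀ p j → Supp (UsesBelow (suc p)) (row p j)
  row-UsesBelow p j with pad-cases (suc p) (h (seg 0 (suc p))) (suc k + j)
  ... | inj₁ eq = subst (Supp _) (sym eq) Supp-0
  ... | inj₂ (d , _ , eq) = subst (Supp _) (sym eq) (h-UsesBelow 0 (suc p) d)

  row-Bounded : ∀ p j d → p < n → suc k + j ≤ suc p + d → Supp (Bounded p d) (row p j)
  row-Bounded p j d p<n le with pad-cases (suc p) (h (seg 0 (suc p))) (suc k + j)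
  ... | inj₁ eq = subst (Supp _) (sym eq) Supp-0
  ... | inj₂ (d' , eq' , eq) = subst (Supp _) (sym eq) (Supp-map (λ { (bounded u b) → bounded u (ℕP.≤-trans b d'≤d) }) (h-Bounded 0 p d' p<n))
    where
    d'≤d : d' ≤ d
    d'≤d = ℕP.+-cancelˡ-≤ (suc p) d' d (ℕP.≤-trans (ℕP.≤-reflexive eq') le)

  -- Induction over the variables, expanding along the row of the newest selected one. Its last
  -- entry leads with the power x_o^(d + 1) and multiplies the determinant of the earlier rows, in
  -- which x_o does not occur. The equation between `o`, `falses B` and the number of rows is
  -- preserved whether or not a variable is selected.
  det-Lead : ∀ {l} o (B : Vec Bool l) rs m → o + l ≡ n → suc (o + falses B) ≡ k + length rs →
    UsesBelow o m → (∀ {j} (C : Vec Bool j) → Supp (UsesBelow o) (wedges rs C)) → Lead (det rs) m →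
    Lead (det (rows o B rs)) (leadOf o B m)
  det-Lead o [] rs m _ _ _ _ lead = lead
  det-Lead {suc l} o (false ∷ B) rs m eq eq' u su lead = det-Lead (suc o) B rs m (trans (sym (ℕP.+-suc o l)) eq)
    (trans (cong suc (sym (ℕP.+-suc o (falses B)))) eq') (UsesBelow-mono (ℕP.n≤1+n o) u) (λ C → Supp-map (UsesBelow-mono (ℕP.n≤1+n o)) (su C)) lead
  det-Lead {suc l} o (true ∷ B) rs m eq eq' u su lead = det-Lead (suc o) B (row o ∷ rs) m' (trans (sym (ℕP.+-suc o l)) eq)
    (trans (cong suc eq') (sym (ℕP.+-suc k (length rs)))) u' su' lead'
    where
    d = falses B
    m' = m ⊕ power n o (suc d)
    o<n : o < n
    o<n = ℕP.≤-trans (ℕP.m<m+n o (s≤s z≤n)) (ℕP.≤-reflexive eq)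
    u' : UsesBelow (suc o) m'
    u' = UsesBelow-⊕ (UsesBelow-mono (ℕP.n≤1+n o) u) (UsesBelow-power o (suc d))
    su' : ∀ {j} (C : Vec Bool j) → Supp (UsesBelow (suc o)) (wedges (row o ∷ rs) C)
    su' C = Supp-wedge UsesBelow-⊕ (row o) (wedges rs) (λ l _ → row-UsesBelow o l) (λ C → Supp-map (UsesBelow-mono (ℕP.n≤1+n o)) (su C)) C
    -- This places the entry of degree `suc d` of the new row in the last column.
    index : suc k + length rs ≡ suc o + suc d
    index = trans (cong suc (sym eq')) (cong suc (sym (ℕP.+-suc o d)))
    top : Lead (row o (length rs)) (power n o (suc d))
    top = subst (λ p → Lead p (power n o (suc d))) (sym (trans (cong (pad (suc o) (h (seg 0 (suc o)))) index) (pad-+ (suc o) _ (suc d)))) (h-Lead 0 o (suc d) o<n)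
    exponent : expAt m' o ≡ suc d
    exponent = trans (expAt-⊕ m (power n o (suc d)) o) (cong₂ _+_ (UsesBelow.zeroAbove u o ℕP.≤-refl) (expAt-power (suc d) o<n))
    -- The other terms of the expansion take an earlier column, where the new row has degree at most
    -- `d`; this bounds the exponent of x_o.
    lower : Supp (_<nl m') (⊟ wedge (row o) (wedges rs ∘ (true ∷_)) (allTrue (length rs)))
    lower = Supp-neg (Supp-map (λ b → Bounded⇒<nl b u' (subst (d <_) (sym exponent) ℕP.≤-refl))
      (Supp-wedge {S = Bounded o d} (λ {a} {c} p q → subst (λ e → Bounded o e (a ⊕ c)) (ℕP.+-identityʳ d) (Bounded-⊕ p q)) (row o) (wedges rs ∘ (true ∷_))
        (λ j j<i → row-Bounded o j d o<n (ℕP.≤-pred (ℕP.≤-trans (s≤s (ℕP.+-monoʳ-≤ (suc k) ℕP.≤-refl)) (ℕP.≤-trans (ℕP.+-monoʳ-< (suc k) j<i) (ℕP.≤-reflexive (trans index (cong suc (ℕP.+-suc o d))))))))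
        (λ C → Supp-map UsesBelow⇒Bounded (su (true ∷ C))) (allTrue (length rs))))
    lead' : Lead (det (row o ∷ rs)) m'
    lead' = Lead-+ (subst (Lead _) (⊕-comm (power n o (suc d)) m)
      (Lead-* top (Lead-≋ (≋-sym (wedges-false rs (allTrue (length rs)))) lead))) lower

  expAt-leadOf-< : ∀ {l} o (B : Vec Bool l) m q → q < o → expAt (leadOf o B m) q ≡ expAt m q
  expAt-leadOf-< o [] m q lt = refl
  expAt-leadOf-< o (false ∷ B) m q lt = expAt-leadOf-< (suc o) B m q (ℕP.m≤n⇒m≤1+n lt)
  expAt-leadOf-< o (true ∷ B) m q lt = trans (expAt-leadOf-< (suc o) B _ q (ℕP.m≤n⇒m≤1+n lt))
    (trans (expAt-⊕ m (power n o _) q) (trans (cong (expAt m q +_) (expAt-power-≢ n _ (ℕP.<⇒≢ lt))) (ℕP.+-identityʳ _)))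

  expAt-leadOf : ∀ {l} o (B : Vec Bool l) m q → o + l ≡ n → UsesBelow o m → expAt (leadOf o B m) (o + q) ≡ expAt (expo B) q
  expAt-leadOf o [] m q eq u = UsesBelow.zeroAbove u (o + q) (ℕP.m≤m+n o q)
  expAt-leadOf o (false ∷ B) m zero eq u rewrite ℕP.+-identityʳ o = trans (expAt-leadOf-< (suc o) B m o ℕP.≤-refl) (UsesBelow.zeroAbove u o ℕP.≤-refl)
  expAt-leadOf {suc l} o (false ∷ B) m (suc q) eq u rewrite ℕP.+-suc o q = expAt-leadOf (suc o) B m q (trans (sym (ℕP.+-suc o l)) eq) (UsesBelow-mono (ℕP.n≤1+n o) u)
  expAt-leadOf {suc l} o (true ∷ B) m zero eq u rewrite ℕP.+-identityʳ o = trans (expAt-leadOf-< (suc o) B _ o ℕP.≤-refl)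
    (trans (expAt-⊕ m (power n o _) o) (cong₂ _+_ (UsesBelow.zeroAbove u o ℕP.≤-refl) (expAt-power _ (ℕP.≤-trans (ℕP.m<m+n o (s≤s z≤n)) (ℕP.≤-reflexive eq)))))
  expAt-leadOf {suc l} o (true ∷ B) m (suc q) eq u rewrite ℕP.+-suc o q = expAt-leadOf (suc o) B _ q (trans (sym (ℕP.+-suc o l)) eq)
    (UsesBelow-⊕ (UsesBelow-mono (ℕP.n≤1+n o) u) (UsesBelow-power o _))

  rows-length : ∀ {l} o (B : Vec Bool l) rs → length (rows o B rs) ≡ ∣ B ∣ + length rs
  rows-length o [] rs = refl
  rows-length o (true ∷ B) rs = trans (rows-length (suc o) B _) (ℕP.+-suc ∣ B ∣ _)
  rows-length o (false ∷ B) rs = rows-length (suc o) B rs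

  rows-orthogonal : ∀ {l} o (B : Vec Bool l) rs → o + l ≡ n → All (λ r → I (sumN (suc i) (λ j → r j ⊠ column j))) rs →
    All (λ r → I (sumN (suc i) (λ j → r j ⊠ column j))) (rows o B rs)
  rows-orthogonal o [] rs eq a = a
  rows-orthogonal {suc l} o (false ∷ B) rs eq a = rows-orthogonal (suc o) B rs (trans (sym (ℕP.+-suc o l)) eq) a
  rows-orthogonal {suc l} o (true ∷ B) rs eq a = rows-orthogonal (suc o) B _ (trans (sym (ℕP.+-suc o l)) eq)
    (row-orthogonal o (ℕP.≤-trans (ℕP.m<m+n o (s≤s z≤n)) (ℕP.≤-reflexive eq)) ∷ a)

  unit-UsesBelow : ∀ {j} (C : Vec Bool j) → Supp (UsesBelow 0) (unit C)
  unit-UsesBelow [] = Supp-mono UsesBelow-one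
  unit-UsesBelow (false ∷ C) = unit-UsesBelow C
  unit-UsesBelow (true ∷ C) = Supp-0

  -- With k - 1 positions left out, n - k + 1 = i + 1 rows are selected, so their product has top
  -- degree. The last entry of `column` is ε in degree 0, that is 1, as `cramer` requires.
  lead-expo : (B : Vec Bool n) → suc (falses B) ≡ k → ∃ λ p → I p × Lead p (expo B)
  lead-expo B eq = det (rows 0 B []) ,
    subst (λ l → I (wedges (rows 0 B []) (allTrue l))) (sym size) (cramer column (rows 0 B []) i
      (≈-trans (≈-reflexive (cong (ε (vars (allFin n))) (ℕP.n∸n≡0 i))) (ε-zero (vars (allFin n)))) (rows-orthogonal 0 B [] refl [])) ,
    subst (Lead (det (rows 0 B []))) (expAt-ext _ _ λ q → expAt-leadOf 0 B one q refl UsesBelow-one)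
      (det-Lead 0 B [] one refl (trans eq (sym (ℕP.+-identityʳ k))) UsesBelow-one unit-UsesBelow (Lead-mono one))
    where
    size : length (rows 0 B []) ≡ suc i
    size = trans (rows-length 0 B []) (trans (ℕP.+-identityʳ ∣ B ∣)
      (ℕP.+-cancelʳ-≡ (falses B) ∣ B ∣ (suc i) (trans (∣∣+falses B) (trans (sym k+i≡n)
        (trans (cong (_+ i) (sym eq)) (cong suc (ℕP.+-comm (falses B) i)))))))

-- Skip monomials

-- For i = s_j the number i - j counts the non-elements of S before i; `z` carries this count.
gammaFrom : ∀ {n} → ℕ → Subset n → Vec ℕ n
gammaFrom z [] = []
gammaFrom z (true ∷ S) = suc z ∷ gammaFrom z S
gammaFrom z (false ∷ S) = 0 ∷ gammaFrom (suc z) S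

≤ᵇ-suc : ∀ a b → (suc a ℕ.≤ᵇ suc b) ≡ (a ℕ.≤ᵇ b)
≤ᵇ-suc zero b = refl
≤ᵇ-suc (suc a) b = refl

sum-zero : ∀ {A : Set} (xs : List A) → ListAction.sum (map (λ _ → 0) xs) ≡ 0
sum-zero [] = refl
sum-zero (x ∷ xs) = sum-zero xs

countUpTo-zero : ∀ {n} s (S : Subset n) → countUpTo (s ∷ S) Fin.zero ≡ (if s then 1 else 0)
countUpTo-zero {n} s S = trans (cong (λ xs → (if s then 1 else 0) + ListAction.sum xs)
  (trans (ListP.map-tabulate {n = n} Fin.suc _) (sym (ListP.map-tabulate {n = n} id (λ _ → 0)))))
  (trans (cong ((if s then 1 else 0) +_) (sum-zero (allFin n))) (ℕP.+-identityʳ _))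

countUpTo-suc : ∀ {n} s (S : Subset n) q → countUpTo (s ∷ S) (Fin.suc q) ≡ (if s then 1 else 0) + countUpTo S q
countUpTo-suc {n} s S q = cong (λ xs → (if s then 1 else 0) + ListAction.sum xs)
  (trans (ListP.map-tabulate {n = n} Fin.suc _) (trans (ListP.tabulate-cong λ q' → cong (λ b → if b ∧ lookup S q' then 1 else 0) (≤ᵇ-suc (toℕ q') (toℕ q)))
    (sym (ListP.map-tabulate {n = n} id _))))

gamma-from : ∀ {n} z (S : Subset n) →
  tabulate (λ q → if lookup S q then (z + suc (toℕ q) ∸ countUpTo S q) + 1 else 0) ≡ gammaFrom z S
gamma-from z [] = refl
gamma-from z (true ∷ S) = cong₂ _∷_
  (trans (cong (λ c → (z + 1 ∸ c) + 1) (countUpTo-zero true S)) (trans (cong (_+ 1) (ℕP.m+n∸n≡m z 1)) (ℕP.+-comm z 1)))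
  (trans (VecP.tabulate-cong λ q → cong (λ c → if lookup S q then c + 1 else 0)
      (trans (cong (z + suc (suc (toℕ q)) ∸_) (countUpTo-suc true S q)) (cong (_∸ suc (countUpTo S q)) (ℕP.+-suc z (suc (toℕ q))))))
    (gamma-from z S))
gamma-from z (false ∷ S) = cong (0 ∷_)
  (trans (VecP.tabulate-cong λ q → cong (λ c → if lookup S q then c + 1 else 0)
      (trans (cong (z + suc (suc (toℕ q)) ∸_) (countUpTo-suc false S q)) (cong (_∸ countUpTo S q) (ℕP.+-suc z (suc (toℕ q))))))
    (gamma-from (suc z) S))

gammaFrom-∷ʳ : ∀ {n} z (S : Subset n) s → gammaFrom z (S Vec.∷ʳ s) ≡ gammaFrom z S Vec.∷ʳ (if s then suc (z + falses S) else 0)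
gammaFrom-∷ʳ z [] true = cong (λ c → suc c ∷ []) (sym (ℕP.+-identityʳ z))
gammaFrom-∷ʳ z [] false = refl
gammaFrom-∷ʳ z (true ∷ S) s = cong (suc z ∷_) (gammaFrom-∷ʳ z S s)
gammaFrom-∷ʳ z (false ∷ S) s = cong (0 ∷_) (trans (gammaFrom-∷ʳ (suc z) S s)
  (cong (λ c → gammaFrom (suc z) S Vec.∷ʳ (if s then suc c else 0)) (sym (ℕP.+-suc z (falses S)))))

falses-∷ʳ : ∀ {n} (S : Subset n) s → falses (S Vec.∷ʳ s) ≡ falses (s ∷ S)
falses-∷ʳ [] s = refl
falses-∷ʳ (true ∷ S) true = falses-∷ʳ S true
falses-∷ʳ (true ∷ S) false = falses-∷ʳ S false
falses-∷ʳ (false ∷ S) true = cong suc (falses-∷ʳ S true)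
falses-∷ʳ (false ∷ S) false = cong suc (falses-∷ʳ S false)

falses-∷ : ∀ {n} s {S S' : Subset n} → falses S ≡ falses S' → falses (s ∷ S) ≡ falses (s ∷ S')
falses-∷ true eq = eq
falses-∷ false eq = cong suc eq

falses-reverse : ∀ {n} (S : Subset n) → falses (Vec.reverse S) ≡ falses S
falses-reverse [] = refl
falses-reverse (s ∷ S) = trans (cong falses (VecP.reverse-∷ s S)) (trans (falses-∷ʳ (Vec.reverse S) s) (falses-∷ s (falses-reverse S)))

reverse-∷ʳ : ∀ {A : Set} {n} (xs : Vec A n) x → Vec.reverse (xs Vec.∷ʳ x) ≡ x ∷ Vec.reverse xs
reverse-∷ʳ xs x = VecP.reverse-reverse (trans (VecP.reverse-∷ x (Vec.reverse xs)) (cong (Vec._∷ʳ x) (VecP.reverse-involutive xs)))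

-- Reversal turns the non-elements before a position into those after it, which `expo` counts. This
-- form suits the determinants, which are built by reading the variables in increasing order.
xStar-reverse : ∀ {n} (B : Subset n) → xStar (Vec.reverse B) ≡ expo B
xStar-reverse B = trans (cong Vec.reverse (gamma-from 0 (Vec.reverse B))) (go B)
  where
  cons : ∀ {n} b (B : Subset n) → (if b then suc (falses (Vec.reverse B)) else 0) ∷ expo B ≡ expo (b ∷ B)
  cons true B = cong (λ c → suc c ∷ expo B) (falses-reverse B)
  cons false B = refl
  go : ∀ {n} (B : Subset n) → Vec.reverse (gammaFrom 0 (Vec.reverse B)) ≡ expo B
  go [] = refl
  go (b ∷ B) = trans (cong (Vec.reverse ∘ gammaFrom 0) (VecP.reverse-∷ b B))
    (trans (cong Vec.reverse (gammaFrom-∷ʳ 0 (Vec.reverse B) b))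
    (trans (reverse-∷ʳ (gammaFrom 0 (Vec.reverse B)) _)
    (trans (cong ((if b then suc (falses (Vec.reverse B)) else 0) ∷_) (go B)) (cons b B))))

-- The number of blocks left empty when the letters are placed starting with `s` empty blocks: an
-- exponent below the current number of empty blocks fills one of them.
final : ∀ {l} → ℕ → Vec ℕ l → ℕ
final s [] = s
final s (e ∷ m) with e ℕ.<? s
... | yes _ = final (ℕ.pred s) m
... | no _  = final s m

final-0 : ∀ {l} (m : Vec ℕ l) → final 0 m ≡ 0
final-0 [] = refl
final-0 (e ∷ m) = final-0 m

expo-allFalse : ∀ l (m : Vec ℕ l) → expo (replicate l false) ∣ₘ m
expo-allFalse (suc l) (e ∷ m) Fin.zero = z≤n
expo-allFalse (suc l) (e ∷ m) (Fin.suc i) = expo-allFalse l m i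

falses-allFalse : ∀ l → falses (replicate l false) ≡ l
falses-allFalse zero = refl
falses-allFalse (suc l) = cong suc (falses-allFalse l)

-- Mark a letter `false` if it fills an empty block. Otherwise its exponent is at least the number
-- `suc s` of empty blocks, and `true` is affordable: with `s` entries `false` still to come, `expo`
-- has exactly the value `suc s` there.
final-or-skip : ∀ {l} s (m : Vec ℕ l) → s ≤ l → (final (suc s) m ≡ 0) ⊎ (∃ λ B → (falses B ≡ s) × (expo B ∣ₘ m))
final-or-skip zero [] z≤n = inj₂ ([] , refl , λ ())
final-or-skip {suc l} s (e ∷ m) s≤ with e ℕ.<? suc s
final-or-skip {suc l} zero (e ∷ m) s≤ | yes _ = inj₁ (final-0 m)
final-or-skip {suc l} (suc s) (e ∷ m) (s≤s s≤) | yes _ with final-or-skip s m s≤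
... | inj₁ f = inj₁ f
... | inj₂ (B , eq , d) = inj₂ (false ∷ B , cong suc eq , λ { Fin.zero → z≤n ; (Fin.suc i) → d i })
final-or-skip {suc l} s (e ∷ m) s≤ | no e≮ with s ℕ.≤? l
-- All remaining letters have to be `false` to reach the count `s`, and then no condition on their
-- exponents is left.
... | no s≰ = inj₂ (replicate (suc l) false , trans (falses-allFalse (suc l)) (ℕP.≤-antisym (ℕP.≰⇒> s≰) s≤) , expo-allFalse (suc l) (e ∷ m))
... | yes s≤l with final-or-skip s m s≤l
...   | inj₁ f = inj₁ f
...   | inj₂ (B , eq , d) = inj₂ (true ∷ B , eq , λ { Fin.zero → subst (λ c → suc c ≤ e) (sym eq) (ℕP.≮⇒≥ e≮) ; (Fin.suc i) → d i })

expAt-lookup : ∀ {n} (m : Vec ℕ n) i → expAt m (toℕ i) ≡ lookup m i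
expAt-lookup (e ∷ m) Fin.zero = refl
expAt-lookup (e ∷ m) (Fin.suc i) = expAt-lookup m i

power-∣ₘ : ∀ {n} (m : Monomial n) p d → d ≤ expAt m p → power n p d ∣ₘ m
power-∣ₘ {n} m p d le i = subst (_≤ lookup m i) (expAt-lookup (power n p d) i) (bound (toℕ i ℕ.≟ p))
  where
  bound : Dec (toℕ i ≡ p) → expAt (power n p d) (toℕ i) ≤ lookup m i
  bound (yes refl) = subst (_≤ lookup m i) (sym (expAt-power d (FinP.toℕ<n i))) (subst (d ≤_) (expAt-lookup m i) le)
  bound (no ne) = subst (_≤ lookup m i) (sym (expAt-power-≢ n d ne)) z≤n

∣ₘ-quotient : ∀ {n} (a m : Monomial n) → a ∣ₘ m → ∃ λ q → q ⊕ a ≡ m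
∣ₘ-quotient [] [] d = [] , refl
∣ₘ-quotient (x ∷ a) (y ∷ m) d with ∣ₘ-quotient a m (d ∘ Fin.suc)
... | q , refl = (y ∸ x) ∷ q , cong (_∷ (q ⊕ a)) (ℕP.m∸n+n≡m (d Fin.zero))

-- Batches of variables

positions : ∀ {r} (α : Vec ℕ r) → Vec ℕ (Vec.sum α)
positions [] = []
positions (a ∷ α) = tabulate {n = a} toℕ Vec.++ positions α

expAt-++ˡ : ∀ {a b} (xs : Vec ℕ a) (ys : Vec ℕ b) q → q < a → expAt (xs Vec.++ ys) q ≡ expAt xs q
expAt-++ˡ (x ∷ xs) ys zero lt = refl
expAt-++ˡ (x ∷ xs) ys (suc q) (s≤s lt) = expAt-++ˡ xs ys q lt

expAt-++ʳ : ∀ {a b} (xs : Vec ℕ a) (ys : Vec ℕ b) q → expAt (xs Vec.++ ys) (a + q) ≡ expAt ys q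
expAt-++ʳ [] ys q = refl
expAt-++ʳ (x ∷ xs) ys q = expAt-++ʳ xs ys q

positions-offset : ∀ {r} (α : Vec ℕ r) i j → j < lookup α i → expAt (positions α) (offset α i + j) ≡ j
positions-offset (a ∷ α) Fin.zero j lt = trans (expAt-++ˡ (tabulate {n = a} toℕ) (positions α) j lt)
  (trans (cong (expAt (tabulate {n = a} toℕ)) (sym (FinP.toℕ-fromℕ< lt))) (trans (expAt-lookup (tabulate {n = a} toℕ) (fromℕ< lt))
    (trans (VecP.lookup∘tabulate toℕ (fromℕ< lt)) (FinP.toℕ-fromℕ< lt))))
positions-offset (a ∷ α) (Fin.suc i) j lt = trans (cong (expAt (positions (a ∷ α))) (ℕP.+-assoc a (offset α i) j))
  (trans (expAt-++ʳ (tabulate {n = a} toℕ) (positions α) _) (positions-offset α i j lt))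

locate : ∀ {r} (α : Vec ℕ r) q → q < Vec.sum α → ∃ λ i → ∃ λ j → j < lookup α i × q ≡ offset α i + j
locate (a ∷ α) q lt with q ℕ.<? a
... | yes q<a = Fin.zero , q , q<a , refl
... | no q≮a with locate α (q ∸ a) (ℕP.+-cancelˡ-< a _ _ (subst (_< a + Vec.sum α) (sym (ℕP.m+[n∸m]≡n (ℕP.≮⇒≥ q≮a))) lt))
...   | i , j , j< , eq = Fin.suc i , j , j< , trans (sym (ℕP.m+[n∸m]≡n (ℕP.≮⇒≥ q≮a))) (trans (cong (a +_) eq) (sym (ℕP.+-assoc a _ j)))

offset-sum : ∀ {r} (α : Vec ℕ r) i → offset α i + lookup α i ≤ Vec.sum α
offset-sum (a ∷ α) Fin.zero = ℕP.m≤m+n a (Vec.sum α)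
offset-sum (a ∷ α) (Fin.suc i) = subst (_≤ a + Vec.sum α) (sym (ℕP.+-assoc a (offset α i) (lookup α i))) (ℕP.+-monoʳ-≤ a (offset-sum α i))

∈-filterᵇ⁺ : ∀ {A : Set} (f : A → Bool) {x xs} → x ∈ xs → f x ≡ true → x ∈ filterᵇ f xs
∈-filterᵇ⁺ f {x} {y ∷ xs} (here refl) fx rewrite fx = here refl
∈-filterᵇ⁺ f {x} {y ∷ xs} (there x∈) fx with f y
... | true = there (∈-filterᵇ⁺ f x∈ fx)
... | false = ∈-filterᵇ⁺ f x∈ fx

∈-filterᵇ⁻ : ∀ {A : Set} (f : A → Bool) {x} xs → x ∈ filterᵇ f xs → x ∈ xs × f x ≡ true
∈-filterᵇ⁻ f (y ∷ xs) x∈ with f y in eq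
∈-filterᵇ⁻ f (y ∷ xs) (here refl) | true = here refl , eq
∈-filterᵇ⁻ f (y ∷ xs) (there x∈) | true = let x∈' , fx = ∈-filterᵇ⁻ f xs x∈ in there x∈' , fx
... | false = let x∈' , fx = ∈-filterᵇ⁻ f xs x∈ in there x∈' , fx

filterᵇ-unique : ∀ {A : Set} (f : A → Bool) {xs} → Unique xs → Unique (filterᵇ f xs)
filterᵇ-unique f {[]} u = AllPairs.[]
filterᵇ-unique f {x ∷ xs} (x∉ AllPairs.∷ u) with f x
... | true = All.tabulate (λ y∈ → All.lookup x∉ (proj₁ (∈-filterᵇ⁻ f xs y∈))) AllPairs.∷ filterᵇ-unique f u
... | false = filterᵇ-unique f u

∈-batchVars⁺ : ∀ {r n} (α : Vec ℕ r) i {p : Fin n} → InBatch α p i → p ∈ batchVars n α i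
∈-batchVars⁺ α i {p} (le , lt) = ∈-filterᵇ⁺ _ (MemP.∈-allFin p)
  (Equivalence.to T-≡ (Equivalence.from T-∧ (ℕP.≤⇒≤ᵇ le , ℕP.<⇒<ᵇ lt)))

∈-batchVars⁻ : ∀ {r n} (α : Vec ℕ r) i {p : Fin n} → p ∈ batchVars n α i → InBatch α p i
∈-batchVars⁻ {n = n} α i {p} p∈ with Equivalence.to T-∧ (Equivalence.from T-≡ (proj₂ (∈-filterᵇ⁻ _ (allFin n) p∈)))
... | le , lt = ℕP.≤ᵇ⇒≤ _ _ le , ℕP.<ᵇ⇒< _ _ lt

batchVars-unique : ∀ {r} n (α : Vec ℕ r) i → Unique (batchVars n α i)
batchVars-unique n α i = filterᵇ-unique _ (UniqueP.allFin⁺ n)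

batchVars-↭ : ∀ {r} (α : Vec ℕ r) i → map toℕ (batchVars (Vec.sum α) α i) ↭ segment (offset α i) (lookup α i)
batchVars-↭ α i = unique-↭ (UniqueP.map⁺ FinP.toℕ-injective (batchVars-unique _ α i)) (segment-unique (offset α i) (lookup α i)) to from
  where
  to : ∀ {q} → q ∈ map toℕ (batchVars (Vec.sum α) α i) → q ∈ segment (offset α i) (lookup α i)
  to q∈ with MemP.∈-map⁻ toℕ q∈
  ... | p , p∈ , refl = let le , lt = ∈-batchVars⁻ α i p∈ in ∈-segment⁺ le lt
  from : ∀ {q} → q ∈ segment (offset α i) (lookup α i) → q ∈ map toℕ (batchVars (Vec.sum α) α i)
  from {q} q∈ with ∈-segment⁻ (lookup α i) q∈
  ... | le , lt = subst (_∈ map toℕ (batchVars (Vec.sum α) α i)) (FinP.toℕ-fromℕ< q<n)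
      (MemP.∈-map⁺ toℕ (∈-batchVars⁺ α i (subst (offset α i ≤_) (sym (FinP.toℕ-fromℕ< q<n)) le , subst (_< offset α i + lookup α i) (sym (FinP.toℕ-fromℕ< q<n)) lt)))
    where
    q<n : q < Vec.sum α
    q<n = ℕP.<-≤-trans lt (offset-sum α i)

esym-e : ∀ {n} (is : List (Fin n)) d → esym is d ≡ PolySym.e (vars is) d
esym-e [] zero = refl
esym-e [] (suc d) = refl
esym-e (i ∷ is) zero = refl
esym-e (i ∷ is) (suc d) = cong₂ (λ a b → a +ₚ (var i *ₚ b)) (esym-e is (suc d)) (esym-e is d)

hsym-h : ∀ {n} (is : List (Fin n)) d → hsym is d ≡ PolySym.h (vars is) d
hsym-h [] zero = refl
hsym-h [] (suc d) = refl
hsym-h (i ∷ is) zero = refl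
hsym-h (i ∷ is) (suc d) = cong₂ (λ a b → a +ₚ (var i *ₚ b)) (hsym-h is (suc d)) (hsym-h (i ∷ is) d)

module Leading {r} (k : ℕ) (α : Vec ℕ r) (0<k : 0 < k) (k≤n : k ≤ Vec.sum α)
  (α-bounds : ∀ i → (1 ≤ lookup α i) × (lookup α i ≤ k)) where

  n : ℕ
  n = Vec.sum α

  J : List (Poly n)
  J = Jgens n k α

  open Ideal J public

  InJ : Poly n → Set
  InJ = Member J

  ε∈J : ∀ d → n ∸ k < d → InJ (PolySym.ε (vars (allFin n)) d)
  ε∈J d lt = go (d ℕ.≤? n)
    where
    go : Dec (d ≤ n) → InJ (PolySym.ε (vars (allFin n)) d)
    go (no d≰n) = ideal-≈ (≋-sym (PolySym.ε-vanish (vars (allFin n)) d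
        (subst (_< d) (sym (trans (ListP.length-map var (allFin n)) (ListP.length-tabulate id))) (ℕP.≰⇒> d≰n)))) ideal-0
    go (yes d≤n) = ideal-≈ (≋-sym (PolySym.ε-sgn (vars (allFin n)) d)) (ideal-* (PolySym.sgn d)
        (subst InJ (trans (cong (esym (allFin n)) (ℕP.m∸[m∸n]≡n d≤n)) (esym-e (allFin n) d))
          (ideal-gen (MemP.∈-++⁺ˡ (MemP.∈-map⁺ (λ t → esym (allFin n) (n ∸ t)) (MemP.∈-upTo⁺ (n∸d<k d≤n)))))))
      where
      n∸d<k : d ≤ n → n ∸ d < k
      n∸d<k d≤n = subst (n ∸ d <_) (ℕP.m∸[m∸n]≡n k≤n) (ℕP.∸-monoʳ-< lt d≤n)

  h-batch∈J : ∀ i d → d ≤ k → k < d + lookup α i → InJ (PolySym.h (seg (offset α i) (lookup α i)) d)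
  h-batch∈J i d d≤k lt = ideal-≈ (PolySym.h-↭ (subst (_↭ seg (offset α i) (lookup α i)) (sym (vars-x (batchVars n α i)))
      (PermP.map⁺ x[_] (batchVars-↭ α i))) d)
    (subst InJ (trans (cong (hsym (batchVars n α i)) (ℕP.m∸[m∸n]≡n d≤k)) (hsym-h (batchVars n α i) d))
      (ideal-gen (MemP.∈-++⁺ʳ (eGens n k) (MemP.∈-concatMap⁺ _ (Any.map (λ { refl → MemP.∈-map⁺ _ (MemP.∈-upTo⁺ k∸d<) }) (MemP.∈-allFin i))))))
    where
    k∸d< : k ∸ d < lookup α i
    k∸d< = ℕP.+-cancelˡ-< d _ _ (subst (_< d + lookup α i) (sym (ℕP.m+[n∸m]≡n d≤k)) lt)

  -- With one more variable x, h_d of the prefix is h_d of the longer prefix minus x times its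
  -- h_{d-1}. Both keep the bound `k < d + j`, so the claim descends from the whole batch; `c`
  -- counts the missing variables.
  h-prefix∈J : ∀ i c j d → j + c ≡ lookup α i → d ≤ k → k < d + j → InJ (PolySym.h (seg (offset α i) j) d)
  h-prefix∈J i zero j d eq d≤k lt = subst (λ j → InJ (PolySym.h (seg (offset α i) j) d)) (sym j≡)
    (h-batch∈J i d d≤k (subst (λ j → k < d + j) j≡ lt))
    where
    j≡ : j ≡ lookup α i
    j≡ = trans (sym (ℕP.+-identityʳ j)) eq
  h-prefix∈J i (suc c) j zero eq d≤k lt =
    ⊥-elim (ℕP.<⇒≱ lt (ℕP.≤-trans (ℕP.m+n≤o⇒m≤o j (ℕP.≤-reflexive eq)) (proj₂ (α-bounds i))))
  h-prefix∈J i (suc c) j (suc d) eq d≤k lt = ideal-cancel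
    (ideal-≈ (add-comm (PolySym.h (seg (offset α i) j) (suc d)) (x[ offset α i + j ] *ₚ PolySym.h (seg (offset α i) (suc j)) d))
      (h-prefix∈J i c (suc j) (suc d) (trans (sym (ℕP.+-suc j c)) eq) d≤k (ℕP.<-≤-trans lt (ℕP.+-monoʳ-≤ (suc d) (ℕP.n≤1+n j)))))
    (ideal-* x[ offset α i + j ] (h-prefix∈J i c (suc j) d (trans (sym (ℕP.+-suc j c)) eq) (ℕP.<⇒≤ d≤k) (subst (k <_) (sym (ℕP.+-suc d j)) lt)))

  lead-power : ∀ i j → j < lookup α i → ∃ λ p → InJ p × Lead p (power n (offset α i + j) (k ∸ j))
  lead-power i j lt = PolySym.h (seg (offset α i) (suc j)) (k ∸ j) ,
    h-prefix∈J i (lookup α i ∸ suc j) (suc j) (k ∸ j) (ℕP.m+[n∸m]≡n lt) (ℕP.m∸n≤m k j)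
      (ℕP.≤-reflexive (sym (trans (ℕP.+-suc (k ∸ j) j) (cong suc (ℕP.m∸n+n≡m (ℕP.≤-trans (ℕP.<⇒≤ lt) (proj₂ (α-bounds i)))))))) ,
    h-Lead (offset α i) j (k ∸ j) (ℕP.<-≤-trans (ℕP.+-monoʳ-< (offset α i) lt) (offset-sum α i))

  open Determinant InJ (Member-isIdeal J) k (n ∸ k) (ℕP.m+[n∸m]≡n k≤n) ε∈J public using (lead-expo)

  -- The decidable form of the nonskip condition, as the placement of letters uses it: every
  -- exponent selects an available block, and no block stays empty.
  record Accepted (m : Monomial n) : Set where
    constructor accepted
    field
      small : ∀ p → lookup m p < k ∸ lookup (positions α) p
      exhausts : final k m ≡ 0
  open Accepted public

  data Skip (m : Monomial n) : Set where
    bigPower : ∀ i j → j < lookup α i → k ∸ j ≤ expAt m (offset α i + j) → Skip m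
    skips : ∀ B → suc (falses B) ≡ k → expo B ∣ₘ m → Skip m

  classify : ∀ m → Accepted m ⊎ Skip m
  classify m with FinP.any? (λ p → k ∸ lookup (positions α) p ℕ.≤? lookup m p)
  ... | yes (p , le) = inj₂ (big (locate α (toℕ p) (FinP.toℕ<n p)))
    where
    big : (∃ λ i → ∃ λ j → j < lookup α i × toℕ p ≡ offset α i + j) → Skip m
    big (i , j , lt , eq) = bigPower i j lt (subst (λ e → k ∸ e ≤ expAt m (offset α i + j))
      (trans (sym (expAt-lookup (positions α) p)) (trans (cong (expAt (positions α)) eq) (positions-offset α i j lt)))
      (subst (k ∸ lookup (positions α) p ≤_) (trans (sym (expAt-lookup m p)) (cong (expAt m) eq)) le))
  ... | no none with final-or-skip (ℕ.pred k) m (ℕP.≤-trans (ℕP.pred[n]≤n) k≤n)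
  ...   | inj₁ f = inj₁ (accepted (λ p → ℕP.≰⇒> λ le → none (p , le)) (trans (cong (λ s → final s m) (sym k≡)) f))
    where
    k≡ : suc (ℕ.pred k) ≡ k
    k≡ = ℕP.suc-pred k {{ℕ.>-nonZero 0<k}}
  ...   | inj₂ (B , eq , d) = inj₂ (skips B (trans (cong suc eq) (ℕP.suc-pred k {{ℕ.>-nonZero 0<k}})) d)

  Skip-lead : ∀ {m} → Skip m → ∃ λ p → ∃ λ a → InJ p × Lead p a × (a ∣ₘ m)
  Skip-lead {m} (bigPower i j lt le) = let p , p∈ , l = lead-power i j lt in p , _ , p∈ , l , power-∣ₘ m _ _ le
  Skip-lead (skips B eq d) = let p , p∈ , l = lead-expo B eq in p , _ , p∈ , l , d

  Nonskip⇒Accepted : ∀ {m} → Nonskip k α m → Accepted m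
  Nonskip⇒Accepted {m} (noStar , noPower) with classify m
  ... | inj₁ acc = acc
  ... | inj₂ (bigPower i j lt le) = ⊥-elim (noPower i (suc j) (s≤s z≤n) lt
      (subst₂' (trans (sym (ℕP.m∸n+n≡m 1≤)) (cong (_+ 1) (trans (ℕP.∸-+-assoc k j 1) (cong (k ∸_) (ℕP.+-comm j 1)))))
        (cong (expAt m) (sym (cong (_∸ 1) (ℕP.+-suc (offset α i) j)))) le))
    where
    1≤ : 1 ≤ k ∸ j
    1≤ = ℕP.m<n⇒0<n∸m (ℕP.<-≤-trans lt (proj₂ (α-bounds i)))
    subst₂' : ∀ {a b c d} → a ≡ b → c ≡ d → a ≤ c → b ≤ d
    subst₂' refl refl le = le
  ... | inj₂ (skips B eq d) = ⊥-elim (noStar (Vec.reverse B) size (subst (_∣ₘ m) (sym (xStar-reverse B)) d))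
    where
    size : ∣ Vec.reverse B ∣ ≡ (n ∸ k) + 1
    size = ℕP.+-cancelʳ-≡ (falses (Vec.reverse B)) _ _ (trans (∣∣+falses (Vec.reverse B))
      (sym (trans (ℕP.+-assoc (n ∸ k) 1 _) (trans (cong (λ f → n ∸ k + suc f) (falses-reverse B)) (trans (cong (n ∸ k +_) eq) (ℕP.m∸n+n≡m k≤n))))))

  Standard⇒Nonskip : ∀ {m} → Standard J m → Nonskip k α m
  Standard⇒Nonskip {m} std = noStar , noPower
    where
    noStar : ∀ S → ∣ S ∣ ≡ (n ∸ k) + 1 → ¬ (xStar S ∣ₘ m)
    noStar S size d = let p , p∈ , l = lead-expo (Vec.reverse S) fs in
      std (p , _ , inIdeal p∈ , Lead⇒LeadMon l , subst (_∣ₘ m) (trans (cong xStar (sym (VecP.reverse-involutive S))) (xStar-reverse (Vec.reverse S))) d)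
      where
      fs : suc (falses (Vec.reverse S)) ≡ k
      fs = trans (cong suc (falses-reverse S)) (ℕP.+-cancelˡ-≡ (n ∸ k) _ _ (trans (sym (ℕP.+-assoc (n ∸ k) 1 (falses S)))
        (trans (cong (_+ falses S) (sym size)) (trans (∣∣+falses S) (sym (ℕP.m∸n+n≡m k≤n))))))
    noPower : ∀ i j → 1 ≤ j → j ≤ lookup α i → ¬ ((k ∸ j) + 1 ≤ expAt m ((offset α i + j) ∸ 1))
    noPower i (suc j) _ lt le = let p , p∈ , l = lead-power i j lt in std (p , _ , inIdeal p∈ , Lead⇒LeadMon l , power-∣ₘ m _ _
        (ℕP.≤-trans (ℕP.≤-trans (ℕP.≤-reflexive (ℕP.+-∸-assoc 1 j<k)) (ℕP.≤-reflexive (ℕP.+-comm 1 (k ∸ suc j)))) (subst (λ e → (k ∸ suc j) + 1 ≤ expAt m (e ∸ 1)) (ℕP.+-suc (offset α i) j) le)))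
      where
      j<k : suc j ≤ k
      j<k = ℕP.≤-trans lt (proj₂ (α-bounds i))

-- Nonskip monomials and ordered set partitions

unique-resp-↭ : ∀ {A : Set} {xs ys : List A} → xs ↭ ys → Unique xs → Unique ys
unique-resp-↭ {A} p = PermS.Unique-resp-↭ (setoid A) (Perm.↭⇒↭ₛ p)

unique-disjoint : ∀ {A : Set} (xs : List A) {ys b} → Unique (xs ++ ys) → b ∈ xs → b ∈ ys → ⊥
unique-disjoint (x ∷ xs) (x∉ AllPairs.∷ u) (here refl) b∈ = All.lookup x∉ (MemP.∈-++⁺ʳ xs b∈) refl
unique-disjoint (x ∷ xs) (x∉ AllPairs.∷ u) (there b∈) b∈' = unique-disjoint xs u b∈ b∈'

unique-++ˡ : ∀ {A : Set} (xs : List A) {ys} → Unique (xs ++ ys) → Unique xs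
unique-++ˡ [] u = AllPairs.[]
unique-++ˡ (x ∷ xs) (x∉ AllPairs.∷ u) = AllP.++⁻ˡ xs x∉ AllPairs.∷ unique-++ˡ xs u

unique-++ʳ : ∀ {A : Set} (xs : List A) {ys} → Unique (xs ++ ys) → Unique ys
unique-++ʳ [] u = u
unique-++ʳ (x ∷ xs) (x∉ AllPairs.∷ u) = unique-++ʳ xs u

data Pick {A : Set} : List A → ℕ → A → List A → Set where
  here  : ∀ {x xs} → Pick (x ∷ xs) 0 x xs
  there : ∀ {x xs e b ys} → Pick xs e b ys → Pick (x ∷ xs) (suc e) b (x ∷ ys)

pick : ∀ {A : Set} (xs : List A) e → e < length xs → ∃ λ b → ∃ λ ys → Pick xs e b ys
pick (x ∷ xs) zero lt = x , xs , here
pick (x ∷ xs) (suc e) (s≤s lt) = let b , ys , p = pick xs e lt in b , x ∷ ys , there p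

Pick-↭ : ∀ {A : Set} {xs e} {b : A} {ys} → Pick xs e b ys → xs ↭ b ∷ ys
Pick-↭ here = Perm.refl
Pick-↭ {b = b} (there {x} p) = ↭-trans (Perm.prep x (Pick-↭ p)) (Perm.swap x b Perm.refl)

Pick-∈ : ∀ {A : Set} {xs e} {b : A} {ys} → Pick xs e b ys → b ∈ xs
Pick-∈ here = here refl
Pick-∈ (there p) = there (Pick-∈ p)

Pick-length : ∀ {A : Set} {xs e} {b : A} {ys} → Pick xs e b ys → length xs ≡ suc (length ys)
Pick-length here = refl
Pick-length (there p) = cong suc (Pick-length p)

Pick-deterministic : ∀ {A : Set} {xs e e'} {b : A} {ys ys'} → Unique xs → Pick xs e b ys → Pick xs e' b ys' → (e ≡ e') × (ys ≡ ys')
Pick-deterministic u here here = refl , refl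
Pick-deterministic (x∉ AllPairs.∷ u) here (there p) = ⊥-elim (All.lookup x∉ (Pick-∈ p) refl)
Pick-deterministic (x∉ AllPairs.∷ u) (there p) here = ⊥-elim (All.lookup x∉ (Pick-∈ p) refl)
Pick-deterministic (x∉ AllPairs.∷ u) (there p) (there p') with Pick-deterministic u p p'
... | refl , refl = refl , refl

module Filling {k : ℕ} where

  -- A new batch releases the blocks used by the previous one.
  available : ℕ → List (Fin k) → List (Fin k) → List (Fin k)
  available zero F U = F ++ U
  available (suc _) F U = F

  used : ℕ → List (Fin k) → List (Fin k)
  used zero U = []
  used (suc _) U = U

  reset-++ : ∀ j F U → available j F U ++ used j U ≡ F ++ U
  reset-++ zero F U = ListP.++-identityʳ (F ++ U)
  reset-++ (suc _) F U = refl

  -- Reads an exponent vector as instructions for placing letters into blocks: E are the empty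
  -- blocks, U the blocks already used by the current batch, and F the other blocks. The position j
  -- of a letter in its batch is 0 exactly when a new batch starts.
  data Run : (E F U : List (Fin k)) → ∀ {l} → Vec ℕ l → Vec ℕ l → Vec (Fin k) l → Set where
    done : ∀ {F U} → Run [] F U [] [] []
    new  : ∀ {E F U l j e b E'} {js m : Vec ℕ l} {w} → Pick E e b E' →
      Run E' (available j F U) (b ∷ used j U) js m w → Run E F U (j ∷ js) (e ∷ m) (b ∷ w)
    old  : ∀ {E F U l j e e' b F'} {js m : Vec ℕ l} {w} → e ≡ length E + e' → Pick (available j F U) e' b F' →
      Run E F' (b ∷ used j U) js m w → Run E F U (j ∷ js) (e ∷ m) (b ∷ w)

  record Fresh (E F U : List (Fin k)) : Set where
    constructor fresh
    field distinct : Unique (E ++ F ++ U)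
  open Fresh

  fresh-reset : ∀ j {E F U} → Fresh E F U → Fresh E (available j F U) (used j U)
  fresh-reset j {E} {F} {U} u = fresh (subst (λ xs → Unique (E ++ xs)) (sym (reset-++ j F U)) (distinct u))

  fresh-new : ∀ {E e b E' F U} → Pick E e b E' → Fresh E F U → Fresh E' F (b ∷ U)
  fresh-new {E} {b = b} {E'} {F} {U} p u = fresh (unique-resp-↭ (↭-trans (PermP.++⁺ʳ (F ++ U) (Pick-↭ p))
    (↭-trans (↭-sym (PermP.shift b E' (F ++ U))) (PermP.++⁺ˡ E' (↭-sym (PermP.shift b F U))))) (distinct u))

  fresh-old : ∀ {E e b F F' U} → Pick F e b F' → Fresh E F U → Fresh E F' (b ∷ U)
  fresh-old {E} {b = b} {F} {F'} {U} p u = fresh (unique-resp-↭ (PermP.++⁺ˡ E (↭-trans (PermP.++⁺ʳ U (Pick-↭ p)) (↭-sym (PermP.shift b F' U)))) (distinct u))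

  -- Decoding goes letter by letter. Since the lists are disjoint, a block reveals whether it was
  -- empty, and its place in the list reveals the exponent; the lists for the next letter are then
  -- determined too.
  Run-injective : ∀ {E F U l} {js m m' : Vec ℕ l} {w} → Fresh E F U → Run E F U js m w → Run E F U js m' w → m ≡ m'
  Run-injective u done done = refl
  Run-injective {E} {F} {U} {js = j ∷ _} u (new p r) (new p' r') with Pick-deterministic (unique-++ˡ E (distinct u)) p p'
  ... | refl , refl = cong (_ ∷_) (Run-injective (fresh-new p (fresh-reset j u)) r r')
  Run-injective {E} {F} {U} {js = j ∷ _} u (old refl p r) (old refl p' r')
    with Pick-deterministic (unique-++ˡ (available j F U) (unique-++ʳ E (distinct (fresh-reset j u)))) p p'
  ... | refl , refl = cong (_ ∷_) (Run-injective (fresh-old p (fresh-reset j u)) r r')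
  Run-injective {E} {F} {U} {js = j ∷ _} u (new p _) (old _ p' _) =
    ⊥-elim (unique-disjoint E (distinct (fresh-reset j u)) (Pick-∈ p) (MemP.∈-++⁺ˡ (Pick-∈ p')))
  Run-injective {E} {F} {U} {js = j ∷ _} u (old _ p _) (new p' _) =
    ⊥-elim (unique-disjoint E (distinct (fresh-reset j u)) (Pick-∈ p') (MemP.∈-++⁺ˡ (Pick-∈ p)))

  Run-covers : ∀ {E F U l} {js m : Vec ℕ l} {w} → Run E F U js m w → ∀ {b} → b ∈ E → ∃ λ p → lookup w p ≡ b
  Run-covers (new p r) b∈ with PermP.∈-resp-↭ (Pick-↭ p) b∈
  ... | here refl = Fin.zero , refl
  ... | there b∈' = let q , eq = Run-covers r b∈' in Fin.suc q , eq
  Run-covers (old _ p r) b∈ = let q , eq = Run-covers r b∈ in Fin.suc q , eq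

  used-nonzero : ∀ {j} U → j ≢ 0 → used j U ≡ U
  used-nonzero {zero} U ne = ⊥-elim (ne refl)
  used-nonzero {suc _} U ne = refl

  -- A block in `U` becomes available again only at position 0, which the condition on `js` excludes
  -- up to the letter `p`.
  Run-avoids : ∀ {E F U l} {js m : Vec ℕ l} {w} → Fresh E F U → Run E F U js m w → ∀ {b} → b ∈ U →
    ∀ p → (∀ q → toℕ q ≤ toℕ p → lookup js q ≢ 0) → lookup w p ≢ b
  Run-avoids {E} {F} {U} {js = j ∷ _} u (new {b = b} pk r) b∈ Fin.zero nz refl =
    unique-disjoint E (distinct (fresh-reset j u)) (Pick-∈ pk) (MemP.∈-++⁺ʳ (available j F U) (subst (b ∈_) (sym (used-nonzero U (nz Fin.zero z≤n))) b∈))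
  Run-avoids {E} {F} {U} {js = j ∷ _} u (old {b = b} _ pk r) b∈ Fin.zero nz refl =
    unique-disjoint (available j F U) (unique-++ʳ E (distinct (fresh-reset j u))) (Pick-∈ pk) (subst (b ∈_) (sym (used-nonzero U (nz Fin.zero z≤n))) b∈)
  Run-avoids {E} {F} {U} {js = j ∷ _} u (new pk r) {b} b∈ (Fin.suc p) nz =
    Run-avoids (fresh-new pk (fresh-reset j u)) r (there (subst (b ∈_) (sym (used-nonzero U (nz Fin.zero z≤n))) b∈)) p (λ q le → nz (Fin.suc q) (s≤s le))
  Run-avoids {E} {F} {U} {js = j ∷ _} u (old _ pk r) {b} b∈ (Fin.suc p) nz =
    Run-avoids (fresh-old pk (fresh-reset j u)) r (there (subst (b ∈_) (sym (used-nonzero U (nz Fin.zero z≤n))) b∈)) p (λ q le → nz (Fin.suc q) (s≤s le))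

  Run-distinct : ∀ {E F U l} {js m : Vec ℕ l} {w} → Fresh E F U → Run E F U js m w →
    ∀ p p' → toℕ p < toℕ p' → (∀ q → toℕ p < toℕ q → toℕ q ≤ toℕ p' → lookup js q ≢ 0) → lookup w p ≢ lookup w p'
  Run-distinct {E} {js = j ∷ _} u (new pk r) Fin.zero (Fin.suc p') lt nz eq =
    Run-avoids (fresh-new pk (fresh-reset j u)) r (here refl) p' (λ q le → nz (Fin.suc q) (s≤s z≤n) (s≤s le)) (sym eq)
  Run-distinct {E} {js = j ∷ _} u (old _ pk r) Fin.zero (Fin.suc p') lt nz eq =
    Run-avoids (fresh-old pk (fresh-reset j u)) r (here refl) p' (λ q le → nz (Fin.suc q) (s≤s z≤n) (s≤s le)) (sym eq)
  Run-distinct {E} {js = j ∷ _} u (new pk r) (Fin.suc p) (Fin.suc p') (s≤s lt) nz =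
    Run-distinct (fresh-new pk (fresh-reset j u)) r p p' lt (λ q a b → nz (Fin.suc q) (s≤s a) (s≤s b))
  Run-distinct {E} {js = j ∷ _} u (old _ pk r) (Fin.suc p) (Fin.suc p') (s≤s lt) nz =
    Run-distinct (fresh-old pk (fresh-reset j u)) r p p' lt (λ q a b → nz (Fin.suc q) (s≤s a) (s≤s b))

  -- A position either starts a batch or continues the current one, where `u` is the next position
  -- expected. This keeps the length of `U` in step with the position.
  data Chain : ∀ {l} → ℕ → Vec ℕ l → Set where
    []  : ∀ {u} → Chain u []
    _∷_ : ∀ {u j l} {js : Vec ℕ l} → (j ≡ 0) ⊎ (j ≡ u) → Chain (suc j) js → Chain u (j ∷ js)

  used-length : ∀ {j} U → (j ≡ 0) ⊎ (j ≡ length U) → length (used j U) ≡ j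
  used-length {zero} U _ = refl
  used-length {suc j} U (inj₂ eq) = sym eq

  -- At position j the earlier letters of the batch occupy j blocks, so k - j are available, empty
  -- ones included. The bound on the exponents is exactly what makes every selection possible.
  Run-exists : ∀ {l} E F U (js m : Vec ℕ l) → Chain (length U) js → length (E ++ F ++ U) ≡ k →
    (∀ p → lookup m p < k ∸ lookup js p) → final (length E) m ≡ 0 → ∃ λ w → Run E F U js m w
  Run-exists [] F U [] [] [] size small fin = [] , done
  Run-exists E F U (j ∷ js) (e ∷ m) (start ∷ chain) size small fin with e ℕ.<? length E
  ... | yes lt = let b , E' , p = pick E e lt
                     w , r = Run-exists E' (available j F U) (b ∷ used j U) js m (subst (λ u → Chain (suc u) js) (sym (used-length U start)) chain)
                       (trans (PermP.↭-length (↭-trans (PermP.++⁺ˡ E' (PermP.shift b (available j F U) (used j U)))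
                          (↭-trans (PermP.shift b E' _) (PermP.++⁺ʳ _ (↭-sym (Pick-↭ p))))))
                         (trans (cong (λ xs → length (E ++ xs)) (reset-++ j F U)) size))
                       (small ∘ Fin.suc) (trans (cong (λ s → final (ℕ.pred s) m) (sym (Pick-length p))) fin)
                 in b ∷ w , new p r
  ... | no ge = let b , F' , p = pick (available j F U) (e ∸ length E) e<
                    w , r = Run-exists E F' (b ∷ used j U) js m (subst (λ u → Chain (suc u) js) (sym (used-length U start)) chain)
                      (trans (PermP.↭-length (PermP.++⁺ˡ E (↭-trans (PermP.shift b F' (used j U)) (PermP.++⁺ʳ (used j U) (↭-sym (Pick-↭ p))))))
                         (trans (cong (λ xs → length (E ++ xs)) (reset-++ j F U)) size))
                      (small ∘ Fin.suc) fin
                in b ∷ w , old (sym (ℕP.m+[n∸m]≡n (ℕP.≮⇒≥ ge))) p r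
    where
    sizes : length E + length (available j F U) ≡ k ∸ j
    sizes = trans (sym (ℕP.m+n∸n≡m _ j)) (cong (_∸ j) (trans (ℕP.+-assoc (length E) (length (available j F U)) j)
      (trans (cong (λ u → length E + (length (available j F U) + u)) (sym (used-length U start)))
      (trans (cong (length E +_) (sym (ListP.length-++ (available j F U))))
      (trans (sym (ListP.length-++ E)) (trans (cong (λ xs → length (E ++ xs)) (reset-++ j F U)) size))))))
    e< : e ∸ length E < length (available j F U)
    e< = ℕP.+-cancelˡ-< (length E) _ _ (subst (_< length E + length (available j F U)) (sym (ℕP.m+[n∸m]≡n (ℕP.≮⇒≥ ge)))
      (subst (e <_) (sym sizes) (small Fin.zero)))

  Chain-positions : ∀ {r} (α : Vec ℕ r) u → Chain u (positions α)
  Chain-positions [] u = []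
  Chain-positions (a ∷ α) u = go a 0 u (inj₁ refl)
    where
    go : ∀ a s u → (s ≡ 0) ⊎ (s ≡ u) → Chain u (tabulate {n = a} (λ i → s + toℕ i) Vec.++ positions α)
    go zero s u _ = Chain-positions α u
    go (suc a) s u h = subst (λ x → (x ≡ 0) ⊎ (x ≡ u)) (sym (ℕP.+-identityʳ s)) h ∷
      subst (λ xs → Chain (suc (s + 0)) (xs Vec.++ positions α)) (VecP.tabulate-cong (λ i → sym (ℕP.+-suc s (toℕ i))))
        (go a (suc s) (suc (s + 0)) (inj₂ (cong suc (sym (ℕP.+-identityʳ s)))))

allVecs : {A : Set} → List A → ∀ n → List (Vec A n)
allVecs xs zero = [] ∷ []
allVecs xs (suc n) = List.cartesianProductWith _∷_ xs (allVecs xs n)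

∈-allVecs : ∀ {A : Set} {xs : List A} {n} (v : Vec A n) → (∀ i → lookup v i ∈ xs) → v ∈ allVecs xs n
∈-allVecs [] h = here refl
∈-allVecs (x ∷ v) h = MemP.∈-cartesianProductWith⁺ _∷_ (h Fin.zero) (∈-allVecs v (h ∘ Fin.suc))

allVecs-unique : ∀ {A : Set} {xs : List A} n → Unique xs → Unique (allVecs xs n)
allVecs-unique zero u = [] AllPairs.∷ AllPairs.[]
allVecs-unique (suc n) u = UniqueP.cartesianProductWith⁺ _∷_ (λ { refl → refl , refl }) u (allVecs-unique n u)

module Words {r} (k : ℕ) (α : Vec ℕ r) (0<k : 0 < k) (k≤n : k ≤ Vec.sum α)
  (α-bounds : ∀ i → (1 ≤ lookup α i) × (lookup α i ≤ k)) where

  open Leading k α 0<k k≤n α-bounds public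
  open Filling {k}

  run : ∀ {m} → Accepted m → ∃ λ w → Run (allFin k) [] [] (positions α) m w
  run {m} acc = Run-exists (allFin k) [] [] (positions α) m (Chain-positions α 0)
    (trans (cong length (ListP.++-identityʳ (allFin k))) (ListP.length-tabulate id)) (small acc)
    (trans (cong (λ s → final s m) (ListP.length-tabulate {n = k} id)) (exhausts acc))

  word : ∀ {m} → Accepted m → Vec (Fin k) n
  word acc = proj₁ (run acc)

  start-unique : Unique (allFin k ++ [] ++ [])
  start-unique = subst Unique (sym (ListP.++-identityʳ (allFin k))) (UniqueP.allFin⁺ k)

  word-injective : ∀ {m m'} (a : Accepted m) (a' : Accepted m') → word a ≡ word a' → m ≡ m'
  word-injective a a' eq = Run-injective (fresh start-unique) (proj₂ (run a))
    (subst (Run (allFin k) [] [] (positions α) _) (sym eq) (proj₂ (run a')))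

  position-inBatch : ∀ p i → InBatch α p i → lookup (positions α) p ≡ toℕ p ∸ offset α i
  position-inBatch p i (le , lt) = trans (sym (expAt-lookup (positions α) p))
    (trans (cong (expAt (positions α)) (sym (ℕP.m+[n∸m]≡n le))) (positions-offset α i (toℕ p ∸ offset α i)
      (ℕP.+-cancelˡ-< (offset α i) _ _ (subst (_< offset α i + lookup α i) (sym (ℕP.m+[n∸m]≡n le)) lt))))

  word-OP : ∀ {m} (a : Accepted m) → IsOP α (word a)
  word-OP a = (λ b → Run-covers (proj₂ (run a)) (MemP.∈-allFin b)) , distinct
    where
    ordered : ∀ p p' i → InBatch α p i → InBatch α p' i → toℕ p < toℕ p' → lookup (word a) p ≢ lookup (word a) p'
    ordered p p' i (le , _) (_ , lt) p<p' = Run-distinct (fresh start-unique) (proj₂ (run a)) p p' p<p' λ q p<q q≤p' z →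
      ℕP.<⇒≢ (ℕP.m<n⇒0<n∸m (ℕP.≤-<-trans le p<q))
        (sym (trans (sym (position-inBatch q i (ℕP.<⇒≤ (ℕP.≤-<-trans le p<q) , ℕP.≤-<-trans q≤p' lt))) z))
    distinct : ∀ p p' i → InBatch α p i → InBatch α p' i → p ≢ p' → lookup (word a) p ≢ lookup (word a) p'
    distinct p p' i b b' ne eq with ℕP.<-cmp (toℕ p) (toℕ p')
    ... | tri< lt _ _ = ordered p p' i b b' lt eq
    ... | tri≈ _ e _ = ne (FinP.toℕ-injective e)
    ... | tri> _ _ gt = ordered p' p i b' b gt (sym eq)

  Accepted? : Decidable Accepted
  Accepted? m with FinP.all? (λ p → lookup m p ℕ.<? k ∸ lookup (positions α) p) | final k m ℕ.≟ 0
  ... | yes s | yes f = yes (accepted s f)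
  ... | no ¬s | _ = no (λ a → ¬s (small a))
  ... | yes _ | no ¬f = no (λ a → ¬f (exhausts a))

  -- Accepted exponents are below k, so a finite search finds all accepted monomials.
  acceptedList : List (Monomial n)
  acceptedList = List.filter Accepted? (allVecs (upTo k) n)

  ∈-accepted⁺ : ∀ {m} → Accepted m → m ∈ acceptedList
  ∈-accepted⁺ {m} a = MemP.∈-filter⁺ Accepted? (∈-allVecs m λ i → MemP.∈-upTo⁺ (ℕP.<-≤-trans (small a i) (ℕP.m∸n≤m k (lookup (positions α) i)))) a

  ∈-accepted⁻ : ∀ {m} → m ∈ acceptedList → Accepted m
  ∈-accepted⁻ m∈ = proj₂ (MemP.∈-filter⁻ Accepted? {xs = allVecs (upTo k) n} m∈)

  acceptedList-unique : Unique acceptedList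
  acceptedList-unique = UniqueP.filter⁺ Accepted? (allVecs-unique n (UniqueP.upTo⁺ k))

-- Normal forms modulo J

<nl-wellFounded : ∀ {n} → WellFounded (_<nl_ {n})
<nl-wellFounded [] = access λ { {[]} () }
<nl-wellFounded (a ∷ as) = go as (<nl-wellFounded as) a (<-wellFounded a)
  where
  mutual
    go : ∀ {n} (as : Monomial n) → Acc _<nl_ as → ∀ a → Acc _<_ a → Acc _<nl_ (a ∷ as)
    go as wa a w = access (below as wa a w)

    below : ∀ {n} (as : Monomial n) → Acc _<nl_ as → ∀ a → Acc _<_ a → ∀ {bs} → bs <nl (a ∷ as) → Acc _<nl_ bs
    -- A smaller tail admits any head, so accessibility of the head starts afresh.
    below as (access ras) a w {b ∷ bs} (inj₁ bs<as) = go bs (ras bs<as) b (<-wellFounded b)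
    below as wa a (access ra) {b ∷ bs} (inj₂ (refl , b<a)) = go bs wa b (ra b<a)

≤nl-trans : ∀ {n} {a b c : Monomial n} → a ≤nl b → b ≤nl c → a ≤nl c
≤nl-trans (inj₁ refl) q = q
≤nl-trans (inj₂ p) (inj₁ refl) = inj₂ p
≤nl-trans (inj₂ p) (inj₂ q) = inj₂ (<nl-trans p q)

-- Homogeneous components

select : ∀ {n} (P : ℕ → Set) → Decidable P → Poly n → Poly n
select P P? = List.filter (λ t → P? (degree (proj₂ t)))

component : ∀ {n} → ℕ → Poly n → Poly n
component d = select (_≡ d) (ℕ._≟ d)

All-component : ∀ {n} d (p : Poly n) → All (λ t → degree (proj₂ t) ≡ d) (component d p)
All-component d p = AllP.all-filter (λ t → degree (proj₂ t) ℕ.≟ d) p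

Homogeneous : ∀ {n} → ℕ → Poly n → Set
Homogeneous d = Supp (λ m → degree m ≡ d)

-- Dual to `component`: selecting terms of a list becomes restricting the functional, which shows
-- that the selection respects `_≋_`.
atDegree : ∀ {n} → ℕ → (Monomial n → ℚ) → Monomial n → ℚ
atDegree d f m with degree m ℕ.≟ d
... | yes _ = f m
... | no _  = 0ℚ

atDegree-≡ : ∀ {n} d (f : Monomial n → ℚ) m → degree m ≡ d → atDegree d f m ≡ f m
atDegree-≡ d f m eq with degree m ℕ.≟ d
... | yes _ = refl
... | no ne = ⊥-elim (ne eq)

atDegree-≢ : ∀ {n} d (f : Monomial n → ℚ) m → degree m ≢ d → atDegree d f m ≡ 0ℚ
atDegree-≢ d f m ne with degree m ℕ.≟ d
... | yes eq = ⊥-elim (ne eq)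
... | no _ = refl

lin-component : ∀ {n} (f : Monomial n → ℚ) d p → lin f (component d p) ≡ lin (atDegree d f) p
lin-component f d [] = refl
lin-component f d ((c , m) ∷ p) = go (degree m ℕ.≟ d)
  where
  go : Dec (degree m ≡ d) → lin f (component d ((c , m) ∷ p)) ≡ c *q atDegree d f m +q lin (atDegree d f) p
  go (yes eq) = trans (cong (lin f) (ListP.filter-accept (λ t → degree (proj₂ t) ℕ.≟ d) {x = (c , m)} {xs = p} eq))
    (cong₂ _+q_ (cong (c *q_) (sym (atDegree-≡ d f m eq))) (lin-component f d p))
  go (no ne) = trans (cong (lin f) (ListP.filter-reject (λ t → degree (proj₂ t) ℕ.≟ d) {x = (c , m)} {xs = p} ne))
    (trans (lin-component f d p) (sym (trans (cong (λ z → c *q z +q lin (atDegree d f) p) (atDegree-≢ d f m ne))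
      (trans (cong (_+q lin (atDegree d f) p) (ℚP.*-zeroʳ c)) (ℚP.+-identityˡ (lin (atDegree d f) p))))))

component-≋ : ∀ {n} d {p q : Poly n} → p ≋ q → component d p ≋ component d q
component-≋ d {p} {q} e = ≋-lin λ f → trans (lin-component f d p) (trans (lin-≋ (atDegree d f) e) (sym (lin-component f d q)))

component-+ : ∀ {n} d (p q : Poly n) → component d (p +ₚ q) ≡ component d p +ₚ component d q
component-+ d p q = ListP.filter-++ (λ t → degree (proj₂ t) ℕ.≟ d) p q

component-all : ∀ {n} d {p : Poly n} → All (λ t → degree (proj₂ t) ≡ d) p → component d p ≡ p
component-all d = ListP.filter-all (λ t → degree (proj₂ t) ℕ.≟ d)

-- The part of degree d - e. Written with a sum, it is empty when e exceeds d, where truncated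
-- subtraction would select the constant terms.
cofactor : ∀ {n} → ℕ → ℕ → Poly n → Poly n
cofactor d e = select (λ x → x + e ≡ d) (λ x → x + e ℕ.≟ d)

component-* : ∀ {n} d e (a g : Poly n) → All (λ t → degree (proj₂ t) ≡ e) g →
  component d (a *ₚ g) ≡ cofactor d e a *ₚ g
component-* d e [] g hg = refl
component-* d e ((c , m) ∷ a) g hg = trans (component-+ d (map (λ t → (c *q proj₁ t , m ⊕ proj₂ t)) g) (a *ₚ g)) (step (degree m + e ℕ.≟ d))
  where
  term = map (λ t → (c *q proj₁ t , m ⊕ proj₂ t)) g
  degrees : All (λ t → degree (proj₂ t) ≡ degree m + e) term
  degrees = AllP.map⁺ (All.map (λ {t} eq → trans (degree-⊕ m (proj₂ t)) (cong (degree m +_) eq)) hg)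
  step : Dec (degree m + e ≡ d) → component d term +ₚ component d (a *ₚ g) ≡ cofactor d e ((c , m) ∷ a) *ₚ g
  step (yes eq) = trans (cong₂ _++_ (component-all d (All.map (λ e → trans e eq) degrees)) (component-* d e a g hg))
    (cong (_*ₚ g) (sym (ListP.filter-accept (λ t → degree (proj₂ t) + e ℕ.≟ d) {x = (c , m)} {xs = a} eq)))
  step (no ne) = trans (cong₂ _++_ (ListP.filter-none (λ t → degree (proj₂ t) ℕ.≟ d) (All.map (λ e' eq → ne (trans (sym e') eq)) degrees)) (component-* d e a g hg))
    (cong (_*ₚ g) (sym (ListP.filter-reject (λ t → degree (proj₂ t) + e ℕ.≟ d) {x = (c , m)} {xs = a} ne)))

component-*-Homogeneous : ∀ {n} d e (a : Poly n) {g} → Homogeneous e g →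
  component d (a *ₚ g) ≋ (cofactor d e a *ₚ g)
component-*-Homogeneous d e a (supp R hR g≋R) = ≋-trans (component-≋ d (mul-cong (≋-refl {p = a}) g≋R))
  (≋-trans (≋-reflexive (component-* d e a R hR)) (mul-cong (≋-refl {p = cofactor d e a}) (≋-sym g≋R)))

degree-one : ∀ n → degree (one {n}) ≡ 0
degree-one zero = refl
degree-one (suc n) = degree-one n

degree-power : ∀ {n p} d → p < n → degree (power n p d) ≡ d
degree-power {suc n} {zero} d lt = trans (cong (d +_) (degree-one n)) (ℕP.+-identityʳ d)
degree-power {suc n} {suc p} d (s≤s lt) = degree-power d lt

var-Homogeneous : ∀ {n} (i : Fin n) → Homogeneous 1 (var i)
var-Homogeneous i = subst (Homogeneous 1) (sym (var-x i)) (Supp-mono (degree-power 1 (FinP.toℕ<n i)))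

Homogeneous-* : ∀ {n a b} {p q : Poly n} → Homogeneous a p → Homogeneous b q → Homogeneous (a + b) (p *ₚ q)
Homogeneous-* = Supp-* λ {a} {b} e e' → trans (degree-⊕ a b) (cong₂ _+_ e e')

e-Homogeneous : ∀ {n} (is : List (Fin n)) d → Homogeneous d (PolySym.e (vars is) d)
e-Homogeneous {n} [] zero = Supp-mono (degree-one n)
e-Homogeneous [] (suc d) = Supp-0
e-Homogeneous {n} (i ∷ is) zero = Supp-mono (degree-one n)
e-Homogeneous (i ∷ is) (suc d) = Supp-+ (e-Homogeneous is (suc d)) (Homogeneous-* (var-Homogeneous i) (e-Homogeneous is d))

h-Homogeneous : ∀ {n} (is : List (Fin n)) d → Homogeneous d (PolySym.h (vars is) d)
h-Homogeneous {n} [] zero = Supp-mono (degree-one n)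
h-Homogeneous [] (suc d) = Supp-0
h-Homogeneous {n} (i ∷ is) zero = Supp-mono (degree-one n)
h-Homogeneous (i ∷ is) (suc d) = Supp-+ (h-Homogeneous is (suc d)) (Homogeneous-* (var-Homogeneous i) (h-Homogeneous (i ∷ is) d))

esym-Homogeneous : ∀ {n} (is : List (Fin n)) d → Homogeneous d (esym is d)
esym-Homogeneous is d = subst (Homogeneous d) (sym (esym-e is d)) (e-Homogeneous is d)

hsym-Homogeneous : ∀ {n} (is : List (Fin n)) d → Homogeneous d (hsym is d)
hsym-Homogeneous is d = subst (Homogeneous d) (sym (hsym-h is d)) (h-Homogeneous is d)

minus-cons : ∀ {n} c (x : Monomial n) F R Q →
  (scaleF c (mono x -ₚ F) +ₚ (R -ₚ Q)) ≋ (((c , x) ∷ R) -ₚ (scaleF c F ++ Q))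
minus-cons c x F R Q = ≋-lin λ f → begin
  lin f (scaleF c (mono x -ₚ F) +ₚ (R -ₚ Q))
    ≡⟨ lin-++ f (scaleF c (mono x -ₚ F)) (R -ₚ Q) ⟩
  lin f (scaleF c (mono x -ₚ F)) +q lin f (R -ₚ Q)
    ≡⟨ cong₂ _+q_ (trans (lin-scale f c (mono x -ₚ F)) (cong (c *q_) (trans (MonoD.lin-minus f (mono x) F)
         (cong (_+q (-q lin f F)) (lin-single f 1ℚ x))))) (MonoD.lin-minus f R Q) ⟩
  c *q (1ℚ *q f x +q (-q lin f F)) +q (lin f R +q (-q lin f Q))
    ≡⟨ solve 5 (λ c a F R Q → c :* (con 1ℚ :* a :+ :- F) :+ (R :+ :- Q) := (c :* a :+ R) :+ :- (c :* F :+ Q)) refl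
         c (f x) (lin f F) (lin f R) (lin f Q) ⟩
  (c *q f x +q lin f R) +q (-q (c *q lin f F +q lin f Q))
    ≡⟨ cong (λ z → (c *q f x +q lin f R) +q (-q z)) (trans (lin-++ f (scaleF c F) Q) (cong (_+q lin f Q) (lin-scale f c F))) ⟨
  (c *q f x +q lin f R) +q (-q lin f (scaleF c F ++ Q))
    ≡⟨ MonoD.lin-minus f ((c , x) ∷ R) (scaleF c F ++ Q) ⟨
  lin f (((c , x) ∷ R) -ₚ (scaleF c F ++ Q)) ∎
  where
  open ≡-Reasoning
  open +-*-Solver

module NormalForm {r} (k : ℕ) (α : Vec ℕ r) (0<k : 0 < k) (k≤n : k ≤ Vec.sum α)
  (α-bounds : ∀ i → (1 ≤ lookup α i) × (lookup α i ≤ k)) where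

  open Words k α 0<k k≤n α-bounds public

  data Generator (g : Poly n) : Set where
    e-gen : ∀ t → t < k → g ≡ esym (allFin n) (n ∸ t) → Generator g
    h-gen : ∀ i t → t < lookup α i → g ≡ hsym (batchVars n α i) (k ∸ t) → Generator g

  generator : ∀ {g} → g ∈ J → Generator g
  generator {g} g∈ = go (MemP.∈-++⁻ (eGens n k) g∈)
    where
    fromE : (∃ λ t → t ∈ upTo k × g ≡ esym (allFin n) (n ∸ t)) → Generator g
    fromE (t , t∈ , eq) = e-gen t (MemP.∈-upTo⁻ t∈) eq
    fromH : ∀ i → (∃ λ t → t ∈ upTo (lookup α i) × g ≡ hsym (batchVars n α i) (k ∸ t)) → Generator g
    fromH i (t , t∈ , eq) = h-gen i t (MemP.∈-upTo⁻ t∈) eq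
    search : (is : List (Fin r)) → Any.Any (λ i → g ∈ map (λ t → hsym (batchVars n α i) (k ∸ t)) (upTo (lookup α i))) is → Generator g
    search (i ∷ is) (here g∈i) = fromH i (MemP.∈-map⁻ (λ t → hsym (batchVars n α i) (k ∸ t)) g∈i)
    search (i ∷ is) (there p) = search is p
    go : (g ∈ eGens n k) ⊎ (g ∈ hGens n k α) → Generator g
    go (inj₁ g∈e) = fromE (MemP.∈-map⁻ (λ t → esym (allFin n) (n ∸ t)) g∈e)
    go (inj₂ g∈h) = search (allFin r) (MemP.∈-concatMap⁻ (λ i → map (λ t → hsym (batchVars n α i) (k ∸ t)) (upTo (lookup α i))) {xs = allFin r} g∈h)

  generator-Homogeneous : ∀ {g} → Generator g → ∃ λ d → Homogeneous d g
  generator-Homogeneous (e-gen t _ eq) = n ∸ t , subst (Homogeneous (n ∸ t)) (sym eq) (esym-Homogeneous (allFin n) (n ∸ t))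
  generator-Homogeneous (h-gen i t _ eq) = k ∸ t , subst (Homogeneous (k ∸ t)) (sym eq) (hsym-Homogeneous (batchVars n α i) (k ∸ t))

  -- The generators are homogeneous, so a component of a multiple of a generator is again a multiple
  -- of it.
  component∈J : ∀ d {p} → InJ p → InJ (component d p)
  component∈J d = ideal-elim (λ p → InJ (component d p)) (λ e → ideal-≈ (component-≋ d e)) ideal-0
    (λ {p} {q} i j → subst InJ (sym (component-+ d p q)) (ideal-+ i j))
    (λ a g∈ → let e , hom = generator-Homogeneous (generator g∈) in
      ideal-≈ (≋-sym (component-*-Homogeneous d e a hom)) (ideal-* (cofactor d e a) (ideal-gen g∈)))

  ideal-scale : ∀ c {p} → InJ p → InJ (scaleF c p)
  ideal-scale c {p} i = ideal-≈ (≋-sym (scale≈const* c p)) (ideal-* (const c) i)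

  -- A multiple of an element of J leads with `m`. Passing to its component in the degree of `m`
  -- stays in J and makes the reduct homogeneous, which normal forms need in order to be compared
  -- with evaluation.
  reduce : ∀ {m} → Skip m → ∃ λ R → All (λ t → (degree (proj₂ t) ≡ degree m) × (proj₂ t <nl m)) R × InJ (mono m -ₚ R)
  reduce {m} skip = let p , a , p∈ , ld , a∣m = Skip-lead skip
                        q , q⊕a≡m = ∣ₘ-quotient a m a∣m
                    in go q⊕a≡m (ideal-* (mono q) p∈) (Lead-* (Lead-mono q) ld)
    where
    go : ∀ {p m'} → m' ≡ m → InJ p → Lead p m' → ∃ λ R → All (λ t → (degree (proj₂ t) ≡ degree m) × (proj₂ t <nl m)) R × InJ (mono m -ₚ R)
    go refl p∈ (mkLead T T< p≋) = negP T' , All-scale (-q 1ℚ) (All.zip (All-component (degree m) T , AllP.filter⁺ (λ t → degree (proj₂ t) ℕ.≟ degree m) T<)) ,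
      ideal-≈ (≋-trans (component-≋ (degree m) p≋) (≋-trans (≋-reflexive split) (add-cong (≋-refl {p = mono m}) (≋-sym double)))) (component∈J (degree m) p∈)
      where
      T' = component (degree m) T
      split : component (degree m) (mono m +ₚ T) ≡ mono m +ₚ T'
      split = ListP.filter-accept (λ t → degree (proj₂ t) ℕ.≟ degree m) {x = (1ℚ , m)} {xs = T} refl
      double : negP (negP T') ≋ T'
      double = PolySym.solve 1 (λ x → PolySym.:-_ (PolySym.:-_ x) PolySym.:= x) ≋-refl T'

  -- The order bound serves the analysis of leading coefficients, the degree condition the
  -- comparison with evaluation.
  Below : Monomial n → Monomial n → Set
  Below m m' = Accepted m' × (degree m' ≡ degree m) × (m' ≤nl m)

  record NF (m : Monomial n) : Set where
    constructor nf
    field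
      form : Poly n
      form-Below : All (Below m ∘ proj₂) form
      form-≡ : InJ (mono m -ₚ form)

  combine : ∀ {m} R → All (λ t → (degree (proj₂ t) ≡ degree m) × (proj₂ t <nl m) × NF (proj₂ t)) R →
    ∃ λ Q → All (Below m ∘ proj₂) Q × InJ (R -ₚ Q)
  combine [] [] = [] , [] , ideal-0
  combine {m} ((c , x) ∷ R) ((dx , x< , nf F FB F≡) ∷ a) = let Q , QB , Q≡ = combine R a in
    scaleF c F ++ Q ,
    AllP.++⁺ (All-scale {P = Below m} c (All.map (λ { (acc' , dm , le) → acc' , trans dm dx , ≤nl-trans le (inj₂ x<) }) FB)) QB ,
    ideal-≈ (minus-cons c x F R Q) (ideal-+ (ideal-scale c F≡) Q≡)

  minus-minus : ∀ (p q s : Poly n) → ((p -ₚ q) +ₚ (q -ₚ s)) ≋ (p -ₚ s)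
  minus-minus p q s = PolySym.solve 3 (λ p q s → (p :+ :- q) :+ (q :+ :- s) := p :+ :- s) ≋-refl p q s
    where open PolySym using (_:+_; :-_; _:=_)

  mutual
    normalise : ∀ m → Acc _<nl_ m → NF m
    normalise m (access rec) = normaliseCase m rec (Accepted? m)

    normaliseCase : ∀ m → (∀ {m'} → m' <nl m → Acc _<nl_ m') → Dec (Accepted m) → NF m
    normaliseCase m rec (yes a) = nf (mono m) ((a , refl , inj₁ refl) ∷ []) (ideal-≈ (≋-sym (add-inverseʳ (mono m))) ideal-0)
    normaliseCase m rec (no ¬a) = fromReduct (reduce (skipOf (classify m)))
      where
      skipOf : Accepted m ⊎ Skip m → Skip m
      skipOf (inj₁ a) = ⊥-elim (¬a a)
      skipOf (inj₂ s) = s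
      normals : ∀ R → All (λ t → (degree (proj₂ t) ≡ degree m) × (proj₂ t <nl m)) R →
        All (λ t → (degree (proj₂ t) ≡ degree m) × (proj₂ t <nl m) × NF (proj₂ t)) R
      normals [] [] = []
      normals ((c , x) ∷ R) ((dx , x<) ∷ a) = (dx , x< , normalise x (rec x<)) ∷ normals R a
      fromReduct : (∃ λ R → All (λ t → (degree (proj₂ t) ≡ degree m) × (proj₂ t <nl m)) R × InJ (mono m -ₚ R)) → NF m
      fromReduct (R , a , R≡) = let Q , QB , Q≡ = combine R (normals R a) in
        nf Q QB (ideal-≈ (minus-minus (mono m) R Q) (ideal-+ R≡ Q≡))

  normal : ∀ m → NF m
  normal m = normalise m (<nl-wellFounded m)

  N : Monomial n → Poly n
  N m = NF.form (normal m)

  N-accepted : ∀ {m} → Accepted m → N m ≡ mono m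
  N-accepted {m} a = go (<nl-wellFounded m)
    where
    go : ∀ ac → NF.form (normalise m ac) ≡ mono m
    go (access rec) = go' (Accepted? m)
      where
      go' : ∀ d → NF.form (normaliseCase m rec d) ≡ mono m
      go' (yes _) = refl
      go' (no ¬a) = ⊥-elim (¬a a)

  N̂ : Poly n → Poly n
  N̂ = bind N

  All-bind : ∀ {P Q : Monomial n → Set} p → All (P ∘ proj₂) p → (∀ {m} → P m → All (Q ∘ proj₂) (N m)) → All (Q ∘ proj₂) (N̂ p)
  All-bind [] [] h = []
  All-bind {P} {Q} ((c , m) ∷ p) (pm ∷ ps) h = AllP.++⁺ (All-scale {P = Q} c (h pm)) (All-bind {P} {Q} p ps h)

  N̂-accepted : ∀ p → All (Accepted ∘ proj₂) (N̂ p)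
  N̂-accepted p = All-bind {P = λ _ → n ≡ n} p (All.universal (λ _ → refl) p) (λ {m} _ → All.map proj₁ (NF.form-Below (normal m)))

  N̂-degree : ∀ (P : ℕ → Set) p → All (P ∘ degree ∘ proj₂) p → All (P ∘ degree ∘ proj₂) (N̂ p)
  N̂-degree P p a = All-bind {P = P ∘ degree} {Q = P ∘ degree} p a (λ {m} pm → All.map (λ b → subst P (sym (proj₁ (proj₂ b))) pm) (NF.form-Below (normal m)))

  N̂-≡ : ∀ p → InJ (p -ₚ N̂ p)
  N̂-≡ [] = ideal-0
  N̂-≡ ((c , x) ∷ p) = ideal-≈ (minus-cons c x (N x) p (N̂ p)) (ideal-+ (ideal-scale c (NF.form-≡ (normal x))) (N̂-≡ p))

-- Evaluation at the points of OP

module RatSym = Symmetric ℚP.+-*-commutativeRing ℚAlgebra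

infixr 8 _^q_
_^q_ : ℚ → ℕ → ℚ
x ^q zero = 1ℚ
x ^q suc e = x *q x ^q e

^q-+ : ∀ x a b → x ^q (a + b) ≡ x ^q a *q x ^q b
^q-+ x zero b = sym (ℚP.*-identityˡ (x ^q b))
^q-+ x (suc a) b = trans (cong (x *q_) (^q-+ x a b)) (sym (ℚP.*-assoc x (x ^q a) (x ^q b)))

prodF : ∀ n → (Fin n → ℚ) → ℚ
prodF zero f = 1ℚ
prodF (suc n) f = f Fin.zero *q prodF n (f ∘ Fin.suc)

prodF-cong : ∀ n {f g} → (∀ i → f i ≡ g i) → prodF n f ≡ prodF n g
prodF-cong zero h = refl
prodF-cong (suc n) h = cong₂ _*q_ (h Fin.zero) (prodF-cong n (h ∘ Fin.suc))

prodF-* : ∀ n f g → prodF n (λ i → f i *q g i) ≡ prodF n f *q prodF n g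
prodF-* zero f g = refl
prodF-* (suc n) f g = trans (cong (f Fin.zero *q g Fin.zero *q_) (prodF-* n (f ∘ Fin.suc) (g ∘ Fin.suc)))
  (solve 4 (λ a b c d → (a :* b) :* (c :* d) := (a :* c) :* (b :* d)) refl (f Fin.zero) (g Fin.zero) (prodF n (f ∘ Fin.suc)) (prodF n (g ∘ Fin.suc)))
  where open +-*-Solver

prodF-1 : ∀ n → prodF n (λ _ → 1ℚ) ≡ 1ℚ
prodF-1 zero = refl
prodF-1 (suc n) = trans (ℚP.*-identityˡ (prodF n (λ _ → 1ℚ))) (prodF-1 n)

prodL : List ℚ → ℚ
prodL [] = 1ℚ
prodL (x ∷ xs) = x *q prodL xs

prodL-↭ : ∀ {xs ys} → xs ↭ ys → prodL xs ≡ prodL ys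
prodL-↭ Perm.refl = refl
prodL-↭ (Perm.prep x p) = cong (x *q_) (prodL-↭ p)
prodL-↭ (Perm.swap {xs} {ys} x y p) = trans (cong (λ z → x *q (y *q z)) (prodL-↭ p))
  (solve 3 (λ x y z → x :* (y :* z) := y :* (x :* z)) refl x y (prodL ys))
  where open +-*-Solver
prodL-↭ (Perm.trans p q) = trans (prodL-↭ p) (prodL-↭ q)

prodF-list : ∀ n f → prodF n f ≡ prodL (map f (allFin n))
prodF-list zero f = refl
prodF-list (suc n) f = cong (f Fin.zero *q_) (trans (prodF-list n (f ∘ Fin.suc))
  (cong prodL (trans (ListP.map-tabulate id (f ∘ Fin.suc)) (sym (ListP.map-tabulate Fin.suc f)))))

allFin-↭ : ∀ {n} (u u' : Fin n → Fin n) → (∀ q → u (u' q) ≡ q) → (∀ q → u' (u q) ≡ q) → map u (allFin n) ↭ allFin n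
allFin-↭ {n} u u' uu' u'u = unique-↭ (UniqueP.map⁺ (λ {p} {q} eq → trans (sym (u'u p)) (trans (cong u' eq) (u'u q))) (UniqueP.allFin⁺ n)) (UniqueP.allFin⁺ n)
  (λ {x} _ → MemP.∈-allFin x) (λ {x} _ → subst (_∈ map u (allFin n)) (uu' x) (MemP.∈-map⁺ u (MemP.∈-allFin (u' x))))

prodF-perm : ∀ {n} (u u' : Fin n → Fin n) → (∀ q → u (u' q) ≡ q) → (∀ q → u' (u q) ≡ q) → ∀ f → prodF n (f ∘ u) ≡ prodF n f
prodF-perm {n} u u' uu' u'u f = trans (prodF-list n (f ∘ u)) (trans (cong prodL (ListP.map-∘ (allFin n)))
  (trans (prodL-↭ (PermP.map⁺ f (allFin-↭ u u' uu' u'u))) (sym (prodF-list n f))))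

evalM : ∀ {n} → (Fin n → ℚ) → Monomial n → ℚ
evalM {n} a m = prodF n (λ i → a i ^q lookup m i)

evalM-⊕ : ∀ {n} (a : Fin n → ℚ) m m' → evalM a (m ⊕ m') ≡ evalM a m *q evalM a m'
evalM-⊕ {n} a m m' = trans (prodF-cong n λ i → trans (cong (a i ^q_) (VecP.lookup-zipWith _+_ i m m')) (^q-+ (a i) (lookup m i) (lookup m' i)))
  (prodF-* n (λ i → a i ^q lookup m i) (λ i → a i ^q lookup m' i))

evalM-one : ∀ {n} (a : Fin n → ℚ) → evalM a one ≡ 1ℚ
evalM-one {n} a = trans (prodF-cong n λ i → cong (a i ^q_) (VecP.lookup-replicate i 0)) (prodF-1 n)

evalM-power : ∀ {n} (a : Fin n → ℚ) i → evalM a (power n (toℕ i) 1) ≡ a i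
evalM-power {suc n} a Fin.zero = trans (cong (a Fin.zero *q 1ℚ *q_) (evalM-one (a ∘ Fin.suc)))
  (trans (ℚP.*-identityʳ (a Fin.zero *q 1ℚ)) (ℚP.*-identityʳ (a Fin.zero)))
evalM-power {suc n} a (Fin.suc i) = trans (ℚP.*-identityˡ (evalM (a ∘ Fin.suc) (power n (toℕ i) 1))) (evalM-power (a ∘ Fin.suc) i)

eval : ∀ {n} → (Fin n → ℚ) → Poly n → ℚ
eval a = lin (evalM a)

module _ {n} (a : Fin n → ℚ) where

  eval-+ : ∀ p q → eval a (p +ₚ q) ≡ eval a p +q eval a q
  eval-+ = lin-++ (evalM a)

  eval-* : ∀ p q → eval a (p *ₚ q) ≡ eval a p *q eval a q
  eval-* p q = trans (lin-mul (evalM a) p q) (trans (lin-cong (λ m → trans (lin-cong (λ m' → evalM-⊕ a m m') q) (lin-* (evalM a m) (evalM a) q)) p)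
    (trans (lin-cong (λ m → ℚP.*-comm (evalM a m) (eval a q)) p) (trans (lin-* (eval a q) (evalM a) p) (ℚP.*-comm (eval a q) (eval a p)))))

  eval-1 : eval a oneP ≡ 1ℚ
  eval-1 = trans (lin-single (evalM a) 1ℚ one) (trans (ℚP.*-identityˡ (evalM a one)) (evalM-one a))

  eval-const : ∀ c → eval a (const c) ≡ c
  eval-const c = trans (lin-single (evalM a) c one) (trans (cong (c *q_) (evalM-one a)) (ℚP.*-identityʳ c))

  eval-neg : ∀ p → eval a (negP p) ≡ -q eval a p
  eval-neg = lin-neg (evalM a)

  eval-var : ∀ i → eval a (var i) ≡ a i
  eval-var i = trans (cong (eval a) (var-x i)) (trans (lin-single (evalM a) 1ℚ (power n (toℕ i) 1))
    (trans (ℚP.*-identityˡ (evalM a (power n (toℕ i) 1))) (evalM-power a i)))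

  module H = Homomorphism (polyRing n) (polyAlgebra n) ℚP.+-*-commutativeRing ℚAlgebra

  eval-vars : ∀ is → map (eval a) (vars is) ≡ map a is
  eval-vars is = trans (sym (ListP.map-∘ is)) (ListP.map-cong eval-var is)

  eval-h : ∀ is d → eval a (PolySym.h (vars is) d) ≡ RatSym.h (map a is) d
  eval-h is d = trans (H.hom-h (eval a) eval-+ eval-* refl eval-1 (vars is) d) (cong (λ xs → RatSym.h xs d) (eval-vars is))

  eval-ε : ∀ is d → eval a (PolySym.ε (vars is) d) ≡ RatSym.ε (map a is) d
  eval-ε is d = trans (H.hom-ε (eval a) eval-+ eval-* refl eval-1 eval-neg (vars is) d) (cong (λ xs → RatSym.ε xs d) (eval-vars is))

  eval-sumN : ∀ i g → eval a (PolySym.sumN i g) ≡ RatSym.sumN i (eval a ∘ g)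
  eval-sumN = H.hom-sumN (eval a) eval-+ eval-* refl eval-1

Degree< : ∀ {n} → ℕ → Poly n → Set
Degree< d = Supp (λ m → degree m < d)

Supp-sumN : ∀ {n} {P : Monomial n → Set} i g → (∀ j → j < i → Supp P (g j)) → Supp P (PolySym.sumN i g)
Supp-sumN zero g h = Supp-0
Supp-sumN (suc i) g h = Supp-+ (Supp-sumN i g (λ j j<i → h j (ℕP.m≤n⇒m≤1+n j<i))) (h i ℕP.≤-refl)

const-Homogeneous : ∀ {n} c → Homogeneous {n} 0 (const c)
const-Homogeneous {n} c = supp (const c) (degree-one n ∷ []) ≋-refl

sgn-Homogeneous : ∀ {n} d → Homogeneous {n} 0 (PolySym.sgn d)
sgn-Homogeneous {n} zero = Supp-mono (degree-one n)
sgn-Homogeneous (suc d) = Supp-neg (sgn-Homogeneous d)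

ε-Homogeneous : ∀ {n} (is : List (Fin n)) d → Homogeneous d (PolySym.ε (vars is) d)
ε-Homogeneous is d = Supp-≋ (≋-sym (PolySym.ε-sgn (vars is) d)) (Homogeneous-* (sgn-Homogeneous d) (e-Homogeneous is d))

-- The identity h⋆ε, solved for its term of top degree in the point.
e-lift : ∀ {n} (is : List (Fin n)) (Y : List ℚ) d → ∃ λ L → Degree< d L ×
  (∀ (a : Fin n → ℚ) Z → map a is ↭ Y ++ Z → length Z < d → eval a (esym is d) ≡ eval a L)
e-lift is Y d = PolySym.sgn d *ₚ negP (PolySym.sumN d term) , degrees , agree
  where
  open RatSym hiding (solve; _:=_; _:+_; _:*_; :-_; con)
  open +-*-Solver using (solve; _:=_; _:+_; _:*_; :-_; con)
  term = λ a → const (h Y (suc a)) *ₚ PolySym.ε (vars is) (d ∸ suc a)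
  degrees : Degree< d (PolySym.sgn d *ₚ negP (PolySym.sumN d term))
  degrees = Supp-* (λ {a} {b} z lt → subst (_< d) (sym (trans (degree-⊕ a b) (cong (_+ degree b) z))) lt) (sgn-Homogeneous d)
    (Supp-neg (Supp-sumN d term λ j j<d → Supp-map (λ {m} eq → subst (_< d) (sym eq) (ℕP.∸-monoʳ-< (s≤s z≤n) j<d))
      (Homogeneous-* (const-Homogeneous (h Y (suc j))) (ε-Homogeneous is (d ∸ suc j)))))
  agree : ∀ a Z → map a is ↭ Y ++ Z → length Z < d → eval a (esym is d) ≡ eval a (PolySym.sgn d *ₚ negP (PolySym.sumN d term))
  agree a Z p lt = trans (cong (eval a) (esym-e is d)) (trans (lin-≋ (evalM a) (PolySym.e-sgn (vars is) d))
    (trans (eval-* a (PolySym.sgn d) (PolySym.ε (vars is) d)) (trans (cong (eval a (PolySym.sgn d) *q_) value)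
      (sym (eval-* a (PolySym.sgn d) (negP (PolySym.sumN d term)))))))
    where
    W = map a is
    S = sumN d (λ j → h Y (suc j) *q ε W (d ∸ suc j))
    S≡ : eval a (PolySym.sumN d term) ≡ S
    S≡ = trans (eval-sumN a d term) (sumN-cong d λ j _ → trans (eval-* a (const (h Y (suc j))) (PolySym.ε (vars is) (d ∸ suc j)))
      (cong₂ _*q_ (eval-const a (h Y (suc j))) (eval-ε a is (d ∸ suc j))))
    total : ε W d +q S ≡ 0ℚ
    total = trans (cong (_+q S) (sym (trans (cong (_*q ε W d) (h-zero Y)) (ℚP.*-identityˡ (ε W d)))))
      (trans (sym (sumN-front d (λ j → h Y j *q ε W (d ∸ j))))
      (trans (sumN-cong (suc d) (λ j _ → cong (h Y j *q_) (ε-↭ p (d ∸ j)))) (trans (h⋆ε Y Z d) (ε-vanish Z d lt))))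
    value : eval a (PolySym.ε (vars is) d) ≡ eval a (negP (PolySym.sumN d term))
    value = trans (eval-ε a is d) (trans (solve 2 (λ x s → x := (x :+ s) :+ :- s) refl (ε W d) S)
      (trans (cong (_+q (-q S)) total) (trans (ℚP.+-identityˡ (-q S)) (sym (trans (eval-neg a (PolySym.sumN d term)) (cong -q_ S≡))))))

h-lift : ∀ {n} (is : List (Fin n)) (Y : List ℚ) d → ∃ λ L → Degree< d L ×
  (∀ (a : Fin n → ℚ) Z → Y ↭ map a is ++ Z → length Z < d → eval a (hsym is d) ≡ eval a L)
h-lift is Y d = negP (PolySym.sumN d term) , degrees , agree
  where
  open RatSym hiding (solve; _:=_; _:+_; _:*_; :-_; con)
  open +-*-Solver using (solve; _:=_; _:+_; _:*_; :-_; con)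
  term = λ a → const (ε Y (d ∸ a)) *ₚ PolySym.h (vars is) a
  degrees : Degree< d (negP (PolySym.sumN d term))
  degrees = Supp-neg (Supp-sumN d term λ j j<d → Supp-map (λ {m} eq → subst (_< d) (sym eq) j<d)
      (Homogeneous-* (const-Homogeneous (ε Y (d ∸ j))) (h-Homogeneous is j)))
  agree : ∀ a Z → Y ↭ map a is ++ Z → length Z < d → eval a (hsym is d) ≡ eval a (negP (PolySym.sumN d term))
  agree a Z p lt = trans (cong (eval a) (hsym-h is d)) (trans (eval-h a is d) (trans (solve 2 (λ x s → x := (s :+ x) :+ :- s) refl (h V d) S)
      (trans (cong (_+q (-q S)) total) (trans (ℚP.+-identityˡ (-q S)) (sym (trans (eval-neg a (PolySym.sumN d term)) (cong -q_ S≡)))))))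
    where
    V = map a is
    S = sumN d (λ j → h V j *q ε Y (d ∸ j))
    S≡ : eval a (PolySym.sumN d term) ≡ S
    S≡ = trans (eval-sumN a d term) (sumN-cong d λ j _ → trans (eval-* a (const (ε Y (d ∸ j))) (PolySym.h (vars is) j))
      (trans (cong₂ _*q_ (eval-const a (ε Y (d ∸ j))) (eval-h a is j)) (ℚP.*-comm (ε Y (d ∸ j)) (h V j))))
    total : S +q h V d ≡ 0ℚ
    total = trans (cong (S +q_) (sym (trans (cong (λ z → h V d *q ε Y z) (ℕP.n∸n≡0 d)) (trans (cong (h V d *q_) (ε-zero Y)) (ℚP.*-identityʳ (h V d))))))
      (trans (sumN-cong (suc d) (λ j _ → cong (h V j *q_) (ε-↭ p (d ∸ j)))) (trans (h⋆ε V Z d) (ε-vanish Z d lt)))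

-- The values y are 0, ..., k - 1. They are given as reduced fractions, so that distinctness is read
-- off from the numerators.
coordinate : ∀ {k} → Fin k → ℚ
coordinate b = ℚ.mkℚ (ℤ.+ toℕ b) 0 (Coprimality.sym (Coprimality.1-coprimeTo (toℕ b)))

coordinate-injective : ∀ {k} {b b' : Fin k} → coordinate b ≡ coordinate b' → b ≡ b'
coordinate-injective eq = FinP.toℕ-injective (cong (ℤ.∣_∣ ∘ ℚ.numerator) eq)

point : ∀ {n k} → Vec (Fin k) n → Fin n → ℚ
point w p = coordinate (lookup w p)

extend-↭ : ∀ {A : Set} (xs ys : List A) → Unique ys → (∀ {b} → b ∈ ys → b ∈ xs) → ∃ λ Z → xs ↭ ys ++ Z
extend-↭ xs [] u sub = xs , Perm.refl
extend-↭ xs (y ∷ ys) (y∉ AllPairs.∷ u) sub with MemP.∈-∃++ (sub (here refl))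
... | as , bs , refl with extend-↭ (as ++ bs) ys u (λ b∈ → drop b∈ (MemP.∈-++⁻ as (sub (there b∈))))
  where
  drop : ∀ {b} → b ∈ ys → (b ∈ as) ⊎ (b ∈ y ∷ bs) → b ∈ as ++ bs
  drop b∈ (inj₁ b∈as) = MemP.∈-++⁺ˡ b∈as
  drop b∈ (inj₂ (here refl)) = ⊥-elim (All.lookup y∉ b∈ refl)
  drop b∈ (inj₂ (there b∈bs)) = MemP.∈-++⁺ʳ as b∈bs
...   | Z , p = Z , ↭-trans (PermP.shift y as bs) (Perm.prep y p)

map-↭-++ : ∀ {A B : Set} (f : A → B) {xs ys zs : List A} → xs ↭ ys ++ zs → map f xs ↭ map f ys ++ map f zs
map-↭-++ f {xs} {ys} {zs} p = subst (map f xs ↭_) (ListP.map-++ f ys zs) (PermP.map⁺ f p)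

length-rest : ∀ {A : Set} {xs ys zs : List A} → xs ↭ ys ++ zs → length ys + length zs ≡ length xs
length-rest {ys = ys} p = trans (sym (ListP.length-++ ys)) (sym (PermP.↭-length p))

module Evaluation {r} (k : ℕ) (α : Vec ℕ r) (0<k : 0 < k) (k≤n : k ≤ Vec.sum α)
  (α-bounds : ∀ i → (1 ≤ lookup α i) × (lookup α i ≤ k)) where

  open NormalForm k α 0<k k≤n α-bounds public

  ev : Vec (Fin k) n → Poly n → ℚ
  ev w = eval (point w)

  record Lift (g : Poly n) : Set where
    constructor mkLift
    field
      deg : ℕ
      homogeneous : Homogeneous deg g
      lower : Poly n
      lower-< : Degree< deg lower
      agrees : ∀ w → IsOP α w → ev w g ≡ ev w lower

  -- No block is empty, so the coordinates of the point include all k values; the n - k others are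
  -- fewer than the degree n - t.
  e-Lift : ∀ t → t < k → Lift (esym (allFin n) (n ∸ t))
  e-Lift t t<k = go (e-lift (allFin n) (map coordinate (allFin k)) (n ∸ t))
    where
    go : (∃ λ L → Degree< (n ∸ t) L ×
      (∀ a Z → map a (allFin n) ↭ map coordinate (allFin k) ++ Z → length Z < n ∸ t → eval a (esym (allFin n) (n ∸ t)) ≡ eval a L)) →
      Lift (esym (allFin n) (n ∸ t))
    go (L , L< , agree) = mkLift (n ∸ t) (esym-Homogeneous (allFin n) (n ∸ t)) L L< λ w op → values w (extend-↭ (map (lookup w) (allFin n)) (allFin k) (UniqueP.allFin⁺ k) (covered w op))
      where
      covered : ∀ w → IsOP α w → ∀ {b} → b ∈ allFin k → b ∈ map (lookup w) (allFin n)
      covered w (onto , _) {b} _ = subst (_∈ map (lookup w) (allFin n)) (proj₂ (onto b)) (MemP.∈-map⁺ (lookup w) (MemP.∈-allFin (proj₁ (onto b))))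
      values : ∀ w → (∃ λ Z → map (lookup w) (allFin n) ↭ allFin k ++ Z) → ev w (esym (allFin n) (n ∸ t)) ≡ ev w L
      values w (Z , p) = agree (point w) (map coordinate Z) (subst (_↭ map coordinate (allFin k) ++ map coordinate Z) (sym (ListP.map-∘ {g = coordinate} {f = lookup w} (allFin n))) (map-↭-++ coordinate {ys = allFin k} p))
        (subst (_< n ∸ t) (sym (trans (ListP.length-map coordinate Z) size)) (ℕP.∸-monoʳ-< t<k k≤n))
        where
        size : length Z ≡ n ∸ k
        size = trans (sym (ℕP.m+n∸m≡n k (length Z))) (cong (_∸ k) (trans (cong (_+ length Z) (sym (ListP.length-tabulate {n = k} id)))
          (trans (length-rest {ys = allFin k} p) (trans (ListP.length-map (lookup w) (allFin n)) (ListP.length-tabulate {n = n} id)))))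

  h-Lift : ∀ i t → t < lookup α i → Lift (hsym (batchVars n α i) (k ∸ t))
  h-Lift i t t<α = go (h-lift (batchVars n α i) (map coordinate (allFin k)) (k ∸ t))
    where
    go : (∃ λ L → Degree< (k ∸ t) L ×
      (∀ a Z → map coordinate (allFin k) ↭ map a (batchVars n α i) ++ Z → length Z < k ∸ t → eval a (hsym (batchVars n α i) (k ∸ t)) ≡ eval a L)) →
      Lift (hsym (batchVars n α i) (k ∸ t))
    go (L , L< , agree) = mkLift (k ∸ t) (hsym-Homogeneous (batchVars n α i) (k ∸ t)) L L< λ w op →
        values w (extend-↭ (allFin k) (map (lookup w) (batchVars n α i)) (distinct w op (batchVars-unique n α i) (λ p∈ → ∈-batchVars⁻ α i p∈)) (λ {b} _ → MemP.∈-allFin b))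
      where
      distinct : ∀ w → IsOP α w → ∀ {ps} → Unique ps → (∀ {p} → p ∈ ps → InBatch α p i) → Unique (map (lookup w) ps)
      distinct w op {[]} _ _ = AllPairs.[]
      distinct w op {p ∷ ps} (p∉ AllPairs.∷ u) inB =
        AllP.map⁺ (All.tabulate λ {q} q∈ → proj₂ op p q i (inB (here refl)) (inB (there q∈)) (All.lookup p∉ q∈)) AllPairs.∷ distinct w op u (inB ∘ there)
      values : ∀ w → (∃ λ Z → allFin k ↭ map (lookup w) (batchVars n α i) ++ Z) → ev w (hsym (batchVars n α i) (k ∸ t)) ≡ ev w L
      values w (Z , p) = agree (point w) (map coordinate Z) (subst (λ xs → map coordinate (allFin k) ↭ xs ++ map coordinate Z) (sym (ListP.map-∘ {g = coordinate} {f = lookup w} (batchVars n α i))) (map-↭-++ coordinate {ys = map (lookup w) (batchVars n α i)} p))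
        (subst (_< k ∸ t) (sym (trans (ListP.length-map coordinate Z) size)) (ℕP.∸-monoʳ-< t<α (proj₂ (α-bounds i))))
        where
        size : length Z ≡ k ∸ lookup α i
        size = trans (sym (ℕP.m+n∸m≡n (lookup α i) (length Z))) (cong (_∸ lookup α i) (trans (cong (_+ length Z) (sym batchSize))
          (trans (length-rest {ys = map (lookup w) (batchVars n α i)} p) (ListP.length-tabulate {n = k} id))))
          where
          batchSize : length (map (lookup w) (batchVars n α i)) ≡ lookup α i
          batchSize = trans (ListP.length-map (lookup w) (batchVars n α i)) (trans (sym (ListP.length-map toℕ (batchVars n α i)))
            (trans (PermP.↭-length (batchVars-↭ α i)) (segment-length (offset α i) (lookup α i))))

  lift : ∀ {g} → Generator g → Lift g
  lift (e-gen t t<k eq) = subst Lift (sym eq) (e-Lift t t<k)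
  lift (h-gen i t t<α eq) = subst Lift (sym eq) (h-Lift i t t<α)

  record Lower (d : ℕ) (f : Vec (Fin k) n → ℚ) : Set where
    constructor mkLower
    field
      poly : Poly n
      poly-< : Degree< d poly
      agrees : ∀ w → IsOP α w → f w ≡ ev w poly

  -- J is contained in the ideal of top-degree parts of polynomials vanishing on the points of OP.
  J-lower : ∀ d {p} → InJ p → Lower d (λ w → ev w (component d p))
  J-lower d = ideal-elim (λ p → Lower d (λ w → ev w (component d p)))
    (λ { e (mkLower r r< eq) → mkLower r r< (λ w op → trans (sym (lin-≋ (evalM (point w)) (component-≋ d e))) (eq w op)) })
    (mkLower zeroP Supp-0 (λ w _ → refl))
    (λ { {p} {q} (mkLower r r< eq) (mkLower s s< eq') → mkLower (r +ₚ s) (Supp-+ r< s<) λ w op →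
      trans (cong (ev w) (component-+ d p q)) (trans (eval-+ (point w) (component d p) (component d q))
        (trans (cong₂ _+q_ (eq w op) (eq' w op)) (sym (eval-+ (point w) r s)))) })
    (λ a g∈ → fromLift a (lift (generator g∈)))
    where
    fromLift : ∀ a {g} → Lift g → Lower d (λ w → ev w (component d (a *ₚ g)))
    -- Only the part of `a` of degree d - e contributes in degree d, and its product with `L` has
    -- degree below d.
    fromLift a {g} (mkLift e hom L L< agree) = mkLower (a' *ₚ L)
      (Supp-* (λ {m} {m'} eq lt → subst (_< d) (sym (degree-⊕ m m')) (ℕP.<-≤-trans (ℕP.+-monoʳ-< (degree m) lt) (ℕP.≤-reflexive eq)))
        (supp a' (AllP.all-filter (λ t → degree (proj₂ t) + e ℕ.≟ d) a) ≋-refl) L<)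
      λ w op → trans (lin-≋ (evalM (point w)) (component-*-Homogeneous d e a hom)) (trans (eval-* (point w) a' g)
        (trans (cong (ev w a' *q_) (agree w op)) (sym (eval-* (point w) a' L))))
      where a' = cofactor d e a

-- Linear algebra over ℚ

sumF : ∀ n → (Fin n → ℚ) → ℚ
sumF zero f = 0ℚ
sumF (suc n) f = f Fin.zero +q sumF n (f ∘ Fin.suc)

sumF-cong : ∀ n {f g} → (∀ i → f i ≡ g i) → sumF n f ≡ sumF n g
sumF-cong zero h = refl
sumF-cong (suc n) h = cong₂ _+q_ (h Fin.zero) (sumF-cong n (h ∘ Fin.suc))

sumF-0 : ∀ n {f} → (∀ i → f i ≡ 0ℚ) → sumF n f ≡ 0ℚ
sumF-0 zero h = refl
sumF-0 (suc n) h = trans (cong₂ _+q_ (h Fin.zero) (sumF-0 n (h ∘ Fin.suc))) refl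

sumF-+ : ∀ n f g → sumF n (λ i → f i +q g i) ≡ sumF n f +q sumF n g
sumF-+ zero f g = refl
sumF-+ (suc n) f g = trans (cong (f Fin.zero +q g Fin.zero +q_) (sumF-+ n (f ∘ Fin.suc) (g ∘ Fin.suc)))
  (solve 4 (λ a b c d → (a :+ b) :+ (c :+ d) := (a :+ c) :+ (b :+ d)) refl (f Fin.zero) (g Fin.zero) (sumF n (f ∘ Fin.suc)) (sumF n (g ∘ Fin.suc)))
  where open +-*-Solver

sumF-* : ∀ n c f → sumF n (λ i → c *q f i) ≡ c *q sumF n f
sumF-* zero c f = sym (ℚP.*-zeroʳ c)
sumF-* (suc n) c f = trans (cong (c *q f Fin.zero +q_) (sumF-* n c (f ∘ Fin.suc))) (sym (ℚP.*-distribˡ-+ c (f Fin.zero) (sumF n (f ∘ Fin.suc))))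

sumF-swap : ∀ m n (f : Fin m → Fin n → ℚ) → sumF m (λ i → sumF n (f i)) ≡ sumF n (λ j → sumF m (λ i → f i j))
sumF-swap zero n f = sym (sumF-0 n (λ _ → refl))
sumF-swap (suc m) n f = trans (cong (sumF n (f Fin.zero) +q_) (sumF-swap m n (f ∘ Fin.suc)))
  (sym (sumF-+ n (f Fin.zero) (λ j → sumF m (λ i → f (Fin.suc i) j))))

sumF-single : ∀ n i f → (∀ j → j ≢ i → f j ≡ 0ℚ) → sumF n f ≡ f i
sumF-single (suc n) Fin.zero f h = trans (cong (f Fin.zero +q_) (sumF-0 n (λ j → h (Fin.suc j) (λ ())))) (ℚP.+-identityʳ (f Fin.zero))
sumF-single (suc n) (Fin.suc i) f h = trans (cong₂ _+q_ (h Fin.zero (λ ())) (sumF-single n i (f ∘ Fin.suc) (λ j ne → h (Fin.suc j) (ne ∘ FinP.suc-injective))))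
  (ℚP.+-identityˡ (f (Fin.suc i)))

inverse : ∀ x → x ≢ 0ℚ → ∃ λ c → c *q x ≡ 1ℚ
inverse x nz = ℚ.1/_ x {{ℚ.≢-nonZero nz}} , ℚP.*-inverseˡ x {{ℚ.≢-nonZero nz}}

no-zero-divisors : ∀ x y → x ≢ 0ℚ → x *q y ≡ 0ℚ → y ≡ 0ℚ
no-zero-divisors x y nz eq with inverse x nz
... | c , cx = trans (sym (ℚP.*-identityˡ y)) (trans (cong (_*q y) (sym cx)) (trans (ℚP.*-assoc c x y) (trans (cong (c *q_) eq) (ℚP.*-zeroʳ c))))

-- Gaussian elimination on the first column: without a pivot the first unit vector is a solution,
-- and otherwise row `i` eliminates the first unknown from the other rows.
kernel : ∀ m (A : Fin m → Fin (suc m) → ℚ) → Σ (Fin (suc m) → ℚ) λ d → (∃ λ j → d j ≢ 0ℚ) × (∀ i → sumF (suc m) (λ j → A i j *q d j) ≡ 0ℚ)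
kernel zero A = (λ _ → 1ℚ) , (Fin.zero , λ ()) , λ ()
kernel (suc m) A with FinP.any? (λ i → ¬? (A i Fin.zero ℚ.≟ 0ℚ))
... | no none = d , (Fin.zero , λ ()) , vanish
  where
  d : Fin (suc (suc m)) → ℚ
  d Fin.zero = 1ℚ
  d (Fin.suc _) = 0ℚ
  vanish : ∀ i → sumF (suc (suc m)) (λ j → A i j *q d j) ≡ 0ℚ
  vanish i with A i Fin.zero ℚ.≟ 0ℚ
  ... | no nz = ⊥-elim (none (i , nz))
  ... | yes z = trans (cong₂ _+q_ (trans (cong (_*q 1ℚ) z) refl) (sumF-0 (suc m) (λ j → ℚP.*-zeroʳ (A i (Fin.suc j))))) refl
... | yes (i , nz) with inverse (A i Fin.zero) nz
...   | c , cx with kernel m (λ i' j → A (Fin.punchIn i i') (Fin.suc j) +q (-q (A (Fin.punchIn i i') Fin.zero *q c)) *q A i (Fin.suc j))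
...     | d' , (j , nzj) , vanish' = d , (Fin.suc j , nzj) , vanish
  where
  open +-*-Solver
  S : Fin (suc m) → ℚ
  S i' = sumF (suc m) (λ j → A i' (Fin.suc j) *q d' j)
  d : Fin (suc (suc m)) → ℚ
  -- Back substitution in the pivot row.
  d Fin.zero = -q (c *q S i)
  d (Fin.suc j) = d' j
  pivot : A i Fin.zero *q (-q (c *q S i)) +q S i ≡ 0ℚ
  pivot = trans (solve 3 (λ a c s → a :* (:- (c :* s)) :+ s := (con 1ℚ :+ :- (c :* a)) :* s) refl (A i Fin.zero) c (S i))
    (trans (cong (λ z → (1ℚ +q (-q z)) *q S i) cx) (ℚP.*-zeroˡ (S i)))
  other : ∀ i' → A (Fin.punchIn i i') Fin.zero *q (-q (c *q S i)) +q S (Fin.punchIn i i') ≡ 0ℚ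
  other i' = trans (solve 4 (λ a c s t → a :* (:- (c :* s)) :+ t := t :+ (:- (a :* c)) :* s) refl (A (Fin.punchIn i i') Fin.zero) c (S i) (S (Fin.punchIn i i')))
    (trans (cong (S (Fin.punchIn i i') +q_) (sym (sumF-* (suc m) b (λ j → A i (Fin.suc j) *q d' j))))
    (trans (sym (sumF-+ (suc m) (λ j → A (Fin.punchIn i i') (Fin.suc j) *q d' j) (λ j → b *q (A i (Fin.suc j) *q d' j))))
    (trans (sumF-cong (suc m) (λ j → solve 4 (λ a b e d → a :* d :+ b :* (e :* d) := (a :+ b :* e) :* d) refl (A (Fin.punchIn i i') (Fin.suc j)) b (A i (Fin.suc j)) (d' j)))
      (vanish' i'))))
    where b = -q (A (Fin.punchIn i i') Fin.zero *q c)
  vanish : ∀ i' → A i' Fin.zero *q d Fin.zero +q S i' ≡ 0ℚ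
  vanish i' with i FinP.≟ i'
  ... | yes refl = pivot
  ... | no i≢i' = subst (λ i' → A i' Fin.zero *q d Fin.zero +q S i' ≡ 0ℚ) (FinP.punchIn-punchOut i≢i') (other (Fin.punchOut i≢i'))

-- For a kernel vector of [-c | B], multiplying by a shows that its B-part vanishes.
square-injective : ∀ M (a B : Fin M → Fin M → ℚ) →
  (∀ i i' → i' ≢ i → sumF M (λ j → a i j *q B j i') ≡ 0ℚ) → (∀ i → sumF M (λ j → a i j *q B j i) ≢ 0ℚ) →
  ∀ (c : Fin M → ℚ) → (∀ i → sumF M (λ j → a i j *q c j) ≡ 0ℚ) → ∀ j → c j ≡ 0ℚ
square-injective M a B off diag c ac with kernel M A
  where
  A : Fin M → Fin (suc M) → ℚ
  A j Fin.zero = -q c j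
  A j (Fin.suc i) = B j i
... | d , (j₀ , nz) , vanish = λ j → no-zero-divisors (d Fin.zero) (c j) d₀≢0 (cancel j)
  where
  open +-*-Solver
  d₀ = d Fin.zero
  product : ∀ i → sumF M (λ j → a i j *q B j i) *q d (Fin.suc i) ≡ 0ℚ
  product i = begin
    sumF M (λ j → a i j *q B j i) *q d (Fin.suc i)
      ≡⟨ sumF-single M i (λ i' → sumF M (λ j → a i j *q B j i') *q d (Fin.suc i')) (λ i' ne → trans (cong (_*q d (Fin.suc i')) (off i i' ne)) (ℚP.*-zeroˡ (d (Fin.suc i')))) ⟨
    sumF M (λ i' → sumF M (λ j → a i j *q B j i') *q d (Fin.suc i'))
      ≡⟨ sumF-cong M (λ i' → trans (ℚP.*-comm (sumF M (λ j → a i j *q B j i')) (d (Fin.suc i'))) (sym (sumF-* M (d (Fin.suc i')) (λ j → a i j *q B j i')))) ⟩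
    sumF M (λ i' → sumF M (λ j → d (Fin.suc i') *q (a i j *q B j i')))
      ≡⟨ sumF-swap M M (λ i' j → d (Fin.suc i') *q (a i j *q B j i')) ⟩
    sumF M (λ j → sumF M (λ i' → d (Fin.suc i') *q (a i j *q B j i')))
      ≡⟨ sumF-cong M (λ j → trans (sumF-cong M (λ i' → solve 3 (λ d a b → d :* (a :* b) := a :* (b :* d)) refl (d (Fin.suc i')) (a i j) (B j i'))) (sumF-* M (a i j) (λ i' → B j i' *q d (Fin.suc i')))) ⟩
    sumF M (λ j → a i j *q sumF M (λ i' → B j i' *q d (Fin.suc i')))
      ≡⟨ sumF-cong M (λ j → trans (cong (a i j *q_) (solve' j)) (solve 3 (λ a c d → a :* (d :* c) := d :* (a :* c)) refl (a i j) (c j) d₀)) ⟩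
    sumF M (λ j → d₀ *q (a i j *q c j))
      ≡⟨ sumF-* M d₀ (λ j → a i j *q c j) ⟩
    d₀ *q sumF M (λ j → a i j *q c j)
      ≡⟨ trans (cong (d₀ *q_) (ac i)) (ℚP.*-zeroʳ d₀) ⟩
    0ℚ ∎
    where
    open ≡-Reasoning
    solve' : ∀ j → sumF M (λ i' → B j i' *q d (Fin.suc i')) ≡ d₀ *q c j
    solve' j = trans (solve 3 (λ s c d → s := ((:- c) :* d :+ s) :+ d :* c) refl (sumF M (λ i' → B j i' *q d (Fin.suc i'))) (c j) d₀)
      (trans (cong (_+q d₀ *q c j) (vanish j)) (ℚP.+-identityˡ (d₀ *q c j)))
  dᵢ≡0 : ∀ i → d (Fin.suc i) ≡ 0ℚ
  dᵢ≡0 i = no-zero-divisors (sumF M (λ j → a i j *q B j i)) (d (Fin.suc i)) (diag i) (product i)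
  -- The other entries vanish, so the entry that makes the kernel vector nonzero can only be this
  -- one.
  d₀≢0 : d₀ ≢ 0ℚ
  d₀≢0 z = nz (zero-all j₀)
    where
    zero-all : ∀ j → d j ≡ 0ℚ
    zero-all Fin.zero = z
    zero-all (Fin.suc i) = dᵢ≡0 i
  cancel : ∀ j → d₀ *q c j ≡ 0ℚ
  cancel j = trans (solve 3 (λ d c s → d :* c := :- ((:- c) :* d :+ s) :+ s) refl d₀ (c j) (sumF M (λ i' → B j i' *q d (Fin.suc i'))))
    (trans (cong₂ (λ x y → -q x +q y) (vanish j) (sumF-0 M (λ i' → trans (cong (B j i' *q_) (dᵢ≡0 i')) (ℚP.*-zeroʳ (B j i'))))) refl)

table : {X : Set} → (X → ℚ) → List X → Free X
table g = map (λ x → (g x , x))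

lin-table : ∀ {X : Set} (f g : X → ℚ) xs → lin f (table g xs) ≡ sumF (length xs) (λ j → f (List.lookup xs j) *q g (List.lookup xs j))
lin-table f g [] = refl
lin-table f g (x ∷ xs) = cong₂ _+q_ (ℚP.*-comm (g x) (f x)) (lin-table f g xs)

module Tables {X : Set} (_≟_ : DecidableEquality X) where
  open Decidable _≟_

  coeff-table-∉ : ∀ g xs {x} → ¬ (x ∈ xs) → coeff _≟_ (table g xs) x ≡ 0ℚ
  coeff-table-∉ g [] x∉ = refl
  coeff-table-∉ g (y ∷ xs) {x} x∉ with y ≟ x
  ... | yes refl = ⊥-elim (x∉ (here refl))
  ... | no _ = coeff-table-∉ g xs (x∉ ∘ there)

  coeff-table-∈ : ∀ g {xs} → Unique xs → ∀ {x} → x ∈ xs → coeff _≟_ (table g xs) x ≡ g x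
  coeff-table-∈ g {y ∷ xs} (y∉ AllPairs.∷ u) {x} x∈ with y ≟ x
  ... | yes refl = trans (cong (g y +q_) (coeff-table-∉ g xs (λ y∈ → All.lookup y∉ y∈ refl))) (ℚP.+-identityʳ (g y))
  coeff-table-∈ g {y ∷ xs} (y∉ AllPairs.∷ u) {x} (here refl) | no ne = ⊥-elim (ne refl)
  coeff-table-∈ g {y ∷ xs} (y∉ AllPairs.∷ u) {x} (there x∈) | no ne = coeff-table-∈ g u x∈

lookup-injective : ∀ {A : Set} {xs : List A} → Unique xs → ∀ i j → List.lookup xs i ≡ List.lookup xs j → i ≡ j
lookup-injective (x∉ AllPairs.∷ u) Fin.zero Fin.zero eq = refl
lookup-injective {xs = x ∷ xs} (x∉ AllPairs.∷ u) Fin.zero (Fin.suc j) eq = ⊥-elim (All.lookup x∉ (MemP.∈-lookup {xs = xs} j) eq)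
lookup-injective {xs = x ∷ xs} (x∉ AllPairs.∷ u) (Fin.suc i) Fin.zero eq = ⊥-elim (All.lookup x∉ (MemP.∈-lookup {xs = xs} i) (sym eq))
lookup-injective (x∉ AllPairs.∷ u) (Fin.suc i) (Fin.suc j) eq = cong Fin.suc (lookup-injective u i j eq)

-- Linear independence modulo J

All-degree< : ∀ {n} (p : Poly n) → ∃ λ d → All (λ t → degree (proj₂ t) < d) p
All-degree< [] = 0 , []
All-degree< ((c , m) ∷ p) with All-degree< p
... | d , a = suc (degree m) ℕ.⊔ d , ℕP.m≤m⊔n (suc (degree m)) d ∷ All.map (λ lt → ℕP.<-≤-trans lt (ℕP.m≤n⊔m (suc (degree m)) d)) a

lin-split : ∀ {n} (f : Monomial n → ℚ) d p → All (λ t → degree (proj₂ t) < suc d) p →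
  lin f p ≡ lin f (component d p) +q lin f (select (_< d) (ℕ._<? d) p)
lin-split f d [] [] = refl
lin-split f d ((c , m) ∷ p) (s≤s le ∷ a) = go (degree m ℕ.≟ d)
  where
  open +-*-Solver
  low = select (_< d) (ℕ._<? d)
  go : Dec (degree m ≡ d) → lin f ((c , m) ∷ p) ≡ lin f (component d ((c , m) ∷ p)) +q lin f (low ((c , m) ∷ p))
  go (yes eq) = trans (cong (c *q f m +q_) (lin-split f d p a))
    (trans (sym (ℚP.+-assoc (c *q f m) (lin f (component d p)) (lin f (low p))))
    (sym (cong₂ (λ x y → lin f x +q lin f y) (ListP.filter-accept (λ t → degree (proj₂ t) ℕ.≟ d) {x = (c , m)} {xs = p} eq)
      (ListP.filter-reject (λ t → degree (proj₂ t) ℕ.<? d) {x = (c , m)} {xs = p} (ℕP.<-irrefl eq)))))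
  go (no ne) = trans (cong (c *q f m +q_) (lin-split f d p a))
    (trans (solve 3 (λ x y z → x :+ (y :+ z) := y :+ (x :+ z)) refl (c *q f m) (lin f (component d p)) (lin f (low p)))
    (sym (cong₂ (λ x y → lin f x +q lin f y) (ListP.filter-reject (λ t → degree (proj₂ t) ℕ.≟ d) {x = (c , m)} {xs = p} ne)
      (ListP.filter-accept (λ t → degree (proj₂ t) ℕ.<? d) {x = (c , m)} {xs = p} (ℕP.≤∧≢⇒< le ne)))))

prodP : ∀ {n} → List (Poly n) → Poly n
prodP [] = oneP
prodP (p ∷ ps) = p *ₚ prodP ps

eval-prodP : ∀ {n} (a : Fin n → ℚ) ps → eval a (prodP ps) ≡ prodL (map (eval a) ps)
eval-prodP a [] = eval-1 a
eval-prodP a (p ∷ ps) = trans (eval-* a p (prodP ps)) (cong (eval a p *q_) (eval-prodP a ps))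

prodL-zero : ∀ {xs} → 0ℚ ∈ xs → prodL xs ≡ 0ℚ
prodL-zero {x ∷ xs} (here refl) = ℚP.*-zeroˡ (prodL xs)
prodL-zero {x ∷ xs} (there z∈) = trans (cong (x *q_) (prodL-zero z∈)) (ℚP.*-zeroʳ x)

prodL-nonzero : ∀ {xs} → All (_≢ 0ℚ) xs → prodL xs ≢ 0ℚ
prodL-nonzero [] = λ ()
prodL-nonzero {x ∷ xs} (nz ∷ nzs) z = prodL-nonzero nzs (no-zero-divisors x (prodL xs) nz z)

-- Lagrange interpolation: a product of factors x_p - y_b over all wrong choices of a block,
-- vanishing at every word except `w₀`. It is not scaled to 1 at `w₀`, since nonzero is enough for
-- the diagonal in `square-injective`.
module Separator {n k : ℕ} (w₀ : Vec (Fin k) n) where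

  factor : Fin n × Fin k → Poly n
  factor (p , b) = var p -ₚ const (coordinate b)

  eval-factor : ∀ (w : Vec (Fin k) n) p b → eval (point w) (factor (p , b)) ≡ coordinate (lookup w p) +q (-q coordinate b)
  eval-factor w p b = trans (eval-+ (point w) (var p) (negP (const (coordinate b)))) (cong₂ _+q_ (eval-var (point w) p)
    (trans (eval-neg (point w) (const (coordinate b))) (cong -q_ (eval-const (point w) (coordinate b)))))

  Wrong? : Decidable {A = Fin n × Fin k} (λ pb → proj₂ pb ≢ lookup w₀ (proj₁ pb))
  Wrong? (p , b) = ¬? (b FinP.≟ lookup w₀ p)

  wrong : List (Fin n × Fin k)
  wrong = List.filter Wrong? (List.cartesianProduct (allFin n) (allFin k))

  separator : Poly n
  separator = prodP (map factor wrong)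

  value : ∀ (w : Vec (Fin k) n) → eval (point w) separator ≡ prodL (map (eval (point w) ∘ factor) wrong)
  value w = trans (eval-prodP (point w) (map factor wrong)) (cong prodL (sym (ListP.map-∘ wrong)))

  separator-≢ : ∀ (w : Vec (Fin k) n) → w ≢ w₀ → eval (point w) separator ≡ 0ℚ
  separator-≢ w ne = trans (value w) (prodL-zero (vanishing (FinP.any? (λ p → ¬? (lookup w p FinP.≟ lookup w₀ p)))))
    where
    vanishing : Dec (∃ λ p → lookup w p ≢ lookup w₀ p) → 0ℚ ∈ map (eval (point w) ∘ factor) wrong
    vanishing (yes (p , np)) = subst (_∈ map (eval (point w) ∘ factor) wrong) (trans (eval-factor w p (lookup w p)) (ℚP.+-inverseʳ (coordinate (lookup w p))))
      (MemP.∈-map⁺ (eval (point w) ∘ factor) (MemP.∈-filter⁺ Wrong? (MemP.∈-cartesianProduct⁺ (MemP.∈-allFin p) (MemP.∈-allFin (lookup w p))) np))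
    vanishing (no all) = ⊥-elim (ne (trans (sym (VecP.tabulate∘lookup w)) (trans (VecP.tabulate-cong same) (VecP.tabulate∘lookup w₀))))
      where
      same : ∀ p → lookup w p ≡ lookup w₀ p
      same p with lookup w p FinP.≟ lookup w₀ p
      ... | yes eq = eq
      ... | no np = ⊥-elim (all (p , np))

  separator-nonzero : eval (point w₀) separator ≢ 0ℚ
  separator-nonzero z = prodL-nonzero (AllP.map⁺ (All.map (λ { {p , b} → nonzero p b }) (AllP.all-filter Wrong? (List.cartesianProduct (allFin n) (allFin k))))) (trans (sym (value w₀)) z)
    where
    nonzero : ∀ p b → b ≢ lookup w₀ p → eval (point w₀) (factor (p , b)) ≢ 0ℚ
    nonzero p b ne z = ne (sym (coordinate-injective (MonoD.minus-zero {n} (coordinate (lookup w₀ p)) (coordinate b) (trans (sym (eval-factor w₀ p b)) z))))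

module MonoT {n : ℕ} = Tables (_≟ₘ_ {n})

module Independence {r} (k : ℕ) (α : Vec ℕ r) (0<k : 0 < k) (k≤n : k ≤ Vec.sum α)
  (α-bounds : ∀ i → (1 ≤ lookup α i) × (lookup α i ≤ k)) where

  open Evaluation k α 0<k k≤n α-bounds public

  M : ℕ
  M = length acceptedList

  monomial : Fin M → Monomial n
  monomial = List.lookup acceptedList

  monomial-accepted : ∀ j → Accepted (monomial j)
  monomial-accepted j = ∈-accepted⁻ (MemP.∈-lookup {xs = acceptedList} j)

  wordAt : Fin M → Vec (Fin k) n
  wordAt j = word (monomial-accepted j)

  wordAt-injective : ∀ i j → wordAt i ≡ wordAt j → i ≡ j
  wordAt-injective i j eq = lookup-injective acceptedList-unique i j (word-injective (monomial-accepted i) (monomial-accepted j) eq)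

  expansion : ∀ (f : Monomial n → ℚ) q → All (Accepted ∘ proj₂) q → lin f q ≡ sumF M (λ j → f (monomial j) *q coeffP q (monomial j))
  expansion f q a = trans (lin-≋ f {q} {table (coeffP q) acceptedList} (mk≋ agree)) (lin-table f (coeffP q) acceptedList)
    where
    agree : ∀ m → coeffP q m ≡ coeffP (table (coeffP q) acceptedList) m
    agree m with Accepted? m
    ... | yes acc = sym (MonoT.coeff-table-∈ (coeffP q) acceptedList-unique (∈-accepted⁺ acc))
    ... | no ¬acc = trans (MonoD.coeff-∉ {P = Accepted} q a ¬acc) (sym (MonoT.coeff-table-∉ (coeffP q) acceptedList (¬acc ∘ ∈-accepted⁻)))

  -- The hypothesis `leading` says that Φ is evaluation up to lower degree. It is the common feature
  -- of evaluation itself and of the average over the group, so one argument serves both.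
  module Span (Φ : Vec (Fin k) n → Monomial n → ℚ)
    (leading : ∀ d p → All (λ t → degree (proj₂ t) ≡ d) p → Lower d (λ w → lin (Φ w) p +q (-q ev w p))) where

    record Preimage (d : ℕ) (p : Poly n) : Set where
      constructor preimage
      field
        poly : Poly n
        poly-accepted : All (Accepted ∘ proj₂) poly
        poly-< : All (λ t → degree (proj₂ t) < d) poly
        hits : ∀ w → IsOP α w → lin (Φ w) poly ≡ ev w p

    -- Induction on the degree. The top component is replaced by its normal form `q`; both the
    -- change of its evaluation and the gap between Φ and evaluation on `q` are evaluations of
    -- polynomials of lower degree, which join the remaining part.
    findPreimage : ∀ d p → All (λ t → degree (proj₂ t) < d) p → Preimage d p
    findPreimage zero [] [] = preimage [] [] [] (λ w _ → refl)
    findPreimage (suc d) p a = step (leading d q (N̂-degree (_≡ d) top (All-component d p))) (J-lower d (N̂-≡ top))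
      where
      open +-*-Solver
      top = component d p
      low = select (_< d) (ℕ._<? d) p
      q = N̂ top
      difference : ∀ w → ev w (component d (top -ₚ q)) ≡ ev w top +q (-q ev w q)
      difference w = trans (cong (ev w) (component-all d (AllP.++⁺ (All-component d p) (All-scale {P = λ m → degree m ≡ d} (-q 1ℚ) (N̂-degree (_≡ d) top (All-component d p))))))
        (MonoD.lin-minus (evalM (point w)) top q)
      step : Lower d (λ w → lin (Φ w) q +q (-q ev w q)) → Lower d (λ w → ev w (component d (top -ₚ q))) → Preimage (suc d) p
      step (mkLower r₁ (supp R₁ a₁ e₁) eq₁) (mkLower r₂ (supp R₂ a₂ e₂) eq₂) =
        finish (findPreimage d rest (AllP.++⁺ (AllP.all-filter (λ t → degree (proj₂ t) ℕ.<? d) p) (AllP.++⁺ (All-scale {P = λ m → degree m < d} (-q 1ℚ) a₁) a₂)))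
        where
        -- On OP, `R₁` is Φ minus evaluation at `q` and `R₂` is the evaluation of the top component
        -- minus that of `q`; hence the signs.
        rest = low ++ (negP R₁ ++ R₂)
        finish : Preimage d rest → Preimage (suc d) p
        finish (preimage s sA s< hit) = preimage (q ++ s) (AllP.++⁺ (N̂-accepted top) sA)
          (AllP.++⁺ (All.map (λ eq → s≤s (ℕP.≤-reflexive eq)) (N̂-degree (_≡ d) top (All-component d p))) (All.map ℕP.m≤n⇒m≤1+n s<))
          λ w op → begin
            lin (Φ w) (q ++ s) ≡⟨ lin-++ (Φ w) q s ⟩
            lin (Φ w) q +q lin (Φ w) s ≡⟨ cong (lin (Φ w) q +q_) (hit w op) ⟩
            lin (Φ w) q +q ev w rest
              ≡⟨ cong (lin (Φ w) q +q_) (trans (eval-+ (point w) low (negP R₁ ++ R₂)) (cong (ev w low +q_) (trans (eval-+ (point w) (negP R₁) R₂)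
                   (cong₂ _+q_ (trans (eval-neg (point w) R₁) (cong -q_ (trans (sym (lin-≋ (evalM (point w)) e₁)) (sym (eq₁ w op)))))
                     (trans (sym (lin-≋ (evalM (point w)) e₂)) (trans (sym (eq₂ w op)) (difference w))))))) ⟩
            lin (Φ w) q +q (ev w low +q ((-q (lin (Φ w) q +q (-q ev w q))) +q (ev w top +q (-q ev w q))))
              ≡⟨ solve 4 (λ f l e t → f :+ (l :+ ((:- (f :+ :- e)) :+ (t :+ :- e))) := t :+ l) refl (lin (Φ w) q) (ev w low) (ev w q) (ev w top) ⟩
            ev w top +q ev w low ≡⟨ lin-split (evalM (point w)) d p a ⟨
            ev w p ∎
          where open ≡-Reasoning

    dual : (w₀ : Vec (Fin k) n) → ∃ λ d → Preimage d (Separator.separator w₀)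
    dual w₀ = let d , a = All-degree< (Separator.separator w₀) in d , findPreimage d (Separator.separator w₀) a

    -- Restricting to the words of the accepted monomials makes the matrix of Φ square. Its right
    -- inverse consists of preimages of the separators: since these words are distinct, the product
    -- is diagonal with nonzero entries.
    independent : ∀ q → All (Accepted ∘ proj₂) q → (∀ w → IsOP α w → lin (Φ w) q ≡ 0ℚ) → q ≋ zeroP
    independent q qA vanish = mk≋ λ m → zeroAt m (Accepted? m)
      where
      matrix : Fin M → Fin M → ℚ
      matrix i j = Φ (wordAt i) (monomial j)
      rightInverse : Fin M → Fin M → ℚ
      rightInverse j i = coeffP (Preimage.poly (proj₂ (dual (wordAt i)))) (monomial j)
      entry : ∀ i i' → sumF M (λ j → matrix i j *q rightInverse j i') ≡ ev (wordAt i) (Separator.separator (wordAt i'))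
      entry i i' = trans (sym (expansion (Φ (wordAt i)) (Preimage.poly (proj₂ (dual (wordAt i')))) (Preimage.poly-accepted (proj₂ (dual (wordAt i'))))))
        (Preimage.hits (proj₂ (dual (wordAt i'))) (wordAt i) (word-OP (monomial-accepted i)))
      coefficients : ∀ j → coeffP q (monomial j) ≡ 0ℚ
      coefficients = square-injective M matrix rightInverse
        (λ i i' ne → trans (entry i i') (Separator.separator-≢ (wordAt i') (wordAt i) (λ eq → ne (wordAt-injective i' i (sym eq)))))
        (λ i z → Separator.separator-nonzero (wordAt i) (trans (sym (entry i i)) z))
        (λ j → coeffP q (monomial j))
        (λ i → trans (sym (expansion (Φ (wordAt i)) q qA)) (vanish (wordAt i) (word-OP (monomial-accepted i))))
      zeroAt : ∀ m → Dec (Accepted m) → coeffP q m ≡ 0ℚ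
      zeroAt m (no ¬acc) = MonoD.coeff-∉ {P = Accepted} q qA ¬acc
      zeroAt m (yes acc) = let m∈ = ∈-accepted⁺ acc in
        subst (λ x → coeffP q x ≡ 0ℚ) (sym (AnyP.lookup-index m∈)) (coefficients (Any.index m∈))

  module EvalSpan = Span (λ w → evalM (point w)) (λ d p _ → mkLower zeroP Supp-0 (λ w _ → ℚP.+-inverseʳ (ev w p)))

  coeff-component : ∀ (q : Poly n) m → coeffP (component (degree m) q) m ≡ coeffP q m
  coeff-component q m = trans (MonoD.coeff-lin (component (degree m) q) m) (trans (lin-component (MonoD.δ m) (degree m) q)
    (trans (lin-cong same q) (sym (MonoD.coeff-lin q m))))
    where
    same : ∀ m' → atDegree (degree m) (MonoD.δ m) m' ≡ MonoD.δ m m'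
    same m' with degree m' ℕ.≟ degree m
    ... | yes _ = refl
    ... | no ne = sym (MonoD.δ-≢ {x = m} {y = m'} (λ { refl → ne refl }))

  -- On OP the component of `q` in degree d agrees with a polynomial of lower degree, hence with an
  -- accepted combination `s` of degree below d. Independence of the evaluations makes it equal to
  -- `s`, which has no coefficients in degree d.
  accepted∈J⇒0 : ∀ q → All (Accepted ∘ proj₂) q → InJ q → q ≋ zeroP
  accepted∈J⇒0 q qA q∈J = mk≋ λ m → trans (sym (coeff-component q m)) (vanish m (J-lower (degree m) q∈J))
    where
    vanish : ∀ m → Lower (degree m) (λ w → ev w (component (degree m) q)) → coeffP (component (degree m) q) m ≡ 0ℚ
    vanish m (mkLower r (supp R R< e) eq) = finish (EvalSpan.findPreimage (degree m) R R<)
      where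
      d = degree m
      finish : EvalSpan.Preimage d R → coeffP (component d q) m ≡ 0ℚ
      finish (EvalSpan.preimage s sA s< hit) = trans
        (MonoD.minus-zero {n} (coeffP (component d q) m) (coeffP s m)
          (trans (sym (trans (MonoD.coeff-lin (component d q -ₚ s) m) (trans (MonoD.lin-minus (MonoD.δ m) (component d q) s)
            (cong₂ (λ x y → x +q (-q y)) (sym (MonoD.coeff-lin (component d q) m)) (sym (MonoD.coeff-lin s m))))))
          (coeffs (EvalSpan.independent (component d q -ₚ s)
            (AllP.++⁺ (AllP.filter⁺ (λ t → degree (proj₂ t) ℕ.≟ d) qA) (All-scale {P = Accepted} (-q 1ℚ) sA))
            (λ w op → trans (MonoD.lin-minus (evalM (point w)) (component d q) s)
              (trans (cong₂ (λ x y → x +q (-q y)) (trans (eq w op) (lin-≋ (evalM (point w)) e)) (hit w op)) (ℚP.+-inverseʳ (ev w R))))) m)))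
        (MonoD.coeff-∉ {P = λ m' → degree m' < d} s s< (ℕP.<-irrefl refl))

  N̂-J : ∀ {p} → InJ p → N̂ p ≋ zeroP
  N̂-J {p} p∈ = accepted∈J⇒0 (N̂ p) (N̂-accepted p) (ideal-≈ (PolySym.solve 2 (λ p q → p :+ :- (p :+ :- q) := q) ≋-refl p (N̂ p)) (ideal-+ p∈ (ideal-neg (N̂-≡ p))))
    where open PolySym using (_:+_; :-_; _:=_)

  Nonskip-∣ₘ : ∀ {m m' : Monomial n} → m' ∣ₘ m → Nonskip k α m → Nonskip k α m'
  Nonskip-∣ₘ {m} {m'} d (noStar , noPower) = (λ S size d' → noStar S size (λ i → ℕP.≤-trans (d' i) (d i))) ,
    λ i j 1≤j j≤ le → noPower i j 1≤j j≤ (ℕP.≤-trans le (expAt-∣ₘ m' m d ((offset α i + j) ∸ 1)))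
    where
    expAt-∣ₘ : ∀ {l} (a b : Monomial l) → a ∣ₘ b → ∀ p → expAt a p ≤ expAt b p
    expAt-∣ₘ [] [] d p = z≤n
    expAt-∣ₘ (x ∷ a) (y ∷ b) d zero = d Fin.zero
    expAt-∣ₘ (x ∷ a) (y ∷ b) d (suc p) = expAt-∣ₘ a b (d ∘ Fin.suc) p

  -- If p in J had a leading monomial m' dividing m, then m' would be nonskip and its own normal
  -- form. Smaller monomials have normal forms below m', so `N̂ p` would keep the nonzero
  -- coefficient at m', although `N̂` kills J.
  Nonskip⇒Standard : ∀ {m} → Nonskip k α m → Standard J m
  Nonskip⇒Standard {m} ns (p , m' , p∈ , (nz , lead) , d) = nz (trans (sym same) (coeffs (N̂-J {p} (member p∈)) m'))
    where
    acc : Accepted m'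
    acc = Nonskip⇒Accepted (Nonskip-∣ₘ {m} {m'} d ns)
    agree : ∀ x → coeffP p x ≢ 0ℚ → lin (MonoD.δ m') (N x) ≡ MonoD.δ m' x
    agree x nzx = go (lead x nzx)
      where
      go : x ≤nl m' → lin (MonoD.δ m') (N x) ≡ MonoD.δ m' x
      go (inj₁ refl) = trans (cong (lin (MonoD.δ m')) (N-accepted acc)) (trans (lin-single (MonoD.δ m') 1ℚ m') (ℚP.*-identityˡ (MonoD.δ m' m')))
      go (inj₂ x<m') = trans (sym (MonoD.coeff-lin (N x) m'))
        (trans (MonoD.coeff-∉ {P = Below x} (N x) (NF.form-Below (normal x)) λ { (_ , _ , inj₁ refl) → <nl-irrefl x<m' ; (_ , _ , inj₂ m'<x) → <nl-irrefl (<nl-trans m'<x x<m') })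
          (sym (MonoD.δ-≢ {x = m'} {y = x} (λ { refl → <nl-irrefl {a = x} x<m' }))))
    same : coeffP (N̂ p) m' ≡ coeffP p m'
    same = trans (MonoD.coeff-lin (N̂ p) m') (trans (lin-bind N (MonoD.δ m') p) (trans (MonoD.lin-agree (λ x → lin (MonoD.δ m') (N x)) (MonoD.δ m') p agree) (sym (MonoD.coeff-lin p m'))))

-- The equivariant isomorphism

sumL : {A : Set} → List A → (A → ℚ) → ℚ
sumL [] f = 0ℚ
sumL (x ∷ xs) f = f x +q sumL xs f

sumL-cong : ∀ {A : Set} {xs : List A} {f g} → All (λ x → f x ≡ g x) xs → sumL xs f ≡ sumL xs g
sumL-cong [] = refl
sumL-cong (e ∷ es) = cong₂ _+q_ e (sumL-cong es)

sumL-0 : ∀ {A : Set} (xs : List A) → sumL xs (λ _ → 0ℚ) ≡ 0ℚ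
sumL-0 [] = refl
sumL-0 (x ∷ xs) = trans (ℚP.+-identityˡ (sumL xs (λ _ → 0ℚ))) (sumL-0 xs)

sumL-↭ : ∀ {A : Set} {xs ys : List A} f → xs ↭ ys → sumL xs f ≡ sumL ys f
sumL-↭ f Perm.refl = refl
sumL-↭ f (Perm.prep x p) = cong (f x +q_) (sumL-↭ f p)
sumL-↭ f (Perm.swap {xs} {ys} x y p) = trans (cong (λ z → f x +q (f y +q z)) (sumL-↭ f p))
  (solve 3 (λ x y z → x :+ (y :+ z) := y :+ (x :+ z)) refl (f x) (f y) (sumL ys f))
  where open +-*-Solver
sumL-↭ f (Perm.trans p q) = trans (sumL-↭ f p) (sumL-↭ f q)

sumL-map : ∀ {A B : Set} (g : A → B) f xs → sumL (map g xs) f ≡ sumL xs (f ∘ g)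
sumL-map g f [] = refl
sumL-map g f (x ∷ xs) = cong (f (g x) +q_) (sumL-map g f xs)

lin-sumL : ∀ {A X : Set} (xs : List A) (F : A → X → ℚ) p → lin (λ m → sumL xs (λ u → F u m)) p ≡ sumL xs (λ u → lin (F u) p)
lin-sumL [] F p = lin-0 p
lin-sumL (u ∷ xs) F p = trans (lin-+ (F u) (λ m → sumL xs (λ u → F u m)) p) (cong (lin (F u) p +q_) (lin-sumL xs F p))

count : {A : Set} → List A → ℚ
count xs = sumL xs (λ _ → 1ℚ)

count-nonNegative : ∀ {A : Set} (xs : List A) → 0ℚ ℚ.≤ count xs
count-nonNegative [] = ℚP.≤-refl
count-nonNegative (x ∷ xs) = ℚP.+-mono-≤ {0ℚ} {1ℚ} {0ℚ} {count xs} (ℚP.nonNegative⁻¹ 1ℚ) (count-nonNegative xs)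

count-≢0 : ∀ {A : Set} {x : A} {xs} → x ∈ xs → count xs ≢ 0ℚ
count-≢0 {xs = x ∷ xs} _ eq = ℚP.<-irrefl (sym eq) (ℚP.+-mono-<-≤ {0ℚ} {1ℚ} {0ℚ} {count xs} (ℚP.positive⁻¹ 1ℚ) (count-nonNegative xs))

-- Permutations acting on exponent vectors and on words

pull : ∀ {A : Set} {n} → Vec (Fin n) n → Vec A n → Vec A n
pull u v = tabulate (λ q → lookup v (lookup u q))

lookup-pull : ∀ {A : Set} {n} u (v : Vec A n) q → lookup (pull u v) q ≡ lookup v (lookup u q)
lookup-pull u v q = VecP.lookup∘tabulate _ q

lookup-ext : ∀ {A : Set} {n} {v w : Vec A n} → (∀ q → lookup v q ≡ lookup w q) → v ≡ w
lookup-ext {v = v} {w} eq = trans (sym (VecP.tabulate∘lookup v)) (trans (VecP.tabulate-cong eq) (VecP.tabulate∘lookup w))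

pull-pull : ∀ {A : Set} {n} u s (v : Vec A n) → pull u (pull s v) ≡ pull (pull u s) v
pull-pull u s v = VecP.tabulate-cong λ q → trans (lookup-pull s v (lookup u q)) (cong (lookup v) (sym (lookup-pull u s q)))

Inverse : ∀ {n} → Vec (Fin n) n → Vec (Fin n) n → Set
Inverse u u' = ∀ q → lookup u (lookup u' q) ≡ q

pull-inverse : ∀ {A : Set} {n} {u s : Vec (Fin n) n} (v : Vec A n) → Inverse s u → pull u (pull s v) ≡ v
pull-inverse {u = u} {s} v inv = lookup-ext λ q → trans (lookup-pull u (pull s v) q) (trans (lookup-pull s v (lookup u q)) (cong (lookup v) (inv q)))

pullP : ∀ {n} → Vec (Fin n) n → Poly n → Poly n
pullP u = map (λ t → (proj₁ t , pull u (proj₂ t)))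

pull-⊕ : ∀ {n} u (a b : Monomial n) → pull u (a ⊕ b) ≡ pull u a ⊕ pull u b
pull-⊕ u a b = lookup-ext λ q → trans (lookup-pull u (a ⊕ b) q) (trans (VecP.lookup-zipWith _+_ (lookup u q) a b)
  (sym (trans (VecP.lookup-zipWith _+_ q (pull u a) (pull u b)) (cong₂ _+_ (lookup-pull u a q) (lookup-pull u b q)))))

module _ {n} (u u' : Vec (Fin n) n) (uu' : Inverse u u') (u'u : Inverse u' u) where

  pullP-≋ : ∀ {p q} → p ≋ q → pullP u p ≋ pullP u q
  pullP-≋ {p} {q} e = ≋-lin λ f → trans (lin-map (pull u) f p) (trans (lin-≋ (f ∘ pull u) e) (sym (lin-map (pull u) f q)))

  pullP-+ : ∀ p q → pullP u (p +ₚ q) ≋ (pullP u p +ₚ pullP u q)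
  pullP-+ p q = ≋-reflexive (ListP.map-++ _ p q)

  pullP-* : ∀ p q → pullP u (p *ₚ q) ≋ (pullP u p *ₚ pullP u q)
  pullP-* p q = ≋-lin λ f → begin
    lin f (pullP u (p *ₚ q))                                   ≡⟨ lin-map (pull u) f (p *ₚ q) ⟩
    lin (f ∘ pull u) (p *ₚ q)                                  ≡⟨ lin-mul (f ∘ pull u) p q ⟩
    lin (λ a → lin (λ b → f (pull u (a ⊕ b))) q) p             ≡⟨ lin-cong (λ a → lin-cong (λ b → cong f (pull-⊕ u a b)) q) p ⟩
    lin (λ a → lin (λ b → f (pull u a ⊕ pull u b)) q) p        ≡⟨ lin-cong (λ a → lin-map (pull u) (λ b → f (pull u a ⊕ b)) q) p ⟨
    lin (λ a → lin (λ b → f (pull u a ⊕ b)) (pullP u q)) p     ≡⟨ lin-map (pull u) (λ a → lin (λ b → f (a ⊕ b)) (pullP u q)) p ⟨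
    lin (λ a → lin (λ b → f (a ⊕ b)) (pullP u q)) (pullP u p)  ≡⟨ lin-mul f (pullP u p) (pullP u q) ⟨
    lin f (pullP u p *ₚ pullP u q)                             ∎
    where open ≡-Reasoning

  pullP-1 : pullP u oneP ≋ oneP
  pullP-1 = ≋-reflexive (cong mono (lookup-ext λ q → trans (lookup-pull u one q) (trans (VecP.lookup-replicate (lookup u q) 0) (sym (VecP.lookup-replicate q 0)))))

  pullP-var : ∀ i → pullP u (var i) ≡ var (lookup u' i)
  pullP-var i = cong mono (VecP.tabulate-cong λ q → trans (VecP.lookup∘tabulate _ (lookup u q)) (cong (λ b → if b then 1 else 0) (test q (q FinP.≟ lookup u' i))))
    where
    ≡ᵇ-refl : ∀ a → (a ℕ.≡ᵇ a) ≡ true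
    ≡ᵇ-refl zero = refl
    ≡ᵇ-refl (suc a) = ≡ᵇ-refl a
    ≡ᵇ-≢ : ∀ a b → a ≢ b → (a ℕ.≡ᵇ b) ≡ false
    ≡ᵇ-≢ zero zero ne = ⊥-elim (ne refl)
    ≡ᵇ-≢ zero (suc b) ne = refl
    ≡ᵇ-≢ (suc a) zero ne = refl
    ≡ᵇ-≢ (suc a) (suc b) ne = ≡ᵇ-≢ a b (ne ∘ cong suc)
    test : ∀ q → Dec (q ≡ lookup u' i) → (toℕ (lookup u q) ℕ.≡ᵇ toℕ i) ≡ (toℕ q ℕ.≡ᵇ toℕ (lookup u' i))
    test q (yes refl) = trans (cong (λ x → toℕ x ℕ.≡ᵇ toℕ i) (uu' i)) (trans (≡ᵇ-refl (toℕ i)) (sym (≡ᵇ-refl (toℕ (lookup u' i)))))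
    test q (no ne) = trans (≡ᵇ-≢ _ _ (λ eq → ne (trans (sym (u'u q)) (cong (lookup u') (FinP.toℕ-injective eq))))) (sym (≡ᵇ-≢ _ _ (ne ∘ FinP.toℕ-injective)))

  module HP = Homomorphism (polyRing n) (polyAlgebra n) (polyRing n) (polyAlgebra n)

  pullP-vars : ∀ is → map (pullP u) (vars is) ≡ vars (map (lookup u') is)
  pullP-vars is = trans (sym (ListP.map-∘ is)) (trans (ListP.map-cong pullP-var is) (ListP.map-∘ is))

  pullP-esym : ∀ is → map (lookup u') is ↭ is → ∀ d → pullP u (esym is d) ≋ esym is d
  pullP-esym is p d = ≋-trans (≋-reflexive (cong (pullP u) (esym-e is d)))
    (≋-trans (HP.hom-e (pullP u) pullP-+ pullP-* ≋-refl pullP-1 (vars is) d)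
    (≋-trans (≋-reflexive (cong (λ xs → PolySym.e xs d) (pullP-vars is)))
    (≋-trans (PolySym.e-↭ (PermP.map⁺ var p) d) (≋-reflexive (sym (esym-e is d))))))

  pullP-hsym : ∀ is → map (lookup u') is ↭ is → ∀ d → pullP u (hsym is d) ≋ hsym is d
  pullP-hsym is p d = ≋-trans (≋-reflexive (cong (pullP u) (hsym-h is d)))
    (≋-trans (HP.hom-h (pullP u) pullP-+ pullP-* ≋-refl pullP-1 (vars is) d)
    (≋-trans (≋-reflexive (cong (λ xs → PolySym.h xs d) (pullP-vars is)))
    (≋-trans (PolySym.h-↭ (PermP.map⁺ var p) d) (≋-reflexive (sym (hsym-h is d))))))

  -- Coordinates and exponents are permuted alike, so only the order of the factors changes.
  evalM-pull : ∀ {k} (w : Vec (Fin k) n) m → evalM (point (pull u w)) (pull u m) ≡ evalM (point w) m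
  evalM-pull w m = trans (prodF-cong n λ q → cong₂ (λ b e → coordinate b ^q e) (lookup-pull u w q) (lookup-pull u m q))
    (prodF-perm (lookup u) (lookup u') uu' u'u (λ q → point w q ^q lookup m q))

  eval-pull : ∀ {k} (w : Vec (Fin k) n) p → eval (point (pull u w)) (pullP u p) ≡ eval (point w) p
  eval-pull w p = trans (lin-map (pull u) (evalM (point (pull u w))) p) (lin-cong (evalM-pull w) p)

  eval-push : ∀ {k} (w : Vec (Fin k) n) p → eval (point (pull u w)) p ≡ eval (point w) (pullP u' p)
  eval-push w p = trans (lin-cong (λ m → trans (cong (evalM (point (pull u w))) (sym (pull-inverse {u = u} {u'} m u'u))) (evalM-pull w (pull u' m))) p)
    (sym (lin-map (pull u') (evalM (point w)) p))

sumℕ-list : ∀ {n} (m : Monomial n) → degree m ≡ List.foldr _+_ 0 (map (lookup m) (allFin n))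
sumℕ-list [] = refl
sumℕ-list {suc n} (e ∷ m) = cong (e +_) (trans (sumℕ-list m) (cong (List.foldr _+_ 0)
  (trans (ListP.map-tabulate {n = n} id (lookup m)) (sym (ListP.map-tabulate {n = n} Fin.suc (lookup (e ∷ m)))))))

sumℕ-↭ : ∀ {xs ys} → xs ↭ ys → List.foldr _+_ 0 xs ≡ List.foldr _+_ 0 ys
sumℕ-↭ Perm.refl = refl
sumℕ-↭ (Perm.prep x p) = cong (x +_) (sumℕ-↭ p)
sumℕ-↭ (Perm.swap x y p) = trans (cong (λ z → x + (y + z)) (sumℕ-↭ p)) (+-leftSwap x y _)
sumℕ-↭ (Perm.trans p q) = trans (sumℕ-↭ p) (sumℕ-↭ q)

degree-pull : ∀ {n} (u u' : Vec (Fin n) n) → Inverse u u' → Inverse u' u → ∀ m → degree (pull u m) ≡ degree m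
degree-pull {n} u u' uu' u'u m = trans (sumℕ-list (pull u m)) (trans (cong (List.foldr _+_ 0) (trans (ListP.map-cong (lookup-pull u m) (allFin n)) (ListP.map-∘ (allFin n))))
  (trans (sumℕ-↭ (PermP.map⁺ (lookup m) (allFin-↭ (lookup u) (lookup u') uu' u'u))) (sym (sumℕ-list m))))

InBatch-unique : ∀ {r} (α : Vec ℕ r) q i i' → (offset α i ≤ q) × (q < offset α i + lookup α i) →
  (offset α i' ≤ q) × (q < offset α i' + lookup α i') → i ≡ i'
InBatch-unique (a ∷ α) q Fin.zero Fin.zero _ _ = refl
InBatch-unique (a ∷ α) q Fin.zero (Fin.suc i') (_ , lt) (le , _) = ⊥-elim (ℕP.<⇒≱ lt (ℕP.≤-trans (ℕP.m≤m+n a (offset α i')) le))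
InBatch-unique (a ∷ α) q (Fin.suc i) Fin.zero (le , _) (_ , lt) = ⊥-elim (ℕP.<⇒≱ lt (ℕP.≤-trans (ℕP.m≤m+n a (offset α i)) le))
InBatch-unique (a ∷ α) q (Fin.suc i) (Fin.suc i') b b' = cong Fin.suc (InBatch-unique α (q ∸ a) i i' (shift i b) (shift i' b'))
  where
  shift : ∀ i → (a + offset α i ≤ q) × (q < a + offset α i + lookup α i) → (offset α i ≤ q ∸ a) × (q ∸ a < offset α i + lookup α i)
  shift i (le , lt) = ℕP.m+n≤o⇒m≤o∸n (offset α i) (subst (_≤ q) (ℕP.+-comm a (offset α i)) le) ,
    ℕP.+-cancelˡ-< a (q ∸ a) _ (subst₂< (sym (ℕP.m+[n∸m]≡n (ℕP.≤-trans (ℕP.m≤m+n a (offset α i)) le))) (ℕP.+-assoc a (offset α i) (lookup α i)) lt)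
    where
    subst₂< : ∀ {x y z w} → x ≡ y → z ≡ w → x < z → y < w
    subst₂< refl refl lt = lt

coeff-++ : ∀ {X : Set} (_≟_ : DecidableEquality X) u v x → coeff _≟_ (u ++ v) x ≡ coeff _≟_ u x +q coeff _≟_ v x
coeff-++ _≟_ u v x = trans (coeff-lin (u ++ v) x) (trans (lin-++ (δ x) u v) (sym (cong₂ _+q_ (coeff-lin u x) (coeff-lin v x))))
  where open Decidable _≟_

coeff-scale : ∀ {X : Set} (_≟_ : DecidableEquality X) c v x → coeff _≟_ (scaleF c v) x ≡ c *q coeff _≟_ v x
coeff-scale _≟_ c v x = trans (coeff-lin (scaleF c v) x) (trans (lin-scale (δ x) c v) (sym (cong (c *q_) (coeff-lin v x))))
  where open Decidable _≟_

module Isomorphism {r} (k : ℕ) (α : Vec ℕ r) (0<k : 0 < k) (k≤n : k ≤ Vec.sum α)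
  (α-bounds : ∀ i → (1 ≤ lookup α i) × (lookup α i ≤ k)) where

  open Independence k α 0<k k≤n α-bounds public

  Code : Set
  Code = Vec (Fin n) n

  Preserves : Code → Set
  Preserves u = ∀ q i → InBatch α q i → InBatch α (lookup u q) i

  -- A permutation is stored as a pair of inverse tables. Tables can be enumerated without
  -- repetition, so the sum over the group becomes a sum over a list, which translations merely
  -- permute.
  Young : Code × Code → Set
  Young (u , u') = (Inverse u u' × Inverse u' u) × (Preserves u × Preserves u')

  InBatch? : ∀ (q : Fin n) i → Dec (InBatch α q i)
  InBatch? q i = (offset α i ℕ.≤? toℕ q) ×-dec (toℕ q ℕ.<? offset α i + lookup α i)

  Inverse? : ∀ (u u' : Code) → Dec (Inverse u u')
  Inverse? u u' = FinP.all? (λ q → lookup u (lookup u' q) FinP.≟ q)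

  Preserves? : ∀ u → Dec (Preserves u)
  Preserves? u = FinP.all? (λ q → FinP.all? (λ i → InBatch? q i →-dec InBatch? (lookup u q) i))

  Young? : Decidable Young
  Young? (u , u') = (Inverse? u u' ×-dec Inverse? u' u) ×-dec (Preserves? u ×-dec Preserves? u')

  codes : List Code
  codes = allVecs (allFin n) n

  young : List (Code × Code)
  young = List.filter Young? (List.cartesianProduct codes codes)

  ∈-young : ∀ {g} → Young g → g ∈ young
  ∈-young {u , u'} y = MemP.∈-filter⁺ Young? (MemP.∈-cartesianProduct⁺ (∈-allVecs u (λ i → MemP.∈-allFin (lookup u i))) (∈-allVecs u' (λ i → MemP.∈-allFin (lookup u' i)))) y

  young⁻ : ∀ {g} → g ∈ young → Young g
  young⁻ g∈ = proj₂ (MemP.∈-filter⁻ Young? {xs = List.cartesianProduct codes codes} g∈)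

  young-unique : Unique young
  young-unique = UniqueP.filter⁺ Young? (UniqueP.cartesianProduct⁺ (allVecs-unique n (UniqueP.allFin⁺ n)) (allVecs-unique n (UniqueP.allFin⁺ n)))

  identity : Code
  identity = tabulate id

  identity-young : Young (identity , identity)
  identity-young = (inv , inv) , (pres , pres)
    where
    inv : Inverse identity identity
    inv q = trans (VecP.lookup∘tabulate id (lookup identity q)) (VecP.lookup∘tabulate id q)
    pres : Preserves identity
    pres q i = subst (λ p → InBatch α p i) (sym (VecP.lookup∘tabulate id q))

  Young-OP : ∀ {u u'} → Young (u , u') → ∀ (w : Vec (Fin k) n) → IsOP α w → IsOP α (pull u w)
  Young-OP {u} {u'} ((uu' , u'u) , (pu , pu')) w (onto , distinct) =
    (λ b → lookup u' (proj₁ (onto b)) , trans (lookup-pull u w (lookup u' (proj₁ (onto b)))) (trans (cong (lookup w) (uu' (proj₁ (onto b)))) (proj₂ (onto b)))) ,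
    λ p p' i b b' ne eq → distinct (lookup u p) (lookup u p') i (pu p i b) (pu p' i b') (λ e → ne (trans (sym (u'u p)) (trans (cong (lookup u') e) (u'u p'))))
      (trans (sym (lookup-pull u w p)) (trans eq (lookup-pull u w p')))

  Young-sym : ∀ {u u'} → Young (u , u') → Young (u' , u)
  Young-sym ((a , b) , (c , d)) = (b , a) , (d , c)

  batch-↭ : ∀ {u u'} → Young (u , u') → ∀ i → map (lookup u') (batchVars n α i) ↭ batchVars n α i
  batch-↭ {u} {u'} ((uu' , u'u) , (pu , pu')) i = unique-↭
    (UniqueP.map⁺ (λ {p} {q} eq → trans (sym (uu' p)) (trans (cong (lookup u) eq) (uu' q))) (batchVars-unique n α i)) (batchVars-unique n α i) to from
    where
    to : ∀ {q} → q ∈ map (lookup u') (batchVars n α i) → q ∈ batchVars n α i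
    to q∈ with MemP.∈-map⁻ (lookup u') q∈
    ... | p , p∈ , refl = ∈-batchVars⁺ α i (pu' p i (∈-batchVars⁻ α i p∈))
    from : ∀ {q} → q ∈ batchVars n α i → q ∈ map (lookup u') (batchVars n α i)
    from {q} q∈ = subst (_∈ map (lookup u') (batchVars n α i)) (u'u q) (MemP.∈-map⁺ (lookup u') (∈-batchVars⁺ α i (pu q i (∈-batchVars⁻ α i q∈))))

  pullP∈J : ∀ {u u'} → Young (u , u') → ∀ {p} → InJ p → InJ (pullP u p)
  pullP∈J {u} {u'} y@((uu' , u'u) , _) = ideal-elim (λ p → InJ (pullP u p)) (λ e → ideal-≈ (pullP-≋ u u' uu' u'u e)) ideal-0
    (λ {p} {q} i j → ideal-≈ (≋-sym (pullP-+ u u' uu' u'u p q)) (ideal-+ i j))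
    (λ a {g} g∈ → ideal-≈ (≋-sym (≋-trans (pullP-* u u' uu' u'u a g) (mul-cong (≋-refl {p = pullP u a}) (invariant (generator g∈))))) (ideal-* (pullP u a) (ideal-gen g∈)))
    where
    invariant : ∀ {g} → Generator g → pullP u g ≋ g
    invariant (e-gen t _ eq) = subst (λ g → pullP u g ≋ g) (sym eq) (pullP-esym u u' uu' u'u (allFin n) (allFin-↭ (lookup u') (lookup u) u'u uu') (n ∸ t))
    invariant (h-gen i t _ eq) = subst (λ g → pullP u g ≋ g) (sym eq) (pullP-hsym u u' uu' u'u (batchVars n α i) (batch-↭ {u} {u'} y i) (k ∸ t))

  normaliser : ∃ λ c → c *q count young ≡ 1ℚ
  normaliser = inverse (count young) (count-≢0 (∈-young {identity , identity} identity-young))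

  c₀ : ℚ
  c₀ = proj₁ normaliser

  -- Word and monomial are moved by the same permutation, so without `N` this would be the
  -- evaluation at `w`.
  twisted : Vec (Fin k) n → Code × Code → Monomial n → ℚ
  twisted w (u , _) m = ev (pull u w) (N (pull u m))

  Φ : Vec (Fin k) n → Monomial n → ℚ
  Φ w m = c₀ *q sumL young (λ g → twisted w g m)

  lin-twisted : ∀ w u u' p → lin (twisted w (u , u')) p ≡ ev (pull u w) (N̂ (pullP u p))
  lin-twisted w u u' p = sym (trans (lin-bind N (evalM (point (pull u w))) (pullP u p)) (lin-map (pull u) (λ m → ev (pull u w) (N m)) p))

  lin-Φ : ∀ w p → lin (Φ w) p ≡ c₀ *q sumL young (λ g → lin (twisted w g) p)
  lin-Φ w p = trans (lin-* c₀ (λ m → sumL young (λ g → twisted w g m)) p) (cong (c₀ *q_) (lin-sumL young (twisted w) p))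

  -- The group preserves J, and the normal form of every element of J is zero.
  Φ-J : ∀ w {p} → InJ p → lin (Φ w) p ≡ 0ℚ
  Φ-J w {p} p∈ = trans (lin-Φ w p) (trans (cong (c₀ *q_) (trans (sumL-cong (All.tabulate λ {g} g∈ → vanish g (young⁻ g∈))) (sumL-0 young))) (ℚP.*-zeroʳ c₀))
    where
    vanish : ∀ g → Young g → lin (twisted w g) p ≡ 0ℚ
    vanish (u , u') y = trans (lin-twisted w u u' p) (lin-≋ (evalM (point (pull u w))) (N̂-J (pullP∈J {u} {u'} y p∈)))

  -- After moving `p` and `w`, passing to the normal form costs an evaluation of lower degree.
  -- Moving that correction back to `w` by the inverse permutation keeps its degree.
  twisted-leading : ∀ d p → All (λ t → degree (proj₂ t) ≡ d) p → ∀ g → Young g → Lower d (λ w → lin (twisted w g) p +q (-q ev w p))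
  twisted-leading d p a (u , u') y@((uu' , u'u) , _) = finish (J-lower d (N̂-≡ p'))
    where
    open +-*-Solver
    p' = pullP u p
    a' : All (λ t → degree (proj₂ t) ≡ d) p'
    a' = AllP.map⁺ (All.map (λ {t} eq → trans (degree-pull u u' uu' u'u (proj₂ t)) eq) a)
    difference : ∀ w → ev w (component d (p' -ₚ N̂ p')) ≡ ev w p' +q (-q ev w (N̂ p'))
    difference w = trans (cong (ev w) (component-all d (AllP.++⁺ a' (All-scale {P = λ m → degree m ≡ d} (-q 1ℚ) (N̂-degree (_≡ d) p' a')))))
      (MonoD.lin-minus (evalM (point w)) p' (N̂ p'))
    finish : Lower d (λ w → ev w (component d (p' -ₚ N̂ p'))) → Lower d (λ w → lin (twisted w (u , u')) p +q (-q ev w p))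
    finish (mkLower r (supp R R< e) eq) = mkLower (negP (pullP u' R))
      (supp (negP (pullP u' R)) (All-scale {P = λ m → degree m < d} (-q 1ℚ) (AllP.map⁺ (All.map (λ {t} lt → subst (_< d) (sym (degree-pull u' u u'u uu' (proj₂ t))) lt) R<))) ≋-refl)
      λ w op → begin
        lin (twisted w (u , u')) p +q (-q ev w p)
          ≡⟨ cong₂ (λ x z → x +q (-q z)) (lin-twisted w u u' p) (sym (eval-pull u u' uu' u'u w p)) ⟩
        ev (pull u w) (N̂ p') +q (-q ev (pull u w) p')
          ≡⟨ solve 2 (λ x z → x :+ :- z := :- (z :+ :- x)) refl (ev (pull u w) (N̂ p')) (ev (pull u w) p') ⟩
        -q (ev (pull u w) p' +q (-q ev (pull u w) (N̂ p')))
          ≡⟨ cong -q_ (trans (sym (difference (pull u w))) (trans (eq (pull u w) (Young-OP {u} {u'} y w op)) (lin-≋ (evalM (point (pull u w))) e))) ⟩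
        -q ev (pull u w) R
          ≡⟨ cong -q_ (eval-push u u' uu' u'u w R) ⟩
        -q ev w (pullP u' R)
          ≡⟨ eval-neg (point w) (pullP u' R) ⟨
        ev w (negP (pullP u' R)) ∎
      where open ≡-Reasoning

  -- The factor `c₀` gives the summands total weight 1, so the leading part is evaluation itself and
  -- not a multiple of it.
  Φ-leading : ∀ d p → All (λ t → degree (proj₂ t) ≡ d) p → Lower d (λ w → lin (Φ w) p +q (-q ev w p))
  Φ-leading d p a = finish (total young (All.tabulate λ {g} g∈ → twisted-leading d p a g (young⁻ g∈)))
    where
    open +-*-Solver
    total : ∀ gs → All (λ g → Lower d (λ w → lin (twisted w g) p +q (-q ev w p))) gs → Lower d (λ w → sumL gs (λ g → lin (twisted w g) p) +q (-q (count gs *q ev w p)))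
    total [] [] = mkLower zeroP Supp-0 (λ w _ → trans (ℚP.+-identityˡ (-q (0ℚ *q ev w p))) (cong -q_ (ℚP.*-zeroˡ (ev w p))))
    total (g ∷ gs) (mkLower r₁ r₁< eq₁ ∷ ls) = add (total gs ls)
      where
      add : Lower d (λ w → sumL gs (λ g → lin (twisted w g) p) +q (-q (count gs *q ev w p))) →
        Lower d (λ w → sumL (g ∷ gs) (λ g → lin (twisted w g) p) +q (-q (count (g ∷ gs) *q ev w p)))
      add (mkLower r₂ r₂< eq₂) = mkLower (r₁ +ₚ r₂) (Supp-+ r₁< r₂<) λ w op →
        trans (solve 4 (λ x s c e → (x :+ s) :+ :- ((con 1ℚ :+ c) :* e) := (x :+ :- e) :+ (s :+ :- (c :* e))) refl
          (lin (twisted w g) p) (sumL gs (λ g → lin (twisted w g) p)) (count gs) (ev w p))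
        (trans (cong₂ _+q_ (eq₁ w op) (eq₂ w op)) (sym (eval-+ (point w) r₁ r₂)))
    finish : Lower d (λ w → sumL young (λ g → lin (twisted w g) p) +q (-q (count young *q ev w p))) → Lower d (λ w → lin (Φ w) p +q (-q ev w p))
    finish (mkLower r r< eq) = mkLower (const c₀ *ₚ r) (Supp-* (λ {x} {z} dx lt → subst (_< d) (sym (trans (degree-⊕ x z) (cong (_+ degree z) dx))) lt) (const-Homogeneous c₀) r<) λ w op → begin
      lin (Φ w) p +q (-q ev w p)
        ≡⟨ cong₂ (λ x z → x +q (-q z)) (lin-Φ w p) (trans (sym (ℚP.*-identityˡ (ev w p))) (cong (_*q ev w p) (sym (proj₂ normaliser)))) ⟩
      c₀ *q S w +q (-q (c₀ *q count young *q ev w p))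
        ≡⟨ solve 4 (λ c s k e → c :* s :+ :- (c :* k :* e) := c :* (s :+ :- (k :* e))) refl c₀ (S w) (count young) (ev w p) ⟩
      c₀ *q (S w +q (-q (count young *q ev w p)))
        ≡⟨ cong₂ _*q_ (sym (eval-const (point w) c₀)) (eq w op) ⟩
      ev w (const c₀) *q ev w r
        ≡⟨ eval-* (point w) (const c₀) r ⟨
      ev w (const c₀ *ₚ r) ∎
      where
      open ≡-Reasoning
      S : Vec (Fin k) n → ℚ
      S w = sumL young (λ g → lin (twisted w g) p)

  -- The induced map to formal sums of words

  module ΦSpan = Span Φ Φ-leading

  OP? : Decidable (IsOP {n = n} {k = k} α)
  OP? w = FinP.all? (λ b → FinP.any? (λ p → lookup w p FinP.≟ b)) ×-dec
    FinP.all? (λ p → FinP.all? (λ p' → FinP.all? (λ i → InBatch? p i →-dec (InBatch? p' i →-dec (¬? (p FinP.≟ p') →-dec ¬? (lookup w p FinP.≟ lookup w p'))))))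

  opWords : List (Vec (Fin k) n)
  opWords = List.filter OP? (allVecs (allFin k) n)

  ∈-opWords : ∀ {w} → IsOP α w → w ∈ opWords
  ∈-opWords {w} op = MemP.∈-filter⁺ OP? (∈-allVecs w (λ i → MemP.∈-allFin (lookup w i))) op

  opWords⁻ : ∀ {w} → w ∈ opWords → IsOP α w
  opWords⁻ w∈ = proj₂ (MemP.∈-filter⁻ OP? {xs = allVecs (allFin k) n} w∈)

  opWords-unique : Unique opWords
  opWords-unique = UniqueP.filter⁺ OP? (allVecs-unique n (UniqueP.allFin⁺ k))

  module WD = Decidable (_≟w_ {n} {k})
  module WT = Tables (_≟w_ {n} {k})

  onOP : (Vec (Fin k) n → ℚ) → Words n k
  onOP f = table f opWords

  coeff-onOP : ∀ f {w} → IsOP α w → coeff _≟w_ (onOP f) w ≡ f w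
  coeff-onOP f op = WT.coeff-table-∈ f opWords-unique (∈-opWords op)

  onOP-supported : ∀ f → SupportedOnOP α (onOP f)
  onOP-supported f w ¬op = WT.coeff-table-∉ f opWords (¬op ∘ opWords⁻)

  φ : Poly n → Words n k
  φ p = onOP (λ w → lin (Φ w) p)

  supported-≈ : ∀ {u v : Words n k} → SupportedOnOP α u → SupportedOnOP α v → (∀ w → IsOP α w → coeff _≟w_ u w ≡ coeff _≟w_ v w) → u ≈w v
  supported-≈ su sv eq w with OP? w
  ... | yes op = eq w op
  ... | no ¬op = trans (su w ¬op) (sym (sv w ¬op))

  φ-respects : ∀ p q → InIdeal J (p -ₚ q) → φ p ≈w φ q
  φ-respects p q pq∈ = supported-≈ {φ p} {φ q} (onOP-supported _) (onOP-supported _) λ w op →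
    trans (coeff-onOP _ op) (trans (MonoD.minus-zero {n} (lin (Φ w) p) (lin (Φ w) q) (trans (sym (MonoD.lin-minus (Φ w) p q)) (Φ-J w {p -ₚ q} (member pq∈)))) (sym (coeff-onOP _ op)))

  φ-+ : ∀ p q → φ (p +ₚ q) ≈w (φ p ++ φ q)
  φ-+ p q = supported-≈ {φ (p +ₚ q)} {φ p ++ φ q} (onOP-supported _)
    (λ w ¬op → trans (coeff-++ _≟w_ (φ p) (φ q) w) (cong₂ _+q_ (onOP-supported _ w ¬op) (onOP-supported _ w ¬op))) λ w op →
    trans (coeff-onOP _ op) (trans (lin-++ (Φ w) p q) (sym (trans (coeff-++ _≟w_ (φ p) (φ q) w) (cong₂ _+q_ (coeff-onOP _ op) (coeff-onOP _ op)))))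

  φ-scale : ∀ c p → φ (scaleF c p) ≈w scaleF c (φ p)
  φ-scale c p = supported-≈ {φ (scaleF c p)} {scaleF c (φ p)} (onOP-supported _)
    (λ w ¬op → trans (coeff-scale _≟w_ c (φ p) w) (trans (cong (c *q_) (onOP-supported _ w ¬op)) (ℚP.*-zeroʳ c))) λ w op →
    trans (coeff-onOP _ op) (trans (lin-scale (Φ w) c p) (sym (trans (coeff-scale _≟w_ c (φ p) w) (cong (c *q_) (coeff-onOP _ op)))))

  -- The difference and its normal form have the same image. By independence an accepted polynomial
  -- with zero image is zero, so the difference reduces to 0 modulo J.
  φ-injective : ∀ p q → φ p ≈w φ q → InIdeal J (p -ₚ q)
  φ-injective p q eq = inIdeal (ideal-≈ (≋-trans (add-cong (≋-refl {p = d}) (neg-cong zero')) (≋-reflexive (ListP.++-identityʳ d))) (N̂-≡ d))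
    where
    d = p -ₚ q
    vanish : ∀ w → IsOP α w → lin (Φ w) d ≡ 0ℚ
    vanish w op = trans (MonoD.lin-minus (Φ w) p q) (trans (cong (_+q (-q lin (Φ w) q)) (trans (sym (coeff-onOP _ op)) (trans (eq w) (coeff-onOP _ op)))) (ℚP.+-inverseʳ (lin (Φ w) q)))
    zero' : N̂ d ≋ zeroP
    zero' = ΦSpan.independent (N̂ d) (N̂-accepted d) λ w op → trans
      (sym (MonoD.minus-zero {n} (lin (Φ w) d) (lin (Φ w) (N̂ d)) (trans (sym (MonoD.lin-minus (Φ w) d (N̂ d))) (Φ-J w (N̂-≡ d))))) (vanish w op)

  φ-surjective : ∀ v → SupportedOnOP α v → ∃ λ p → φ p ≈w v
  φ-surjective v sv = fromPreimage (All-degree< target)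
    where
    weight : ∀ w → ∃ λ c → c *q ev w (Separator.separator w) ≡ 1ℚ
    weight w = inverse (ev w (Separator.separator w)) (Separator.separator-nonzero w)
    g : Vec (Fin k) n → ℚ
    g w = proj₁ (weight w) *q coeff _≟w_ v w
    target : Poly n
    -- Interpolates the coefficients of `v` on OP by ordinary evaluation; `findPreimage` then trades
    -- evaluation for Φ.
    target = bind Separator.separator (onOP g)
    ev-target : ∀ w → IsOP α w → ev w target ≡ coeff _≟w_ v w
    ev-target w op = begin
      ev w target ≡⟨ lin-bind Separator.separator (evalM (point w)) (onOP g) ⟩
      lin (λ w₀ → ev w (Separator.separator w₀)) (onOP g) ≡⟨ lin-cong (λ w₀ → atw w₀ (w₀ ≟w w)) (onOP g) ⟩
      lin (λ w₀ → s *q WD.δ w w₀) (onOP g) ≡⟨ lin-* s (WD.δ w) (onOP g) ⟩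
      s *q lin (WD.δ w) (onOP g) ≡⟨ cong (s *q_) (trans (sym (WD.coeff-lin (onOP g) w)) (coeff-onOP g op)) ⟩
      s *q (proj₁ (weight w) *q coeff _≟w_ v w) ≡⟨ solve 3 (λ s c x → s :* (c :* x) := (c :* s) :* x) refl s (proj₁ (weight w)) (coeff _≟w_ v w) ⟩
      (proj₁ (weight w) *q s) *q coeff _≟w_ v w ≡⟨ cong (_*q coeff _≟w_ v w) (proj₂ (weight w)) ⟩
      1ℚ *q coeff _≟w_ v w ≡⟨ ℚP.*-identityˡ (coeff _≟w_ v w) ⟩
      coeff _≟w_ v w ∎
      where
      open ≡-Reasoning
      open +-*-Solver using (solve; _:=_; _:*_)
      s = ev w (Separator.separator w)
      atw : ∀ w₀ → Dec (w₀ ≡ w) → ev w (Separator.separator w₀) ≡ s *q WD.δ w w₀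
      atw w₀ (yes refl) = sym (trans (cong (s *q_) (WD.δ-refl w)) (ℚP.*-identityʳ s))
      atw w₀ (no ne) = trans (Separator.separator-≢ w₀ w (ne ∘ sym)) (sym (trans (cong (s *q_) (WD.δ-≢ {x = w} {y = w₀} ne)) (ℚP.*-zeroʳ s)))
    fromPreimage : (∃ λ d → All (λ t → degree (proj₂ t) < d) target) → ∃ λ p → φ p ≈w v
    fromPreimage (d , a) = hit (ΦSpan.findPreimage d target a)
      where
      hit : ΦSpan.Preimage d target → ∃ λ p → φ p ≈w v
      hit (ΦSpan.preimage p _ _ hits) = p , supported-≈ {φ p} {v} (onOP-supported _) sv λ w op → trans (coeff-onOP _ op) (trans (hits w op) (ev-target w op))

  module Equivariance (σ : Permutation′ n) (σ-young : InYoungSubgroup α σ) where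

    s s' : Code
    s = tabulate (σ ⟨$⟩ʳ_)
    s' = tabulate (σ ⟨$⟩ˡ_)

    lookup-s : ∀ q → lookup s q ≡ σ ⟨$⟩ʳ q
    lookup-s = VecP.lookup∘tabulate (σ ⟨$⟩ʳ_)

    lookup-s' : ∀ q → lookup s' q ≡ σ ⟨$⟩ˡ q
    lookup-s' = VecP.lookup∘tabulate (σ ⟨$⟩ˡ_)

    ss' : Inverse s s'
    ss' q = trans (lookup-s (lookup s' q)) (trans (cong (σ ⟨$⟩ʳ_) (lookup-s' q)) (inverseʳ σ))

    s's : Inverse s' s
    s's q = trans (lookup-s' (lookup s q)) (trans (cong (σ ⟨$⟩ˡ_) (lookup-s q)) (inverseˡ σ))

    s-preserves : Preserves s
    s-preserves q i b = subst (λ p → InBatch α p i) (sym (lookup-s q)) (σ-young q i b)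

    -- `InYoungSubgroup` speaks only of σ. The batch that contains the preimage of q is carried by σ
    -- into itself, so it contains q, and batches are disjoint.
    s'-preserves : Preserves s'
    s'-preserves q i b = fromBatch (locate α (toℕ (lookup s' q)) (FinP.toℕ<n (lookup s' q)))
      where
      fromBatch : (∃ λ i' → ∃ λ j → j < lookup α i' × toℕ (lookup s' q) ≡ offset α i' + j) → InBatch α (lookup s' q) i
      fromBatch (i' , j , j< , eq) = subst (InBatch α (lookup s' q))
          (InBatch-unique α (toℕ q) i' i (subst (λ p → InBatch α p i') (ss' q) (s-preserves (lookup s' q) i' inB)) b) inB
        where
        inB : InBatch α (lookup s' q) i'
        inB = subst (offset α i' ≤_) (sym eq) (ℕP.m≤m+n (offset α i') j) , subst (_< offset α i' + lookup α i') (sym eq) (ℕP.+-monoʳ-< (offset α i') j<)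

    s-young : Young (s , s')
    s-young = (ss' , s's) , (s-preserves , s'-preserves)

    Young-∘ : ∀ {u u' v v'} → Young (u , u') → Young (v , v') → Young (pull u v , pull v' u')
    Young-∘ {u} {u'} {v} {v'} ((uu' , u'u) , (pu , pu')) ((vv' , v'v) , (pv , pv')) =
      ((λ q → trans (lookup-pull u v (lookup (pull v' u') q)) (trans (cong (lookup v ∘ lookup u) (lookup-pull v' u' q)) (trans (cong (lookup v) (uu' (lookup v' q))) (vv' q)))) ,
       (λ q → trans (lookup-pull v' u' (lookup (pull u v) q)) (trans (cong (lookup u' ∘ lookup v') (lookup-pull u v q)) (trans (cong (lookup u') (v'v (lookup u q))) (u'u q))))) ,
      ((λ q i b → subst (λ p → InBatch α p i) (sym (lookup-pull u v q)) (pv (lookup u q) i (pu q i b))) ,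
       (λ q i b → subst (λ p → InBatch α p i) (sym (lookup-pull v' u' q)) (pu' (lookup v' q) i (pv' q i b))))

    -- Translations of the group by σ⁻¹ and σ; the second table of each pair is updated to stay
    -- inverse to the first.
    translate untranslate : Code × Code → Code × Code
    translate (u , u') = pull u s' , pull s u'
    untranslate (u , u') = pull u s , pull s' u'

    cancel : ∀ {a b : Code} → Inverse a b → ∀ u → pull (pull u b) a ≡ u
    cancel {a} {b} inv u = lookup-ext λ q → trans (lookup-pull (pull u b) a q) (trans (cong (lookup a) (lookup-pull u b q)) (inv (lookup u q)))

    untranslate-translate : ∀ g → untranslate (translate g) ≡ g
    untranslate-translate (u , u') = cong₂ _,_ (cancel {s} {s'} ss' u) (pull-inverse {u = s'} {s} u' ss')

    translate-untranslate : ∀ g → translate (untranslate g) ≡ g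
    translate-untranslate (u , u') = cong₂ _,_ (cancel {s'} {s} s's u) (pull-inverse {u = s} {s'} u' s's)

    translate-↭ : map translate young ↭ young
    translate-↭ = unique-↭ (UniqueP.map⁺ (λ {g} {h} eq → trans (sym (untranslate-translate g)) (trans (cong untranslate eq) (untranslate-translate h))) young-unique) young-unique to from
      where
      to : ∀ {g} → g ∈ map translate young → g ∈ young
      to g∈ with MemP.∈-map⁻ translate g∈
      ... | (u , u') , h∈ , refl = ∈-young {translate (u , u')} (Young-∘ {u} {u'} {s'} {s} (young⁻ {u , u'} h∈) (Young-sym {s} {s'} s-young))
      from : ∀ {g} → g ∈ young → g ∈ map translate young
      from {u , u'} g∈ = subst (_∈ map translate young) (translate-untranslate (u , u')) (MemP.∈-map⁺ translate (∈-young {untranslate (u , u')} (Young-∘ {u} {u'} {s} {s'} (young⁻ {u , u'} g∈) s-young)))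

    -- Moving the monomial instead of the word only reindexes the sum over the group by a
    -- translation.
    Φ-equivariant : ∀ w m → Φ w (pull s' m) ≡ Φ (pull s w) m
    Φ-equivariant w m = cong (c₀ *q_) (trans (sumL-cong (All.universal same young)) (trans (sym (sumL-map translate (λ g → twisted (pull s w) g m) young)) (sumL-↭ (λ g → twisted (pull s w) g m) translate-↭)))
      where
      same : ∀ g → twisted w g (pull s' m) ≡ twisted (pull s w) (translate g) m
      same (u , u') = cong₂ (λ w' m' → ev w' (N m')) (sym (trans (pull-pull (pull u s') s w) (cong (λ x → pull x w) (cancel {s} {s'} ss' u)))) (pull-pull u s' m)

    actMon-pull : ∀ m → actMon σ m ≡ pull s' m
    actMon-pull m = VecP.tabulate-cong λ q → cong (lookup m) (sym (lookup-s' q))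

    actWord-pull : ∀ (w : Vec (Fin k) n) → actWord σ w ≡ pull s' w
    actWord-pull w = VecP.tabulate-cong λ q → cong (lookup w) (sym (lookup-s' q))

    coeff-actW : ∀ v w → coeff _≟w_ (actW σ v) w ≡ coeff _≟w_ v (pull s w)
    coeff-actW v w = trans (WD.coeff-lin (actW σ v) w) (trans (lin-map (actWord σ) (WD.δ w) v) (trans (lin-cong (λ x → same x (x ≟w pull s w)) v) (sym (WD.coeff-lin v (pull s w)))))
      where
      same : ∀ x → Dec (x ≡ pull s w) → WD.δ w (actWord σ x) ≡ WD.δ (pull s w) x
      same x (yes refl) = trans (cong (WD.δ w) (trans (actWord-pull (pull s w)) (pull-inverse {u = s'} {s} w ss'))) (trans (WD.δ-refl w) (sym (WD.δ-refl (pull s w))))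
      same x (no ne) = trans (WD.δ-≢ {x = w} {y = actWord σ x} (λ eq → ne (trans (sym (pull-inverse {u = s} {s'} x s's)) (cong (pull s) (trans (sym (actWord-pull x)) eq)))))
        (sym (WD.δ-≢ {x = pull s w} {y = x} ne))

    φ-equivariant : ∀ p → φ (actP σ p) ≈w actW σ (φ p)
    φ-equivariant p = supported-≈ {φ (actP σ p)} {actW σ (φ p)} (onOP-supported _)
      (λ w ¬op → trans (coeff-actW (φ p) w) (onOP-supported _ (pull s w) (λ op → ¬op (subst (IsOP α) (pull-inverse {u = s'} {s} w ss') (Young-OP {s'} {s} (Young-sym {s} {s'} s-young) (pull s w) op)))))
      λ w op → trans (coeff-onOP _ op) (trans (trans (lin-map (actMon σ) (Φ w) p) (lin-cong (λ m → trans (cong (Φ w) (actMon-pull m)) (Φ-equivariant w m)) p))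
        (sym (trans (coeff-actW (φ p) w) (coeff-onOP _ (Young-OP {s} {s'} s-young w op)))))

  moduleIso : ModuleIso n k α
  moduleIso = φ , (λ p → onOP-supported _) , φ-respects , φ-+ , φ-scale , φ-injective , φ-surjective , λ σ y p → Equivariance.φ-equivariant σ y p

theorem3p10 : ∀ {r : ℕ} (n k : ℕ) (α : Vec ℕ r)
    → 0 < k
    → k ≤ n
    → (∀ (i : Fin r) → (1 ≤ lookup α i) × (lookup α i ≤ k))
    → sum α ≡ n
    → (∀ (m : Monomial n) → Standard (Jgens n k α) m ⇔ Nonskip k α m)
    × ModuleIso n k α
theorem3p10 n k α 0<k k≤n α-bounds refl = (λ m → mk⇔ (Standard⇒Nonskip {m}) (Nonskip⇒Standard {m})) , moduleIso
  where open Isomorphism k α 0<k k≤n α-bounds
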